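{- There is a randomized distributed algorithm such that for any unweighted undirected graph $G=(V,E)$ on $n$ vertices, any integer $\lambda$ with $1\le \lambda\le \ln n$, and any real $c>3$, the algorithm, run on $G$ with parameters $\lambda$ and $c$, computes, with probability at least $1-3/c$, a strong $\left(2(cn)^{1/\lambda}\cdot\ln(cn),\ \lambda\right)$ network decomposition of $G$. The number of rounds required is $\lambda(cn)^{1/\lambda}\cdot\ln (cn)$, and each message consists of $O(1)$ words.
   Context: Network decomposition: let $\mathcal{P}$ be a partition of $V$ into disjoint clusters. The supergraph $\mathcal{G}(\mathcal{P})$ has the clusters as vertices, and two distinct clusters $C\neq C'$ are adjacent iff some edge of $G$ joins a vertex of $C$ to a vertex of $C'$. The strong diameter of a cluster $C$ is $\max_{v,v'\in C} d_{G(C)}(v,v')$, where $G(C)$ is the subgraph of $G$ induced by $C$ and $d_{G(C)}$ is its shortest-path distance. $\mathcal{P}$ is a strong $(D,\chi)$ network decomposition of $G$ if every cluster has strong diameter at most $D$ and $\mathcal{G}(\mathcal{P})$ can be properly colored with at most $\chi$ colors. Model: each vertex of $G$ hosts a processor with a distinct identity number from $\{1,\dots,n\}$. The processors have private randomness and communicate over the edges of $G$ in synchronous rounds; the running time is the number of rounds. A word is $O(\log n)$ bits, so messages of $O(1)$ words fit the CONGEST model. The algorithm computes a partition when, at its end, each vertex knows (an identifier of) its cluster. -}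

module Defs where

open import Data.Bool.Base using (Bool; true; false; T; if_then_else_)
open import Data.Fin.Base using (Fin)
open import Data.Fin.Permutation using (Permutation′; _⟨$⟩ʳ_; _⟨$⟩ˡ_)
import Data.Integer.Base as ℤ
import Data.Integer.Properties as ℤₚ
open import Data.List.Base using (List; [])
import Data.Nat.Coprimality as Coprime
open import Data.Nat.Base as ℕ using (ℕ; zero; suc)
import Data.Nat.Properties as ℕₚ
open import Data.Product.Base using (Σ; ∃; _×_; _,_; proj₁; proj₂)
open import Data.Rational.Base as ℚ using (ℚ; mkℚ; 0ℚ; 1ℚ; ½; 1/_)
import Data.Rational.Properties as ℚₚ
open import Data.Rational.Solver using (module +-*-Solver)
open import Data.Sum.Base using (_⊎_; inj₁; inj₂)
open import Data.Vec.Base as Vec using (Vec; []; _∷_)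
open import Relation.Binary.Core using (Rel)
open import Relation.Binary.PropositionalEquality
  using (_≡_; _≢_; refl; sym; trans; cong; cong₂; subst)
open import Relation.Nullary.Decidable.Core using (Dec; yes; no)
open import Relation.Nullary.Negation using (contradiction)
open import Level using (0ℓ)

open +-*-Solver using (solve; _:=_; _:+_; _:*_; _:-_; :-_; con)

0≤diff : ∀ {p q} → p ℚ.≤ q → 0ℚ ℚ.≤ q ℚ.- p
0≤diff {p} {q} p≤q =
  subst (ℚ._≤ q ℚ.- p) (ℚₚ.+-inverseʳ p) (ℚₚ.+-monoˡ-≤ (ℚ.- p) p≤q)

certify : ∀ {p q} d → 0ℚ ℚ.≤ d → q ℚ.- p ≡ d → p ℚ.≤ q
certify {p} {q} d 0≤d eq = begin
  p                    ≡⟨ ℚₚ.+-identityˡ p ⟨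
  0ℚ ℚ.+ p             ≤⟨ ℚₚ.+-monoˡ-≤ p 0≤d ⟩
  d ℚ.+ p              ≡⟨ cong (ℚ._+ p) eq ⟨
  (q ℚ.- p) ℚ.+ p      ≡⟨ ring p q ⟩
  q                    ∎
  where
  open ℚₚ.≤-Reasoning
  ring : ∀ p q → (q ℚ.- p) ℚ.+ p ≡ q
  ring = solve 2 (λ p q → (q :- p) :+ p := q) refl

0≤+ : ∀ {p q} → 0ℚ ℚ.≤ p → 0ℚ ℚ.≤ q → 0ℚ ℚ.≤ p ℚ.+ q
0≤+ = ℚₚ.+-mono-≤

p≤p+q : ∀ {q} p → 0ℚ ℚ.≤ q → p ℚ.≤ p ℚ.+ q
p≤p+q {q} p 0≤q = subst (ℚ._≤ p ℚ.+ q) (ℚₚ.+-identityʳ p) (ℚₚ.+-monoʳ-≤ p 0≤q)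

*-monoʳ : ∀ {p q} r → 0ℚ ℚ.≤ r → p ℚ.≤ q → r ℚ.* p ℚ.≤ r ℚ.* q
*-monoʳ r 0≤r = ℚₚ.*-monoˡ-≤-nonNeg r {{ℚ.nonNegative 0≤r}}

*-monoˡ : ∀ {p q} r → 0ℚ ℚ.≤ r → p ℚ.≤ q → p ℚ.* r ℚ.≤ q ℚ.* r
*-monoˡ r 0≤r = ℚₚ.*-monoʳ-≤-nonNeg r {{ℚ.nonNegative 0≤r}}

0≤* : ∀ {p q} → 0ℚ ℚ.≤ p → 0ℚ ℚ.≤ q → 0ℚ ℚ.≤ p ℚ.* q
0≤* {p} {q} 0≤p 0≤q = subst (ℚ._≤ p ℚ.* q) (ℚₚ.*-zeroʳ p) (*-monoʳ p 0≤p 0≤q)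

0<* : ∀ {p q} → 0ℚ ℚ.< p → 0ℚ ℚ.< q → 0ℚ ℚ.< p ℚ.* q
0<* {p} {q} 0<p 0<q =
  subst (ℚ._< p ℚ.* q) (ℚₚ.*-zeroʳ p) (ℚₚ.*-monoʳ-<-pos p {{ℚ.positive 0<p}} 0<q)

0<1/ : ∀ {p} → (0<p : 0ℚ ℚ.< p) → 0ℚ ℚ.< (1/ p) {{ℚ.>-nonZero 0<p}}
0<1/ {p} 0<p = ℚₚ.positive⁻¹ _ {{ℚₚ.1/pos⇒pos p {{ℚ.positive 0<p}}}}

0<1 : 0ℚ ℚ.< 1ℚ
0<1 = ℚₚ.positive⁻¹ 1ℚ

0≤1 : 0ℚ ℚ.≤ 1ℚ
0≤1 = ℚₚ.<⇒≤ 0<1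

half : ℚ → ℚ
half p = p ℚ.* ½

0<half : ∀ {p} → 0ℚ ℚ.< p → 0ℚ ℚ.< half p
0<half 0<p = 0<* 0<p (ℚₚ.positive⁻¹ ½)

half+half : ∀ p → half p ℚ.+ half p ≡ p
half+half p = trans (sym (ℚₚ.*-distribˡ-+ p ½ ½)) (ℚₚ.*-identityʳ p)

shrink : ∀ B ε → 0ℚ ℚ.< B → 0ℚ ℚ.< ε → ∃ λ δ → 0ℚ ℚ.< δ × B ℚ.* δ ≡ ε
shrink B ε 0<B 0<ε = ε ℚ.* B⁻¹ , 0<* 0<ε (0<1/ 0<B) , eq
  where
  instance _ = ℚ.>-nonZero 0<B
  B⁻¹ = 1/ B
  eq : B ℚ.* (ε ℚ.* B⁻¹) ≡ ε
  eq = trans (ring B ε B⁻¹)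
             (trans (cong (ε ℚ.*_) (ℚₚ.*-inverseʳ B)) (ℚₚ.*-identityʳ ε))
    where
    ring : ∀ b e i → b ℚ.* (e ℚ.* i) ≡ e ℚ.* (b ℚ.* i)
    ring = solve 3 (λ b e i → b :* (e :* i) := e :* (b :* i)) refl

ℕ→ℚ : ℕ → ℚ
ℕ→ℚ n = (ℤ.+ n) ℚ./ 1

1/suc : ℕ → ℚ
1/suc n = (ℤ.+ 1) ℚ./ suc n

ℕ→ℚ-mkℚ : ∀ n → ℕ→ℚ n ≡ mkℚ (ℤ.+ n) 0 (Coprime.sym (Coprime.1-coprimeTo n))
ℕ→ℚ-mkℚ n = ℚₚ.normalize-coprime _

ℕ→ℚ-suc : ∀ n → ℕ→ℚ (suc n) ≡ ℕ→ℚ n ℚ.+ 1ℚ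
ℕ→ℚ-suc n = trans (cong (ℚ._/ 1) eq) (cong (ℚ._+ 1ℚ) (sym (ℕ→ℚ-mkℚ n)))
  where
  eq : ℤ.+ suc n ≡ (ℤ.+ n) ℤ.* (ℤ.+ 1) ℤ.+ (ℤ.+ 1)
  eq = trans (cong ℤ.+_ (sym (ℕₚ.+-comm n 1)))
             (cong (ℤ._+ (ℤ.+ 1)) (sym (ℤₚ.*-identityʳ (ℤ.+ n))))

0≤ℕ→ℚ : ∀ n → 0ℚ ℚ.≤ ℕ→ℚ n
0≤ℕ→ℚ n = ℚₚ.nonNegative⁻¹ _ {{ℚₚ.normalize-nonNeg n 1}}

0<1/suc : ∀ n → 0ℚ ℚ.< 1/suc n
0<1/suc n = ℚₚ.positive⁻¹ _ {{ℚₚ.normalize-pos 1 (suc n)}}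

1/suc-inverse : ∀ n → 1/suc n ℚ.* ℕ→ℚ (suc n) ≡ 1ℚ
1/suc-inverse n = trans
  (cong₂ ℚ._*_ (ℚₚ.normalize-coprime (Coprime.1-coprimeTo (suc n))) (ℕ→ℚ-mkℚ (suc n)))
  (ℚₚ.*-inverseˡ (mkℚ (ℤ.+ suc n) 0 (Coprime.sym (Coprime.1-coprimeTo (suc n)))))

archimedean : ∀ p → ∃ λ n → p ℚ.≤ ℕ→ℚ n
archimedean p@(mkℚ (ℤ.+ m) d-1 _) = m , subst (p ℚ.≤_) (sym (ℕ→ℚ-mkℚ m))
  (ℚ.*≤* (ℤₚ.*-monoˡ-≤-nonNeg (ℤ.+ m) (ℤ.+≤+ (ℕ.s≤s ℕ.z≤n))))
archimedean p@(mkℚ ℤ.-[1+ m ] d-1 _) = 0 , ℚ.*≤* ℤ.-≤+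

ℕ→ℚ-mono : ∀ {m n} → m ℕ.≤ n → ℕ→ℚ m ℚ.≤ ℕ→ℚ n
ℕ→ℚ-mono {m} {n} m≤n = go (ℕₚ.≤⇒≤′ m≤n)
  where
  go : ∀ {n} → m ℕ.≤′ n → ℕ→ℚ m ℚ.≤ ℕ→ℚ n
  go ℕ.≤′-refl = ℚₚ.≤-refl
  go {suc n} (ℕ.≤′-step m≤n) = ℚₚ.≤-trans (go m≤n)
    (subst (ℕ→ℚ n ℚ.≤_) (sym (ℕ→ℚ-suc n)) (p≤p+q (ℕ→ℚ n) 0≤1))

1/suc-small : ∀ K ε → 0ℚ ℚ.≤ K → 0ℚ ℚ.< ε →
              ∃ λ N → ∀ n → N ℕ.≤ n → K ℚ.* 1/suc n ℚ.≤ ε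
1/suc-small K ε 0≤K 0<ε = N , λ n N≤n → begin
  K ℚ.* 1/suc n
    ≡⟨ cong (ℚ._* 1/suc n) (trans (sym (ℚₚ.*-identityʳ K)) (cong (K ℚ.*_) (sym εε⁻¹≡1))) ⟩
  K ℚ.* (ε ℚ.* ε⁻¹) ℚ.* 1/suc n
    ≡⟨ ring K ε ε⁻¹ (1/suc n) ⟩
  ε ℚ.* (1/suc n ℚ.* (K ℚ.* ε⁻¹))
    ≤⟨ *-monoʳ ε (ℚₚ.<⇒≤ 0<ε) (*-monoʳ (1/suc n) (ℚₚ.<⇒≤ (0<1/suc n))
         (ℚₚ.≤-trans bound (ℕ→ℚ-mono (ℕₚ.≤-trans N≤n (ℕₚ.n≤1+n n))))) ⟩
  ε ℚ.* (1/suc n ℚ.* ℕ→ℚ (suc n))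
    ≡⟨ trans (cong (ε ℚ.*_) (1/suc-inverse n)) (ℚₚ.*-identityʳ ε) ⟩
  ε ∎
  where
  open ℚₚ.≤-Reasoning
  ε⁻¹ = proj₁ (shrink ε 1ℚ 0<ε 0<1)
  εε⁻¹≡1 = proj₂ (proj₂ (shrink ε 1ℚ 0<ε 0<1))
  N = proj₁ (archimedean (K ℚ.* ε⁻¹))
  bound = proj₂ (archimedean (K ℚ.* ε⁻¹))
  ring : ∀ k e i s → k ℚ.* (e ℚ.* i) ℚ.* s ≡ e ℚ.* (s ℚ.* (k ℚ.* i))
  ring = solve 4 (λ k e i s → k :* (e :* i) :* s := e :* (s :* (k :* i))) refl

-- As m and n are interchangeable, cauchy bounds the absolute difference.
record ℝ : Set where
  field
    approx : ℕ → ℚ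
    cauchy : ∀ ε → 0ℚ ℚ.< ε → ∃ λ N → ∀ m n → N ℕ.≤ m → N ℕ.≤ n →
             approx m ℚ.≤ approx n ℚ.+ ε

open ℝ public

infix  4 _≤_ _<_ _≈_ _⟶_
infixl 6 _+_ _-_
infixl 7 _*_

_≤_ _<_ _≈_ : Rel ℝ 0ℓ
x ≤ y = ∀ ε → 0ℚ ℚ.< ε → ∃ λ N → ∀ n → N ℕ.≤ n → approx x n ℚ.≤ approx y n ℚ.+ ε
x < y = ∃ λ ε → 0ℚ ℚ.< ε × ∃ λ N → ∀ n → N ℕ.≤ n → approx x n ℚ.+ ε ℚ.≤ approx y n
x ≈ y = x ≤ y × y ≤ x

_⟶_ : (ℕ → ℚ) → ℝ → Set
u ⟶ x = ∀ ε → 0ℚ ℚ.< ε → ∃ λ N → ∀ n → N ℕ.≤ n →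
        u n ℚ.≤ approx x n ℚ.+ ε × approx x n ℚ.≤ u n ℚ.+ ε

fromℚ : ℚ → ℝ
fromℚ p .approx _ = p
fromℚ p .cauchy ε 0<ε = 0 , λ _ _ _ _ → p≤p+q p (ℚₚ.<⇒≤ 0<ε)

fromℕ : ℕ → ℝ
fromℕ n = fromℚ (ℕ→ℚ n)

_+_ : ℝ → ℝ → ℝ
(x + y) .approx n = approx x n ℚ.+ approx y n
(x + y) .cauchy ε 0<ε = N ℕ.⊔ M , λ m n N⊔M≤m N⊔M≤n → begin
  approx x m ℚ.+ approx y m
    ≤⟨ ℚₚ.+-mono-≤
         (x-close m n (ℕₚ.≤-trans (ℕₚ.m≤m⊔n N M) N⊔M≤m) (ℕₚ.≤-trans (ℕₚ.m≤m⊔n N M) N⊔M≤n))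
         (y-close m n (ℕₚ.≤-trans (ℕₚ.m≤n⊔m N M) N⊔M≤m) (ℕₚ.≤-trans (ℕₚ.m≤n⊔m N M) N⊔M≤n)) ⟩
  (approx x n ℚ.+ half ε) ℚ.+ (approx y n ℚ.+ half ε)
    ≡⟨ ring (approx x n) (approx y n) (half ε) ⟩
  (approx x n ℚ.+ approx y n) ℚ.+ (half ε ℚ.+ half ε)
    ≡⟨ cong (approx x n ℚ.+ approx y n ℚ.+_) (half+half ε) ⟩
  (approx x n ℚ.+ approx y n) ℚ.+ ε ∎
  where
  open ℚₚ.≤-Reasoning
  N = proj₁ (cauchy x (half ε) (0<half 0<ε))
  M = proj₁ (cauchy y (half ε) (0<half 0<ε))
  x-close = proj₂ (cauchy x (half ε) (0<half 0<ε))
  y-close = proj₂ (cauchy y (half ε) (0<half 0<ε))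
  ring : ∀ a b h → (a ℚ.+ h) ℚ.+ (b ℚ.+ h) ≡ (a ℚ.+ b) ℚ.+ (h ℚ.+ h)
  ring = solve 3 (λ a b h → (a :+ h) :+ (b :+ h) := (a :+ b) :+ (h :+ h)) refl

neg : ℝ → ℝ
neg x .approx n = ℚ.- approx x n
neg x .cauchy ε 0<ε = N , λ m n N≤m N≤n →
  certify _ (0≤diff (close n m N≤n N≤m)) (ring (approx x m) (approx x n) ε)
  where
  N = proj₁ (cauchy x ε 0<ε)
  close = proj₂ (cauchy x ε 0<ε)
  ring : ∀ a b e → (ℚ.- b ℚ.+ e) ℚ.- (ℚ.- a) ≡ (a ℚ.+ e) ℚ.- b
  ring = solve 3 (λ a b e → (:- b :+ e) :- (:- a) := (a :+ e) :- b) refl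

_-_ : ℝ → ℝ → ℝ
x - y = x + neg y

bounded : ∀ x → ∃ λ B → 0ℚ ℚ.< B × ∃ λ N → ∀ n → N ℕ.≤ n →
          approx x n ℚ.≤ B × ℚ.- approx x n ℚ.≤ B
bounded x = B , 0<B , N , λ n N≤n →
    ℚₚ.≤-trans (close n N N≤n ℕₚ.≤-refl)
      (ℚₚ.+-monoˡ-≤ 1ℚ (ℚₚ.≤-trans (ℚₚ.p≤p⊔q a 0ℚ) (p≤p+q (a ℚ.⊔ 0ℚ) (ℚₚ.p≤q⊔p (ℚ.- a) 0ℚ))))
  , ℚₚ.≤-trans
      (certify {q = ℚ.- a ℚ.+ 1ℚ} _ (0≤diff (close N n ℕₚ.≤-refl N≤n)) (ring a (approx x n) 1ℚ))
      (ℚₚ.+-monoˡ-≤ 1ℚ (ℚₚ.≤-trans (ℚₚ.p≤p⊔q (ℚ.- a) 0ℚ)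
        (subst (ℚ.- a ℚ.⊔ 0ℚ ℚ.≤_) (ℚₚ.+-comm (ℚ.- a ℚ.⊔ 0ℚ) (a ℚ.⊔ 0ℚ))
          (p≤p+q (ℚ.- a ℚ.⊔ 0ℚ) (ℚₚ.p≤q⊔p a 0ℚ)))))
  where
  N = proj₁ (cauchy x 1ℚ 0<1)
  close = proj₂ (cauchy x 1ℚ 0<1)
  a = approx x N
  B = ((a ℚ.⊔ 0ℚ) ℚ.+ (ℚ.- a ℚ.⊔ 0ℚ)) ℚ.+ 1ℚ
  0<B : 0ℚ ℚ.< B
  0<B = ℚₚ.+-mono-≤-< (0≤+ (ℚₚ.p≤q⊔p a 0ℚ) (ℚₚ.p≤q⊔p (ℚ.- a) 0ℚ)) 0<1
  ring : ∀ a b e → (ℚ.- a ℚ.+ e) ℚ.- (ℚ.- b) ≡ (b ℚ.+ e) ℚ.- a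
  ring = solve 3 (λ a b e → (:- a :+ e) :- (:- b) := (b :+ e) :- a) refl

*-bound : ∀ {a b B δ} → a ℚ.≤ B → ℚ.- a ℚ.≤ B → b ℚ.≤ δ → ℚ.- b ℚ.≤ δ → a ℚ.* b ℚ.≤ B ℚ.* δ
*-bound {a} {b} {B} {δ} a≤B -a≤B b≤δ -b≤δ = certify
  (half ((B ℚ.- a) ℚ.* (δ ℚ.- (ℚ.- b)) ℚ.+ (B ℚ.- (ℚ.- a)) ℚ.* (δ ℚ.- b)))
  (0≤* (0≤+ (0≤* (0≤diff a≤B) (0≤diff -b≤δ)) (0≤* (0≤diff -a≤B) (0≤diff b≤δ)))
       (ℚₚ.nonNegative⁻¹ ½))
  (ring a b B δ)
  where
  ring : ∀ a b B δ → B ℚ.* δ ℚ.- a ℚ.* b ≡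
    ((B ℚ.- a) ℚ.* (δ ℚ.- (ℚ.- b)) ℚ.+ (B ℚ.- (ℚ.- a)) ℚ.* (δ ℚ.- b)) ℚ.* ½
  ring = solve 4 (λ a b B δ → B :* δ :- a :* b :=
    ((B :- a) :* (δ :- (:- b)) :+ (B :- (:- a)) :* (δ :- b)) :* con ½) refl

_*_ : ℝ → ℝ → ℝ
(x * y) .approx n = approx x n ℚ.* approx y n
(x * y) .cauchy ε 0<ε = K , λ m n K≤m K≤n →
  let am = approx x m ; an = approx x n ; bm = approx y m ; bn = approx y n in begin
  am ℚ.* bm
    ≡⟨ ring₁ am bm an bn ⟩
  an ℚ.* bn ℚ.+ (am ℚ.* (bm ℚ.- bn) ℚ.+ bn ℚ.* (am ℚ.- an))
    ≤⟨ ℚₚ.+-monoʳ-≤ (an ℚ.* bn) (ℚₚ.+-mono-≤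
         (*-bound (ℚₚ.≤-trans (proj₁ (x-bounded m (ℕₚ.≤-trans N₁≤K K≤m))) Bx≤B)
                  (ℚₚ.≤-trans (proj₂ (x-bounded m (ℕₚ.≤-trans N₁≤K K≤m))) Bx≤B)
                  (diff≤ bm bn (y-close m n (ℕₚ.≤-trans M₂≤K K≤m) (ℕₚ.≤-trans M₂≤K K≤n)))
                  (-diff≤ bm bn (y-close n m (ℕₚ.≤-trans M₂≤K K≤n) (ℕₚ.≤-trans M₂≤K K≤m))))
         (*-bound (ℚₚ.≤-trans (proj₁ (y-bounded n (ℕₚ.≤-trans N₂≤K K≤n))) By≤B)
                  (ℚₚ.≤-trans (proj₂ (y-bounded n (ℕₚ.≤-trans N₂≤K K≤n))) By≤B)
                  (diff≤ am an (x-close m n (ℕₚ.≤-trans M₁≤K K≤m) (ℕₚ.≤-trans M₁≤K K≤n)))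
                  (-diff≤ am an (x-close n m (ℕₚ.≤-trans M₁≤K K≤n) (ℕₚ.≤-trans M₁≤K K≤m))))) ⟩
  an ℚ.* bn ℚ.+ (B ℚ.* δ ℚ.+ B ℚ.* δ)
    ≡⟨ cong (an ℚ.* bn ℚ.+_) (trans (cong (λ t → t ℚ.+ t) Bδ≡) (half+half ε)) ⟩
  an ℚ.* bn ℚ.+ ε ∎
  where
  open ℚₚ.≤-Reasoning
  Bx = proj₁ (bounded x)
  0<Bx = proj₁ (proj₂ (bounded x))
  N₁ = proj₁ (proj₂ (proj₂ (bounded x)))
  x-bounded = proj₂ (proj₂ (proj₂ (bounded x)))
  By = proj₁ (bounded y)
  0<By = proj₁ (proj₂ (bounded y))
  N₂ = proj₁ (proj₂ (proj₂ (bounded y)))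
  y-bounded = proj₂ (proj₂ (proj₂ (bounded y)))
  B = Bx ℚ.+ By
  Bx≤B : Bx ℚ.≤ B
  Bx≤B = p≤p+q Bx (ℚₚ.<⇒≤ 0<By)
  By≤B : By ℚ.≤ B
  By≤B = subst (By ℚ.≤_) (ℚₚ.+-comm By Bx) (p≤p+q By (ℚₚ.<⇒≤ 0<Bx))
  scaled = shrink B (half ε) (ℚₚ.+-mono-< 0<Bx 0<By) (0<half 0<ε)
  δ = proj₁ scaled
  0<δ = proj₁ (proj₂ scaled)
  Bδ≡ = proj₂ (proj₂ scaled)
  M₁ = proj₁ (cauchy x δ 0<δ)
  x-close = proj₂ (cauchy x δ 0<δ)
  M₂ = proj₁ (cauchy y δ 0<δ)
  y-close = proj₂ (cauchy y δ 0<δ)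
  K = (N₁ ℕ.⊔ N₂) ℕ.⊔ (M₁ ℕ.⊔ M₂)
  N₁≤K : N₁ ℕ.≤ K
  N₁≤K = ℕₚ.≤-trans (ℕₚ.m≤m⊔n N₁ N₂) (ℕₚ.m≤m⊔n (N₁ ℕ.⊔ N₂) (M₁ ℕ.⊔ M₂))
  N₂≤K : N₂ ℕ.≤ K
  N₂≤K = ℕₚ.≤-trans (ℕₚ.m≤n⊔m N₁ N₂) (ℕₚ.m≤m⊔n (N₁ ℕ.⊔ N₂) (M₁ ℕ.⊔ M₂))
  M₁≤K : M₁ ℕ.≤ K
  M₁≤K = ℕₚ.≤-trans (ℕₚ.m≤m⊔n M₁ M₂) (ℕₚ.m≤n⊔m (N₁ ℕ.⊔ N₂) (M₁ ℕ.⊔ M₂))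
  M₂≤K : M₂ ℕ.≤ K
  M₂≤K = ℕₚ.≤-trans (ℕₚ.m≤n⊔m M₁ M₂) (ℕₚ.m≤n⊔m (N₁ ℕ.⊔ N₂) (M₁ ℕ.⊔ M₂))
  ring₁ : ∀ am bm an bn →
          am ℚ.* bm ≡ an ℚ.* bn ℚ.+ (am ℚ.* (bm ℚ.- bn) ℚ.+ bn ℚ.* (am ℚ.- an))
  ring₁ = solve 4 (λ am bm an bn →
          am :* bm := an :* bn :+ (am :* (bm :- bn) :+ bn :* (am :- an))) refl
  ring₂ : ∀ a b δ → δ ℚ.- (a ℚ.- b) ≡ (b ℚ.+ δ) ℚ.- a
  ring₂ = solve 3 (λ a b δ → δ :- (a :- b) := (b :+ δ) :- a) refl
  ring₃ : ∀ a b δ → δ ℚ.- (ℚ.- (a ℚ.- b)) ≡ (a ℚ.+ δ) ℚ.- b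
  ring₃ = solve 3 (λ a b δ → δ :- (:- (a :- b)) := (a :+ δ) :- b) refl
  diff≤ : ∀ a b → a ℚ.≤ b ℚ.+ δ → a ℚ.- b ℚ.≤ δ
  diff≤ a b p = certify _ (0≤diff p) (ring₂ a b δ)
  -diff≤ : ∀ a b → b ℚ.≤ a ℚ.+ δ → ℚ.- (a ℚ.- b) ℚ.≤ δ
  -diff≤ a b p = certify _ (0≤diff p) (ring₃ a b δ)

-- The functions f = recip, root k and ln are the usual ones at arguments ≥ 1.
-- To be total, they take the value f (max 1 x) at every x; clamp x is max 1 x.

clamp : ℝ → ℝ
clamp x .approx n = 1ℚ ℚ.⊔ approx x n
clamp x .cauchy ε 0<ε = N , λ m n N≤m N≤n → ℚₚ.⊔-lub
  (ℚₚ.≤-trans (ℚₚ.p≤p⊔q 1ℚ (approx x n)) (p≤p+q _ (ℚₚ.<⇒≤ 0<ε)))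
  (ℚₚ.≤-trans (close m n N≤m N≤n) (ℚₚ.+-monoˡ-≤ ε (ℚₚ.p≤q⊔p 1ℚ (approx x n))))
  where
  N = proj₁ (cauchy x ε 0<ε)
  close = proj₂ (cauchy x ε 0<ε)

1≤clamp : ∀ x n → 1ℚ ℚ.≤ approx (clamp x) n
1≤clamp x n = ℚₚ.p≤p⊔q 1ℚ (approx x n)

0<clamp : ∀ x n → 0ℚ ℚ.< approx (clamp x) n
0<clamp x n = ℚₚ.<-≤-trans 0<1 (1≤clamp x n)

recip : ℝ → ℝ
recip x .approx n = (1/ approx (clamp x) n) {{ℚ.>-nonZero (0<clamp x n)}}
recip x .cauchy ε 0<ε = N , λ m n N≤m N≤n →
  lipschitz (approx (clamp x) m) (approx (clamp x) n) (approx (recip x) m) (approx (recip x) n)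
    (1≤clamp x m) (1≤clamp x n) (inverse m) (inverse n) (0≤recip m) (0≤recip n)
    (close n m N≤n N≤m)
  where
  N = proj₁ (cauchy (clamp x) ε 0<ε)
  close = proj₂ (cauchy (clamp x) ε 0<ε)
  inverse : ∀ n → approx (clamp x) n ℚ.* approx (recip x) n ≡ 1ℚ
  inverse n = ℚₚ.*-inverseʳ (approx (clamp x) n) {{ℚ.>-nonZero (0<clamp x n)}}
  0≤recip : ∀ n → 0ℚ ℚ.≤ approx (recip x) n
  0≤recip n = ℚₚ.<⇒≤ (0<1/ (0<clamp x n))
  ≤1 : ∀ a u → 1ℚ ℚ.≤ a → a ℚ.* u ≡ 1ℚ → 0ℚ ℚ.≤ u → u ℚ.≤ 1ℚ
  ≤1 a u 1≤a au≡1 0≤u = begin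
    u          ≡⟨ ℚₚ.*-identityˡ u ⟨
    1ℚ ℚ.* u   ≤⟨ *-monoˡ u 0≤u 1≤a ⟩
    a ℚ.* u    ≡⟨ au≡1 ⟩
    1ℚ         ∎
    where open ℚₚ.≤-Reasoning
  ring₁ : ∀ a b u v → u ℚ.* v ℚ.* (b ℚ.- a) ≡ u ℚ.* (b ℚ.* v) ℚ.- v ℚ.* (a ℚ.* u)
  ring₁ = solve 4 (λ a b u v → u :* v :* (b :- a) := u :* (b :* v) :- v :* (a :* u)) refl
  ring₂ : ∀ a b u v ε → (v ℚ.+ ε) ℚ.- u ≡
    (ε ℚ.* ((1ℚ ℚ.- u) ℚ.* v ℚ.+ (1ℚ ℚ.- v)) ℚ.+ u ℚ.* v ℚ.* ((a ℚ.+ ε) ℚ.- b)) ℚ.+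
    (u ℚ.* v ℚ.* (b ℚ.- a) ℚ.- (u ℚ.- v))
  ring₂ = solve 5 (λ a b u v ε → (v :+ ε) :- u :=
    (ε :* ((con 1ℚ :- u) :* v :+ (con 1ℚ :- v)) :+ u :* v :* ((a :+ ε) :- b)) :+
    (u :* v :* (b :- a) :- (u :- v))) refl
  lipschitz : ∀ a b u v → 1ℚ ℚ.≤ a → 1ℚ ℚ.≤ b → a ℚ.* u ≡ 1ℚ → b ℚ.* v ≡ 1ℚ →
              0ℚ ℚ.≤ u → 0ℚ ℚ.≤ v → b ℚ.≤ a ℚ.+ ε → u ℚ.≤ v ℚ.+ ε
  lipschitz a b u v 1≤a 1≤b au≡1 bv≡1 0≤u 0≤v b≤a+ε = certify d
    (0≤+ (0≤* (ℚₚ.<⇒≤ 0<ε) (0≤+ (0≤* (0≤diff (≤1 a u 1≤a au≡1 0≤u)) 0≤v)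
                                 (0≤diff (≤1 b v 1≤b bv≡1 0≤v))))
         (0≤* (0≤* 0≤u 0≤v) (0≤diff b≤a+ε)))
    (trans (ring₂ a b u v ε) (trans (cong (d ℚ.+_) vanishes) (ℚₚ.+-identityʳ d)))
    where
    d = ε ℚ.* ((1ℚ ℚ.- u) ℚ.* v ℚ.+ (1ℚ ℚ.- v)) ℚ.+ u ℚ.* v ℚ.* ((a ℚ.+ ε) ℚ.- b)
    vanishes : u ℚ.* v ℚ.* (b ℚ.- a) ℚ.- (u ℚ.- v) ≡ 0ℚ
    vanishes = trans (cong (ℚ._- (u ℚ.- v)) (trans (ring₁ a b u v) (cong₂ ℚ._-_
      (trans (cong (u ℚ.*_) bv≡1) (ℚₚ.*-identityʳ u))
      (trans (cong (v ℚ.*_) au≡1) (ℚₚ.*-identityʳ v))))) (ℚₚ.+-inverseʳ (u ℚ.- v))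

-- F stands for the function lim F n on [0,∞): it maps 0 to 1, increases with
-- slope at least 1, is locally Lipschitz, and the convergence is locally
-- uniform. Hence F y = max 1 x has a unique solution y ≥ 0, which Inversion
-- approximates by points of the grids (1 / suc n) ℕ.
record Expanding (F : ℕ → ℚ → ℚ) : Set where
  field
    base : ∀ n → F n 0ℚ ≡ 1ℚ
    expand : ∀ n {a b} → 0ℚ ℚ.≤ a → a ℚ.≤ b → F n a ℚ.+ (b ℚ.- a) ℚ.≤ F n b
    lipschitz : ∀ B → 0ℚ ℚ.≤ B → ∃ λ K → 0ℚ ℚ.≤ K × ∀ n {a b} →
                0ℚ ℚ.≤ a → a ℚ.≤ b → b ℚ.≤ B → F n b ℚ.≤ F n a ℚ.+ K ℚ.* (b ℚ.- a)
    uniform : ∀ B ε → 0ℚ ℚ.≤ B → 0ℚ ℚ.< ε → ∃ λ N → ∀ m n → N ℕ.≤ m → N ℕ.≤ n →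
              ∀ {q} → 0ℚ ℚ.≤ q → q ℚ.≤ B → F m q ℚ.≤ F n q ℚ.+ ε

module Inversion {F : ℕ → ℚ → ℚ} (F-expanding : Expanding F) (x : ℝ) where
  open Expanding F-expanding

  t : ℕ → ℚ
  t = approx (clamp x)

  gridPoint : ℕ → ℕ → ℚ
  gridPoint n j = ℕ→ℚ j ℚ.* 1/suc n

  0≤gridPoint : ∀ n j → 0ℚ ℚ.≤ gridPoint n j
  0≤gridPoint n j = 0≤* (0≤ℕ→ℚ j) (ℚₚ.<⇒≤ (0<1/suc n))

  gridPoint-suc : ∀ n j → gridPoint n (suc j) ≡ gridPoint n j ℚ.+ 1/suc n
  gridPoint-suc n j = trans (cong (ℚ._* 1/suc n) (ℕ→ℚ-suc j)) (ring (ℕ→ℚ j) (1/suc n))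
    where
    ring : ∀ a s → (a ℚ.+ 1ℚ) ℚ.* s ≡ a ℚ.* s ℚ.+ s
    ring = solve 2 (λ a s → (a :+ con 1ℚ) :* s := a :* s :+ s) refl

  F-lower : ∀ n {q} → 0ℚ ℚ.≤ q → 1ℚ ℚ.+ q ℚ.≤ F n q
  F-lower n {q} 0≤q = subst (ℚ._≤ F n q)
    (cong₂ ℚ._+_ (base n) (ℚₚ.+-identityʳ q)) (expand n ℚₚ.≤-refl 0≤q)

  search : ∀ n M → t n ℚ.< F n (gridPoint n M) →
           ∃ λ j → F n (gridPoint n j) ℚ.≤ t n × t n ℚ.< F n (gridPoint n (suc j))
  search n zero t<F = contradiction (ℚₚ.<-≤-trans (subst (t n ℚ.<_)
    (trans (cong (F n) (ℚₚ.*-zeroˡ (1/suc n))) (base n)) t<F) (1≤clamp x n)) (ℚₚ.<-irrefl refl)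
  search n (suc M) t<F = decide (t n ℚₚ.<? F n (gridPoint n M))
    where
    decide : Dec (t n ℚ.< F n (gridPoint n M)) →
             ∃ λ j → F n (gridPoint n j) ℚ.≤ t n × t n ℚ.< F n (gridPoint n (suc j))
    decide (yes t<F′) = search n M t<F′
    decide (no  t≮F′) = M , ℚₚ.≮⇒≥ t≮F′ , t<F

  searchBound : ∀ n → ∃ λ M → t n ℚ.< F n (gridPoint n M)
  searchBound n = M , (begin-strict
    t n                          ≡⟨ trans (cong (t n ℚ.*_) (1/suc-inverse n)) (ℚₚ.*-identityʳ (t n)) ⟨
    t n ℚ.* (s ℚ.* ℕ→ℚ (suc n))  ≡⟨ ring (t n) s (ℕ→ℚ (suc n)) ⟩
    (t n ℚ.* ℕ→ℚ (suc n)) ℚ.* s  ≤⟨ *-monoˡ s (ℚₚ.<⇒≤ (0<1/suc n)) (proj₂ arch) ⟩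
    gridPoint n M                ≡⟨ ℚₚ.+-identityˡ (gridPoint n M) ⟨
    0ℚ ℚ.+ gridPoint n M         <⟨ ℚₚ.+-monoˡ-< (gridPoint n M) 0<1 ⟩
    1ℚ ℚ.+ gridPoint n M         ≤⟨ F-lower n (0≤gridPoint n M) ⟩
    F n (gridPoint n M)          ∎)
    where
    open ℚₚ.≤-Reasoning
    s = 1/suc n
    arch = archimedean (t n ℚ.* ℕ→ℚ (suc n))
    M = proj₁ arch
    ring : ∀ t s k → t ℚ.* (s ℚ.* k) ≡ (t ℚ.* k) ℚ.* s
    ring = solve 3 (λ t s k → t :* (s :* k) := (t :* k) :* s) refl

  found : ∀ n → ∃ λ j → F n (gridPoint n j) ℚ.≤ t n × t n ℚ.< F n (gridPoint n (suc j))
  found n = search n (proj₁ (searchBound n)) (proj₂ (searchBound n))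

  y : ℕ → ℚ
  y n = gridPoint n (proj₁ (found n))

  0≤y : ∀ n → 0ℚ ℚ.≤ y n
  0≤y n = 0≤gridPoint n (proj₁ (found n))

  Fy≤t : ∀ n → F n (y n) ℚ.≤ t n
  Fy≤t n = proj₁ (proj₂ (found n))

  t≤Fy′ : ∀ n → t n ℚ.≤ F n (y n ℚ.+ 1/suc n)
  t≤Fy′ n = subst (λ q → t n ℚ.≤ F n q) (gridPoint-suc n (proj₁ (found n)))
                  (ℚₚ.<⇒≤ (proj₂ (proj₂ (found n))))

  B : ℚ
  B = proj₁ (bounded (clamp x))

  0<B : 0ℚ ℚ.< B
  0<B = proj₁ (proj₂ (bounded (clamp x)))

  0≤B+1 : 0ℚ ℚ.≤ B ℚ.+ 1ℚ
  0≤B+1 = 0≤+ (ℚₚ.<⇒≤ 0<B) 0≤1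

  N₀ : ℕ
  N₀ = proj₁ (proj₂ (proj₂ (bounded (clamp x))))

  y≤B : ∀ n → N₀ ℕ.≤ n → y n ℚ.≤ B
  y≤B n N₀≤n = begin
    y n            ≡⟨ ℚₚ.+-identityˡ (y n) ⟨
    0ℚ ℚ.+ y n     ≤⟨ ℚₚ.+-monoˡ-≤ (y n) 0≤1 ⟩
    1ℚ ℚ.+ y n     ≤⟨ F-lower n (0≤y n) ⟩
    F n (y n)      ≤⟨ Fy≤t n ⟩
    t n            ≤⟨ proj₁ (proj₂ (proj₂ (proj₂ (bounded (clamp x)))) n N₀≤n) ⟩
    B              ∎
    where open ℚₚ.≤-Reasoning

  y+1/suc≤B+1 : ∀ n → N₀ ℕ.≤ n → y n ℚ.+ 1/suc n ℚ.≤ B ℚ.+ 1ℚ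
  y+1/suc≤B+1 n N₀≤n = ℚₚ.+-mono-≤ (y≤B n N₀≤n) (begin
    1/suc n                      ≡⟨ ℚₚ.*-identityʳ (1/suc n) ⟨
    1/suc n ℚ.* 1ℚ               ≤⟨ *-monoʳ (1/suc n) (ℚₚ.<⇒≤ (0<1/suc n)) (ℕ→ℚ-mono {1} {suc n} (ℕ.s≤s ℕ.z≤n)) ⟩
    1/suc n ℚ.* ℕ→ℚ (suc n)      ≡⟨ 1/suc-inverse n ⟩
    1ℚ                           ∎)
    where open ℚₚ.≤-Reasoning

  Fy⟶clamp : (λ n → F n (y n)) ⟶ clamp x
  Fy⟶clamp ε 0<ε = N , λ n N≤n →
      ℚₚ.≤-trans (Fy≤t n) (p≤p+q (t n) (ℚₚ.<⇒≤ 0<ε))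
    , (begin
      t n
        ≤⟨ t≤Fy′ n ⟩
      F n (y n ℚ.+ 1/suc n)
        ≤⟨ K-lipschitz n (0≤y n) (p≤p+q (y n) (ℚₚ.<⇒≤ (0<1/suc n)))
             (y+1/suc≤B+1 n (ℕₚ.≤-trans (ℕₚ.m≤m⊔n N₀ N₁) N≤n)) ⟩
      F n (y n) ℚ.+ K ℚ.* ((y n ℚ.+ 1/suc n) ℚ.- y n)
        ≡⟨ cong (λ d → F n (y n) ℚ.+ K ℚ.* d) (ring (y n) (1/suc n)) ⟩
      F n (y n) ℚ.+ K ℚ.* 1/suc n
        ≤⟨ ℚₚ.+-monoʳ-≤ (F n (y n)) (small n (ℕₚ.≤-trans (ℕₚ.m≤n⊔m N₀ N₁) N≤n)) ⟩
      F n (y n) ℚ.+ ε ∎)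
    where
    open ℚₚ.≤-Reasoning
    K = proj₁ (lipschitz (B ℚ.+ 1ℚ) 0≤B+1)
    0≤K = proj₁ (proj₂ (lipschitz (B ℚ.+ 1ℚ) 0≤B+1))
    K-lipschitz = proj₂ (proj₂ (lipschitz (B ℚ.+ 1ℚ) 0≤B+1))
    N₁ = proj₁ (1/suc-small K ε 0≤K 0<ε)
    small = proj₂ (1/suc-small K ε 0≤K 0<ε)
    N = N₀ ℕ.⊔ N₁
    ring : ∀ a s → (a ℚ.+ s) ℚ.- a ≡ s
    ring = solve 2 (λ a s → (a :+ s) :- a := s) refl

  y-cauchy : ∀ ε → 0ℚ ℚ.< ε → ∃ λ N → ∀ m n → N ℕ.≤ m → N ℕ.≤ n → y m ℚ.≤ y n ℚ.+ ε
  y-cauchy ε 0<ε = N , λ m n N≤m N≤n →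
    case (N₁≤N N≤m) (N₁≤N N≤n) (N₂≤N N≤m) (N₂≤N N≤n) (N₃≤N N≤m) (N₃≤N N≤n) (N₀≤N N≤n)
         (ℚₚ.≤-total (y m) (y n))
    where
    open ℚₚ.≤-Reasoning
    δ = half (half ε)
    0<δ = 0<half (0<half 0<ε)
    N₁ = proj₁ (Fy⟶clamp δ 0<δ)
    converges = proj₂ (Fy⟶clamp δ 0<δ)
    N₂ = proj₁ (cauchy (clamp x) δ 0<δ)
    close = proj₂ (cauchy (clamp x) δ 0<δ)
    N₃ = proj₁ (uniform B δ (ℚₚ.<⇒≤ 0<B) 0<δ)
    uniformly = proj₂ (uniform B δ (ℚₚ.<⇒≤ 0<B) 0<δ)
    N = (N₀ ℕ.⊔ N₁) ℕ.⊔ (N₂ ℕ.⊔ N₃)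
    N₀≤N : ∀ {n} → N ℕ.≤ n → N₀ ℕ.≤ n
    N₀≤N p = ℕₚ.m⊔n≤o⇒m≤o N₀ N₁ (ℕₚ.m⊔n≤o⇒m≤o (N₀ ℕ.⊔ N₁) (N₂ ℕ.⊔ N₃) p)
    N₁≤N : ∀ {n} → N ℕ.≤ n → N₁ ℕ.≤ n
    N₁≤N p = ℕₚ.m⊔n≤o⇒n≤o N₀ N₁ (ℕₚ.m⊔n≤o⇒m≤o (N₀ ℕ.⊔ N₁) (N₂ ℕ.⊔ N₃) p)
    N₂≤N : ∀ {n} → N ℕ.≤ n → N₂ ℕ.≤ n
    N₂≤N p = ℕₚ.m⊔n≤o⇒m≤o N₂ N₃ (ℕₚ.m⊔n≤o⇒n≤o (N₀ ℕ.⊔ N₁) (N₂ ℕ.⊔ N₃) p)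
    N₃≤N : ∀ {n} → N ℕ.≤ n → N₃ ℕ.≤ n
    N₃≤N p = ℕₚ.m⊔n≤o⇒n≤o N₂ N₃ (ℕₚ.m⊔n≤o⇒n≤o (N₀ ℕ.⊔ N₁) (N₂ ℕ.⊔ N₃) p)
    ring₁ : ∀ f a d → (((f ℚ.+ d) ℚ.+ d) ℚ.+ d) ℚ.- (f ℚ.+ a) ≡ (d ℚ.+ d ℚ.+ d) ℚ.- a
    ring₁ = solve 3 (λ f a d → (((f :+ d) :+ d) :+ d) :- (f :+ a) := (d :+ d :+ d) :- a) refl
    ring₂ : ∀ a b d → (b ℚ.+ ((d ℚ.+ d) ℚ.+ (d ℚ.+ d))) ℚ.- a ≡
            d ℚ.+ ((d ℚ.+ d ℚ.+ d) ℚ.- (a ℚ.- b))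
    ring₂ = solve 3 (λ a b d → (b :+ ((d :+ d) :+ (d :+ d))) :- a :=
            d :+ ((d :+ d :+ d) :- (a :- b))) refl
    4δ≡ε : (δ ℚ.+ δ) ℚ.+ (δ ℚ.+ δ) ≡ ε
    4δ≡ε = trans (cong (λ h → h ℚ.+ h) (half+half (half ε))) (half+half ε)
    case : ∀ {m n} → N₁ ℕ.≤ m → N₁ ℕ.≤ n → N₂ ℕ.≤ m → N₂ ℕ.≤ n → N₃ ℕ.≤ m → N₃ ℕ.≤ n →
           N₀ ℕ.≤ n → y m ℚ.≤ y n ⊎ y n ℚ.≤ y m → y m ℚ.≤ y n ℚ.+ ε
    case {m} {n} _ _ _ _ _ _ _ (inj₁ ym≤yn) =
      ℚₚ.≤-trans ym≤yn (p≤p+q (y n) (ℚₚ.<⇒≤ 0<ε))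
    case {m} {n} N₁≤m N₁≤n N₂≤m N₂≤n N₃≤m N₃≤n N₀≤n (inj₂ yn≤ym) = subst
      (λ e → y m ℚ.≤ y n ℚ.+ e) 4δ≡ε
      (certify _ (0≤+ (ℚₚ.<⇒≤ 0<δ) (subst (0ℚ ℚ.≤_)
          (ring₁ (F m (y n)) (y m ℚ.- y n) δ) (0≤diff rise)))
        (ring₂ (y m) (y n) δ))
      where
      rise : F m (y n) ℚ.+ (y m ℚ.- y n) ℚ.≤ ((F m (y n) ℚ.+ δ) ℚ.+ δ) ℚ.+ δ
      rise = begin
        F m (y n) ℚ.+ (y m ℚ.- y n)
          ≤⟨ expand m (0≤y n) yn≤ym ⟩
        F m (y m)
          ≤⟨ Fy≤t m ⟩
        t m
          ≤⟨ close m n N₂≤m N₂≤n ⟩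
        t n ℚ.+ δ
          ≤⟨ ℚₚ.+-monoˡ-≤ δ (proj₂ (converges n N₁≤n)) ⟩
        (F n (y n) ℚ.+ δ) ℚ.+ δ
          ≤⟨ ℚₚ.+-monoˡ-≤ δ (ℚₚ.+-monoˡ-≤ δ (uniformly n m N₃≤n N₃≤m (0≤y n) (y≤B n N₀≤n))) ⟩
        ((F m (y n) ℚ.+ δ) ℚ.+ δ) ℚ.+ δ ∎

  inverse : ℝ
  inverse .approx = y
  inverse .cauchy = y-cauchy

infixr 8 _^_

_^_ : ℚ → ℕ → ℚ
q ^ zero  = 1ℚ
q ^ suc k = q ℚ.* (q ^ k)

0≤1+ : ∀ {q} → 0ℚ ℚ.≤ q → 0ℚ ℚ.≤ 1ℚ ℚ.+ q
0≤1+ = 0≤+ 0≤1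

1≤[1+q]^ : ∀ k {q} → 0ℚ ℚ.≤ q → 1ℚ ℚ.≤ (1ℚ ℚ.+ q) ^ k
1≤[1+q]^ zero    0≤q = ℚₚ.≤-refl
1≤[1+q]^ (suc k) {q} 0≤q = certify
  (((1ℚ ℚ.+ q) ^ k ℚ.- 1ℚ) ℚ.+ q ℚ.* (1ℚ ℚ.+ q) ^ k)
  (0≤+ (0≤diff (1≤[1+q]^ k 0≤q)) (0≤* 0≤q (ℚₚ.≤-trans 0≤1 (1≤[1+q]^ k 0≤q))))
  (ring q ((1ℚ ℚ.+ q) ^ k))
  where
  ring : ∀ q p → (1ℚ ℚ.+ q) ℚ.* p ℚ.- 1ℚ ≡ (p ℚ.- 1ℚ) ℚ.+ q ℚ.* p
  ring = solve 2 (λ q p → (con 1ℚ :+ q) :* p :- con 1ℚ := (p :- con 1ℚ) :+ q :* p) refl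

[1+q]^-mono : ∀ k {a b} → 0ℚ ℚ.≤ a → a ℚ.≤ b → (1ℚ ℚ.+ a) ^ k ℚ.≤ (1ℚ ℚ.+ b) ^ k
[1+q]^-mono zero    0≤a a≤b = ℚₚ.≤-refl
[1+q]^-mono (suc k) {a} {b} 0≤a a≤b = ℚₚ.≤-trans
  (*-monoʳ (1ℚ ℚ.+ a) (0≤1+ 0≤a) ([1+q]^-mono k 0≤a a≤b))
  (*-monoˡ ((1ℚ ℚ.+ b) ^ k) (ℚₚ.≤-trans 0≤1 (1≤[1+q]^ k (ℚₚ.≤-trans 0≤a a≤b)))
    (ℚₚ.+-monoʳ-≤ 1ℚ a≤b))

[1+q]^-base : ∀ k → (1ℚ ℚ.+ 0ℚ) ^ k ≡ 1ℚ
[1+q]^-base zero    = refl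
[1+q]^-base (suc k) = trans (ℚₚ.*-identityˡ ((1ℚ ℚ.+ 0ℚ) ^ k)) ([1+q]^-base k)

[1+q]^-expand : ∀ k {a b} → 0ℚ ℚ.≤ a → a ℚ.≤ b →
                (1ℚ ℚ.+ a) ^ suc k ℚ.+ (b ℚ.- a) ℚ.≤ (1ℚ ℚ.+ b) ^ suc k
[1+q]^-expand k {a} {b} 0≤a a≤b = certify
  ((1ℚ ℚ.+ b) ℚ.* (Pb ℚ.- Pa) ℚ.+ (b ℚ.- a) ℚ.* (Pa ℚ.- 1ℚ))
  (0≤+ (0≤* (0≤1+ (ℚₚ.≤-trans 0≤a a≤b)) (0≤diff ([1+q]^-mono k 0≤a a≤b)))
       (0≤* (0≤diff a≤b) (0≤diff (1≤[1+q]^ k 0≤a))))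
  (ring a b Pa Pb)
  where
  Pa = (1ℚ ℚ.+ a) ^ k
  Pb = (1ℚ ℚ.+ b) ^ k
  ring : ∀ a b p r → (1ℚ ℚ.+ b) ℚ.* r ℚ.- ((1ℚ ℚ.+ a) ℚ.* p ℚ.+ (b ℚ.- a)) ≡
         (1ℚ ℚ.+ b) ℚ.* (r ℚ.- p) ℚ.+ (b ℚ.- a) ℚ.* (p ℚ.- 1ℚ)
  ring = solve 4 (λ a b p r → (con 1ℚ :+ b) :* r :- ((con 1ℚ :+ a) :* p :+ (b :- a)) :=
         (con 1ℚ :+ b) :* (r :- p) :+ (b :- a) :* (p :- con 1ℚ)) refl

[1+q]^-lipschitz : ∀ k B → 0ℚ ℚ.≤ B → ∃ λ K → 0ℚ ℚ.≤ K × ∀ {a b} →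
  0ℚ ℚ.≤ a → a ℚ.≤ b → b ℚ.≤ B → (1ℚ ℚ.+ b) ^ k ℚ.≤ (1ℚ ℚ.+ a) ^ k ℚ.+ K ℚ.* (b ℚ.- a)
[1+q]^-lipschitz zero B 0≤B = 0ℚ , ℚₚ.≤-refl , λ {a} {b} _ _ _ →
  ℚₚ.≤-reflexive (sym (trans (cong (1ℚ ℚ.+_) (ℚₚ.*-zeroˡ (b ℚ.- a))) (ℚₚ.+-identityʳ 1ℚ)))
[1+q]^-lipschitz (suc k) B 0≤B =
  (1ℚ ℚ.+ B) ℚ.* K ℚ.+ PB ,
  0≤+ (0≤* (0≤1+ 0≤B) 0≤K) (ℚₚ.≤-trans 0≤1 (1≤[1+q]^ k 0≤B)) ,
  λ {a} {b} 0≤a a≤b b≤B → certify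
    (K ℚ.* (b ℚ.- a) ℚ.* (B ℚ.- b)
      ℚ.+ (1ℚ ℚ.+ b) ℚ.* (((1ℚ ℚ.+ a) ^ k ℚ.+ K ℚ.* (b ℚ.- a)) ℚ.- (1ℚ ℚ.+ b) ^ k)
      ℚ.+ (b ℚ.- a) ℚ.* (PB ℚ.- (1ℚ ℚ.+ a) ^ k))
    (0≤+ (0≤+ (0≤* (0≤* 0≤K (0≤diff a≤b)) (0≤diff b≤B))
              (0≤* (0≤1+ (ℚₚ.≤-trans 0≤a a≤b)) (0≤diff (IH 0≤a a≤b b≤B))))
         (0≤* (0≤diff a≤b) (0≤diff ([1+q]^-mono k 0≤a (ℚₚ.≤-trans a≤b b≤B)))))
    (ring a b ((1ℚ ℚ.+ a) ^ k) ((1ℚ ℚ.+ b) ^ k) B PB K)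
  where
  PB = (1ℚ ℚ.+ B) ^ k
  K = proj₁ ([1+q]^-lipschitz k B 0≤B)
  0≤K = proj₁ (proj₂ ([1+q]^-lipschitz k B 0≤B))
  IH = proj₂ (proj₂ ([1+q]^-lipschitz k B 0≤B))
  ring : ∀ a b p r B P K →
    ((1ℚ ℚ.+ a) ℚ.* p ℚ.+ ((1ℚ ℚ.+ B) ℚ.* K ℚ.+ P) ℚ.* (b ℚ.- a)) ℚ.- (1ℚ ℚ.+ b) ℚ.* r ≡
    K ℚ.* (b ℚ.- a) ℚ.* (B ℚ.- b)
      ℚ.+ (1ℚ ℚ.+ b) ℚ.* ((p ℚ.+ K ℚ.* (b ℚ.- a)) ℚ.- r)
      ℚ.+ (b ℚ.- a) ℚ.* (P ℚ.- p)
  ring = solve 7 (λ a b p r B P K →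
    ((con 1ℚ :+ a) :* p :+ ((con 1ℚ :+ B) :* K :+ P) :* (b :- a)) :- (con 1ℚ :+ b) :* r :=
    K :* (b :- a) :* (B :- b)
      :+ (con 1ℚ :+ b) :* ((p :+ K :* (b :- a)) :- r)
      :+ (b :- a) :* (P :- p)) refl

root-expanding : ∀ k → Expanding (λ _ q → (1ℚ ℚ.+ q) ^ suc k)
root-expanding k = record
  { base      = λ _ → [1+q]^-base (suc k)
  ; expand    = λ _ → [1+q]^-expand k
  ; lipschitz = λ B 0≤B → let K , 0≤K , bound = [1+q]^-lipschitz (suc k) B 0≤B in
                  K , 0≤K , λ _ → bound
  ; uniform   = λ _ _ _ 0<ε → 0 , λ _ _ _ _ _ _ → p≤p+q _ (ℚₚ.<⇒≤ 0<ε)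
  }

root : ∀ k .{{_ : ℕ.NonZero k}} → ℝ → ℝ
root (suc k) x = fromℚ 1ℚ + Inversion.inverse (root-expanding k) x

root-correct : ∀ k .{{_ : ℕ.NonZero k}} x → (λ n → approx (root k x) n ^ k) ⟶ clamp x
root-correct (suc k) x = Inversion.Fy⟶clamp (root-expanding k) x

-- q ^ k / k !
expTerm : ℚ → ℕ → ℚ
expTerm q zero    = 1ℚ
expTerm q (suc k) = expTerm q k ℚ.* (q ℚ.* 1/suc k)

-- Σ_{k ≤ n} q ^ k / k !
expSum : ℚ → ℕ → ℚ
expSum q zero    = expTerm q zero
expSum q (suc n) = expSum q n ℚ.+ expTerm q (suc n)

0≤expTerm : ∀ k {q} → 0ℚ ℚ.≤ q → 0ℚ ℚ.≤ expTerm q k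
0≤expTerm zero    0≤q = 0≤1
0≤expTerm (suc k) 0≤q = 0≤* (0≤expTerm k 0≤q) (0≤* 0≤q (ℚₚ.<⇒≤ (0<1/suc k)))

expTerm-mono : ∀ k {a b} → 0ℚ ℚ.≤ a → a ℚ.≤ b → expTerm a k ℚ.≤ expTerm b k
expTerm-mono zero    0≤a a≤b = ℚₚ.≤-refl
expTerm-mono (suc k) {a} {b} 0≤a a≤b = ℚₚ.≤-trans
  (*-monoʳ (expTerm a k) (0≤expTerm k 0≤a) (*-monoˡ (1/suc k) (ℚₚ.<⇒≤ (0<1/suc k)) a≤b))
  (*-monoˡ (b ℚ.* 1/suc k) (0≤* (ℚₚ.≤-trans 0≤a a≤b) (ℚₚ.<⇒≤ (0<1/suc k)))
    (expTerm-mono k 0≤a a≤b))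

expTerm-base : ∀ k → expTerm 0ℚ (suc k) ≡ 0ℚ
expTerm-base k = trans (cong (expTerm 0ℚ k ℚ.*_) (ℚₚ.*-zeroˡ (1/suc k))) (ℚₚ.*-zeroʳ (expTerm 0ℚ k))

expSum-base : ∀ n → expSum 0ℚ n ≡ 1ℚ
expSum-base zero    = refl
expSum-base (suc n) = trans (cong₂ ℚ._+_ (expSum-base n) (expTerm-base n)) (ℚₚ.+-identityʳ 1ℚ)

expSum-mono : ∀ n {a b} → 0ℚ ℚ.≤ a → a ℚ.≤ b → expSum a n ℚ.≤ expSum b n
expSum-mono zero    0≤a a≤b = ℚₚ.≤-refl
expSum-mono (suc n) 0≤a a≤b = ℚₚ.+-mono-≤ (expSum-mono n 0≤a a≤b) (expTerm-mono (suc n) 0≤a a≤b)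

expSum-increasing : ∀ {q m n} → 0ℚ ℚ.≤ q → m ℕ.≤ n → expSum q m ℚ.≤ expSum q n
expSum-increasing {q} {m} 0≤q m≤n = go (ℕₚ.≤⇒≤′ m≤n)
  where
  go : ∀ {n} → m ℕ.≤′ n → expSum q m ℚ.≤ expSum q n
  go ℕ.≤′-refl = ℚₚ.≤-refl
  go {suc n} (ℕ.≤′-step m≤n) = ℚₚ.≤-trans (go m≤n) (p≤p+q (expSum q n) (0≤expTerm (suc n) 0≤q))

expSum-expand : ∀ n {a b} → 0ℚ ℚ.≤ a → a ℚ.≤ b →
                expSum a (suc n) ℚ.+ (b ℚ.- a) ℚ.≤ expSum b (suc n)
expSum-expand zero {a} {b} 0≤a a≤b = ℚₚ.≤-reflexive (ring a b)
  where
  ring : ∀ a b → (1ℚ ℚ.+ 1ℚ ℚ.* (a ℚ.* 1ℚ)) ℚ.+ (b ℚ.- a) ≡ 1ℚ ℚ.+ 1ℚ ℚ.* (b ℚ.* 1ℚ)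
  ring = solve 2 (λ a b → (con 1ℚ :+ con 1ℚ :* (a :* con 1ℚ)) :+ (b :- a) :=
                          con 1ℚ :+ con 1ℚ :* (b :* con 1ℚ)) refl
expSum-expand (suc n) {a} {b} 0≤a a≤b = subst (ℚ._≤ expSum b (suc (suc n)))
  (ring (expSum a (suc n)) (expTerm a (suc (suc n))) (b ℚ.- a))
  (ℚₚ.+-mono-≤ (expSum-expand n 0≤a a≤b) (expTerm-mono (suc (suc n)) 0≤a a≤b))
  where
  ring : ∀ s t d → (s ℚ.+ d) ℚ.+ t ≡ (s ℚ.+ t) ℚ.+ d
  ring = solve 3 (λ s t d → (s :+ d) :+ t := (s :+ t) :+ d) refl

expTerm-lipschitz : ∀ k {a b} → 0ℚ ℚ.≤ a → a ℚ.≤ b →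
  expTerm b (suc k) ℚ.≤ expTerm a (suc k) ℚ.+ expTerm b k ℚ.* (b ℚ.- a)
expTerm-lipschitz zero {a} {b} 0≤a a≤b = ℚₚ.≤-reflexive (ring a b)
  where
  ring : ∀ a b → 1ℚ ℚ.* (b ℚ.* 1ℚ) ≡ 1ℚ ℚ.* (a ℚ.* 1ℚ) ℚ.+ 1ℚ ℚ.* (b ℚ.- a)
  ring = solve 2 (λ a b → con 1ℚ :* (b :* con 1ℚ) :=
                          con 1ℚ :* (a :* con 1ℚ) :+ con 1ℚ :* (b :- a)) refl
expTerm-lipschitz (suc k) {a} {b} 0≤a a≤b = certify
  (s ℚ.* (a ℚ.* ((T′ ℚ.+ u ℚ.* (b ℚ.- a)) ℚ.- u ℚ.* (b ℚ.* r))
          ℚ.+ (b ℚ.- a) ℚ.* (b ℚ.- a) ℚ.* u))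
  (0≤* (ℚₚ.<⇒≤ (0<1/suc (suc k)))
    (0≤+ (0≤* 0≤a (0≤diff (expTerm-lipschitz k 0≤a a≤b)))
         (0≤* (0≤* (0≤diff a≤b) (0≤diff a≤b)) (0≤expTerm k (ℚₚ.≤-trans 0≤a a≤b)))))
  (trans (ring a b u T′ s r n)
    (trans (cong₂ (λ v w → d ℚ.- (s ℚ.* (b ℚ.- a) ℚ.* (u ℚ.* b)) ℚ.* v
                             ℚ.+ (u ℚ.* (b ℚ.* r) ℚ.* (b ℚ.- a)) ℚ.* w) vanish₁ vanish₂)
      (ring′ d (s ℚ.* (b ℚ.- a) ℚ.* (u ℚ.* b)) (u ℚ.* (b ℚ.* r) ℚ.* (b ℚ.- a)))))
  where
  u = expTerm b k
  T′ = expTerm a (suc k)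
  r = 1/suc k
  s = 1/suc (suc k)
  n = ℕ→ℚ (suc k)
  d = s ℚ.* (a ℚ.* ((T′ ℚ.+ u ℚ.* (b ℚ.- a)) ℚ.- u ℚ.* (b ℚ.* r))
          ℚ.+ (b ℚ.- a) ℚ.* (b ℚ.- a) ℚ.* u)
  vanish₁ : 1ℚ ℚ.- r ℚ.* n ≡ 0ℚ
  vanish₁ = trans (cong (λ p → 1ℚ ℚ.- p) (1/suc-inverse k)) (ℚₚ.+-inverseʳ 1ℚ)
  vanish₂ : 1ℚ ℚ.- s ℚ.* (n ℚ.+ 1ℚ) ≡ 0ℚ
  vanish₂ = trans (cong (λ m → 1ℚ ℚ.- s ℚ.* m) (sym (ℕ→ℚ-suc (suc k))))
                  (trans (cong (λ p → 1ℚ ℚ.- p) (1/suc-inverse (suc k))) (ℚₚ.+-inverseʳ 1ℚ))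
  ring′ : ∀ d x y → d ℚ.- x ℚ.* 0ℚ ℚ.+ y ℚ.* 0ℚ ≡ d
  ring′ = solve 3 (λ d x y → d :- x :* con 0ℚ :+ y :* con 0ℚ := d) refl
  ring : ∀ a b u T s r n →
    (T ℚ.* (a ℚ.* s) ℚ.+ u ℚ.* (b ℚ.* r) ℚ.* (b ℚ.- a)) ℚ.- u ℚ.* (b ℚ.* r) ℚ.* (b ℚ.* s) ≡
    s ℚ.* (a ℚ.* ((T ℚ.+ u ℚ.* (b ℚ.- a)) ℚ.- u ℚ.* (b ℚ.* r))
          ℚ.+ (b ℚ.- a) ℚ.* (b ℚ.- a) ℚ.* u)
      ℚ.- (s ℚ.* (b ℚ.- a) ℚ.* (u ℚ.* b)) ℚ.* (1ℚ ℚ.- r ℚ.* n)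
      ℚ.+ (u ℚ.* (b ℚ.* r) ℚ.* (b ℚ.- a)) ℚ.* (1ℚ ℚ.- s ℚ.* (n ℚ.+ 1ℚ))
  ring = solve 7 (λ a b u T s r n →
    (T :* (a :* s) :+ u :* (b :* r) :* (b :- a)) :- u :* (b :* r) :* (b :* s) :=
    s :* (a :* ((T :+ u :* (b :- a)) :- u :* (b :* r))
          :+ (b :- a) :* (b :- a) :* u)
      :- (s :* (b :- a) :* (u :* b)) :* (con 1ℚ :- r :* n)
      :+ (u :* (b :* r) :* (b :- a)) :* (con 1ℚ :- s :* (n :+ con 1ℚ))) refl

expSum-lipschitz : ∀ n {a b} → 0ℚ ℚ.≤ a → a ℚ.≤ b →
  expSum b (suc n) ℚ.≤ expSum a (suc n) ℚ.+ expSum b n ℚ.* (b ℚ.- a)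
expSum-lipschitz zero {a} {b} 0≤a a≤b = subst (expSum b 1 ℚ.≤_)
  (sym (ℚₚ.+-assoc 1ℚ (expTerm a 1) (expTerm b 0 ℚ.* (b ℚ.- a))))
  (ℚₚ.+-monoʳ-≤ 1ℚ (expTerm-lipschitz 0 0≤a a≤b))
expSum-lipschitz (suc n) {a} {b} 0≤a a≤b = subst (expSum b (suc (suc n)) ℚ.≤_)
  (ring (expSum a (suc n)) (expSum b n) (expTerm a (suc (suc n))) (expTerm b (suc n)) (b ℚ.- a))
  (ℚₚ.+-mono-≤ (expSum-lipschitz n 0≤a a≤b) (expTerm-lipschitz (suc n) 0≤a a≤b))
  where
  ring : ∀ s S t T d → (s ℚ.+ S ℚ.* d) ℚ.+ (t ℚ.+ T ℚ.* d) ≡ (s ℚ.+ t) ℚ.+ (S ℚ.+ T) ℚ.* d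
  ring = solve 5 (λ s S t T d → (s :+ S :* d) :+ (t :+ T :* d) := (s :+ t) :+ (S :+ T) :* d) refl

-- From index M ≥ 2B on, the terms at q ≤ B at least halve at each step.
module ExpTail (B : ℚ) (0≤B : 0ℚ ℚ.≤ B) where

  M : ℕ
  M = proj₁ (archimedean (B ℚ.+ B))

  step≤½ : ∀ k → M ℕ.≤ suc k → B ℚ.* 1/suc k ℚ.≤ ½
  step≤½ k M≤1+k = begin
    B ℚ.* 1/suc k                              ≡⟨ half+half (B ℚ.* 1/suc k) ⟨
    half (B ℚ.* 1/suc k) ℚ.+ half (B ℚ.* 1/suc k) ≡⟨ ring B (1/suc k) ½ ⟩
    ½ ℚ.* (1/suc k ℚ.* (B ℚ.+ B))
      ≤⟨ *-monoʳ ½ (ℚₚ.nonNegative⁻¹ ½) (*-monoʳ (1/suc k) (ℚₚ.<⇒≤ (0<1/suc k))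
           (ℚₚ.≤-trans (proj₂ (archimedean (B ℚ.+ B))) (ℕ→ℚ-mono M≤1+k))) ⟩
    ½ ℚ.* (1/suc k ℚ.* ℕ→ℚ (suc k))            ≡⟨ cong (½ ℚ.*_) (1/suc-inverse k) ⟩
    ½ ℚ.* 1ℚ                                   ≡⟨ ℚₚ.*-identityʳ ½ ⟩
    ½                                          ∎
    where
    open ℚₚ.≤-Reasoning
    ring : ∀ b s h → (b ℚ.* s) ℚ.* h ℚ.+ (b ℚ.* s) ℚ.* h ≡ h ℚ.* (s ℚ.* (b ℚ.+ b))
    ring = solve 3 (λ b s h → (b :* s) :* h :+ (b :* s) :* h := h :* (s :* (b :+ b))) refl

  halves : ∀ k {q} → 0ℚ ℚ.≤ q → q ℚ.≤ B → M ℕ.≤ suc k → expTerm q (suc k) ℚ.≤ half (expTerm q k)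
  halves k {q} 0≤q q≤B M≤1+k = *-monoʳ (expTerm q k) (0≤expTerm k 0≤q)
    (ℚₚ.≤-trans (*-monoˡ (1/suc k) (ℚₚ.<⇒≤ (0<1/suc k)) q≤B) (step≤½ k M≤1+k))

  sum+term-decreasing : ∀ {q m n} → 0ℚ ℚ.≤ q → q ℚ.≤ B → M ℕ.≤ m → m ℕ.≤ n →
    expSum q n ℚ.+ expTerm q n ℚ.≤ expSum q m ℚ.+ expTerm q m
  sum+term-decreasing {q} {m} 0≤q q≤B M≤m m≤n = go (ℕₚ.≤⇒≤′ m≤n)
    where
    open ℚₚ.≤-Reasoning
    go : ∀ {n} → m ℕ.≤′ n → expSum q n ℚ.+ expTerm q n ℚ.≤ expSum q m ℚ.+ expTerm q m
    go ℕ.≤′-refl = ℚₚ.≤-refl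
    go {suc n} (ℕ.≤′-step m≤′n) = begin
      (expSum q n ℚ.+ expTerm q (suc n)) ℚ.+ expTerm q (suc n)
        ≡⟨ ℚₚ.+-assoc (expSum q n) (expTerm q (suc n)) (expTerm q (suc n)) ⟩
      expSum q n ℚ.+ (expTerm q (suc n) ℚ.+ expTerm q (suc n))
        ≤⟨ ℚₚ.+-monoʳ-≤ (expSum q n) (ℚₚ.+-mono-≤ halved halved) ⟩
      expSum q n ℚ.+ (half (expTerm q n) ℚ.+ half (expTerm q n))
        ≡⟨ cong (expSum q n ℚ.+_) (half+half (expTerm q n)) ⟩
      expSum q n ℚ.+ expTerm q n
        ≤⟨ go m≤′n ⟩
      expSum q m ℚ.+ expTerm q m ∎
      where
      halved = halves n 0≤q q≤B
        (ℕₚ.≤-trans M≤m (ℕₚ.≤-trans (ℕₚ.≤′⇒≤ m≤′n) (ℕₚ.n≤1+n n)))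

  tail : ∀ {q m n} → 0ℚ ℚ.≤ q → q ℚ.≤ B → M ℕ.≤ m → m ℕ.≤ n →
         expSum q n ℚ.≤ expSum q m ℚ.+ expTerm B m
  tail {q} {m} {n} 0≤q q≤B M≤m m≤n = ℚₚ.≤-trans
    (p≤p+q (expSum q n) (0≤expTerm n 0≤q))
    (ℚₚ.≤-trans (sum+term-decreasing 0≤q q≤B M≤m m≤n)
                (ℚₚ.+-monoʳ-≤ (expSum q m) (expTerm-mono m 0≤q q≤B)))

  expTerm-decay : ∀ j → expTerm B (j ℕ.+ M) ℚ.* ℕ→ℚ (suc j) ℚ.≤ expTerm B M
  expTerm-decay zero = ℚₚ.≤-reflexive (ℚₚ.*-identityʳ (expTerm B M))
  expTerm-decay (suc j) = begin
    expTerm B (suc (j ℕ.+ M)) ℚ.* ℕ→ℚ (suc (suc j))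
      ≤⟨ *-monoˡ (ℕ→ℚ (suc (suc j))) (0≤ℕ→ℚ (suc (suc j)))
           (halves (j ℕ.+ M) 0≤B ℚₚ.≤-refl (ℕₚ.≤-trans (ℕₚ.m≤n+m M j) (ℕₚ.n≤1+n (j ℕ.+ M)))) ⟩
    half (expTerm B (j ℕ.+ M)) ℚ.* ℕ→ℚ (suc (suc j))
      ≤⟨ *-monoʳ (half (expTerm B (j ℕ.+ M)))
           (0≤* (0≤expTerm (j ℕ.+ M) 0≤B) (ℚₚ.nonNegative⁻¹ ½)) doubled ⟩
    half (expTerm B (j ℕ.+ M)) ℚ.* (ℕ→ℚ (suc j) ℚ.+ ℕ→ℚ (suc j))
      ≡⟨ ring (expTerm B (j ℕ.+ M)) ½ (ℕ→ℚ (suc j)) ⟩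
    expTerm B (j ℕ.+ M) ℚ.* (half (ℕ→ℚ (suc j)) ℚ.+ half (ℕ→ℚ (suc j)))
      ≡⟨ cong (expTerm B (j ℕ.+ M) ℚ.*_) (half+half (ℕ→ℚ (suc j))) ⟩
    expTerm B (j ℕ.+ M) ℚ.* ℕ→ℚ (suc j)
      ≤⟨ expTerm-decay j ⟩
    expTerm B M ∎
    where
    open ℚₚ.≤-Reasoning
    doubled : ℕ→ℚ (suc (suc j)) ℚ.≤ ℕ→ℚ (suc j) ℚ.+ ℕ→ℚ (suc j)
    doubled = subst (ℚ._≤ ℕ→ℚ (suc j) ℚ.+ ℕ→ℚ (suc j)) (sym (ℕ→ℚ-suc (suc j)))
      (ℚₚ.+-monoʳ-≤ (ℕ→ℚ (suc j)) (ℕ→ℚ-mono {1} {suc j} (ℕ.s≤s ℕ.z≤n)))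
    ring : ∀ t h n → (t ℚ.* h) ℚ.* (n ℚ.+ n) ≡ t ℚ.* (n ℚ.* h ℚ.+ n ℚ.* h)
    ring = solve 3 (λ t h n → (t :* h) :* (n :+ n) := t :* (n :* h :+ n :* h)) refl

  expTerm-small : ∀ ε → 0ℚ ℚ.< ε → ∃ λ N → M ℕ.≤ N × expTerm B N ℚ.≤ ε
  expTerm-small ε 0<ε = J ℕ.+ M , ℕₚ.m≤n+m M J , (begin
    expTerm B (J ℕ.+ M)
      ≡⟨ trans (cong (expTerm B (J ℕ.+ M) ℚ.*_) (1/suc-inverse J))
               (ℚₚ.*-identityʳ (expTerm B (J ℕ.+ M))) ⟨
    expTerm B (J ℕ.+ M) ℚ.* (1/suc J ℚ.* ℕ→ℚ (suc J))
      ≡⟨ ring (expTerm B (J ℕ.+ M)) (1/suc J) (ℕ→ℚ (suc J)) ⟩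
    (expTerm B (J ℕ.+ M) ℚ.* ℕ→ℚ (suc J)) ℚ.* 1/suc J
      ≤⟨ *-monoˡ (1/suc J) (ℚₚ.<⇒≤ (0<1/suc J)) (expTerm-decay J) ⟩
    expTerm B M ℚ.* 1/suc J
      ≤⟨ proj₂ small J ℕₚ.≤-refl ⟩
    ε ∎)
    where
    open ℚₚ.≤-Reasoning
    small = 1/suc-small (expTerm B M) ε (0≤expTerm M 0≤B) 0<ε
    J = proj₁ small
    ring : ∀ t s n → t ℚ.* (s ℚ.* n) ≡ (t ℚ.* n) ℚ.* s
    ring = solve 3 (λ t s n → t :* (s :* n) := (t :* n) :* s) refl

  expSum-bound : ∀ n → expSum B n ℚ.≤ expSum B M ℚ.+ expTerm B M
  expSum-bound n = ℚₚ.≤-trans (expSum-increasing 0≤B (ℕₚ.m≤m⊔n n M))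
                              (tail 0≤B ℚₚ.≤-refl ℕₚ.≤-refl (ℕₚ.m≤n⊔m n M))

exp-expanding : Expanding (λ n q → expSum q (suc n))
exp-expanding = record
  { base      = λ n → expSum-base (suc n)
  ; expand    = expSum-expand
  ; lipschitz = lip
  ; uniform   = uni
  }
  where
  lip : ∀ B → 0ℚ ℚ.≤ B → ∃ λ K → 0ℚ ℚ.≤ K × ∀ n {a b} → 0ℚ ℚ.≤ a → a ℚ.≤ b → b ℚ.≤ B →
        expSum b (suc n) ℚ.≤ expSum a (suc n) ℚ.+ K ℚ.* (b ℚ.- a)
  lip B 0≤B = expSum B M ℚ.+ expTerm B M ,
    ℚₚ.≤-trans 0≤1 (expSum-bound 0) ,
    λ n {a} {b} 0≤a a≤b b≤B → ℚₚ.≤-trans (expSum-lipschitz n 0≤a a≤b)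
      (ℚₚ.+-monoʳ-≤ (expSum a (suc n)) (*-monoˡ (b ℚ.- a) (0≤diff a≤b)
        (ℚₚ.≤-trans (expSum-mono n (ℚₚ.≤-trans 0≤a a≤b) b≤B) (expSum-bound n))))
    where open ExpTail B 0≤B
  uni : ∀ B ε → 0ℚ ℚ.≤ B → 0ℚ ℚ.< ε → ∃ λ N → ∀ m n → N ℕ.≤ m → N ℕ.≤ n →
        ∀ {q} → 0ℚ ℚ.≤ q → q ℚ.≤ B → expSum q (suc m) ℚ.≤ expSum q (suc n) ℚ.+ ε
  uni B ε 0≤B 0<ε = N , λ m n N≤m N≤n {q} 0≤q q≤B → ℚₚ.≤-trans
    (tail 0≤q q≤B M≤N (ℕₚ.≤-trans N≤m (ℕₚ.n≤1+n m)))
    (ℚₚ.+-mono-≤ (expSum-increasing 0≤q (ℕₚ.≤-trans N≤n (ℕₚ.n≤1+n n))) small)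
    where
    open ExpTail B 0≤B
    N = proj₁ (expTerm-small ε 0<ε)
    M≤N = proj₁ (proj₂ (expTerm-small ε 0<ε))
    small = proj₂ (proj₂ (expTerm-small ε 0<ε))

-- The solution y ≥ 0 of exp y = max 1 x; see ln-correct.
ln : ℝ → ℝ
ln x = Inversion.inverse exp-expanding x

ln-correct : ∀ x → (λ n → expSum (approx (ln x) n) (suc n)) ⟶ clamp x
ln-correct x = Inversion.Fy⟶clamp exp-expanding x

record Graph (n : ℕ) : Set where
  field
    adj        : Fin n → Fin n → Bool
    adj-sym    : ∀ u v → adj u v ≡ adj v u
    adj-irrefl : ∀ v → adj v v ≡ false

  Adjacent : Rel (Fin n) 0ℓ
  Adjacent u v = T (adj u v)

open Graph public

data Walk {A : Set} (_∼_ : Rel A 0ℓ) : ℕ → A → A → Set where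
  stay : ∀ {u} → Walk _∼_ 0 u u
  step : ∀ {k u v w} → u ∼ v → Walk _∼_ k v w → Walk _∼_ (suc k) u w

-- Vertices in different components have no distance, i.e. distance ∞.
IsDistance : {A : Set} → Rel A 0ℓ → A → A → ℕ → Set
IsDistance _∼_ u v d = Walk _∼_ d u v × (∀ k → Walk _∼_ k u v → d ℕ.≤ k)

-- A partition of the vertices, given by the identifier of each vertex's
-- cluster. The clusters are the nonempty fibres.
Clustering : ℕ → Set
Clustering n = Fin n → ℕ

module _ {n : ℕ} (G : Graph n) (P : Clustering n) where

  Cluster : ℕ → Set
  Cluster i = Σ (Fin n) λ v → P v ≡ i

  InducedAdjacent : ∀ i → Rel (Cluster i) 0ℓ
  InducedAdjacent i (u , _) (v , _) = Adjacent G u v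

  StrongDiameterAtMost : ℝ → ℕ → Set
  StrongDiameterAtMost D i = ∀ (u v : Cluster i) →
    ∃ λ d → IsDistance (InducedAdjacent i) u v d × fromℕ d ≤ D

  SupergraphAdjacent : Rel ℕ 0ℓ
  SupergraphAdjacent i j =
    i ≢ j × Σ (Cluster i) λ (u , _) → Σ (Cluster j) λ (v , _) → Adjacent G u v

  -- Identifiers of empty clusters are isolated, so colouring them too imposes
  -- no condition.
  SupergraphColorable : ℕ → Set
  SupergraphColorable χ =
    Σ (ℕ → Fin χ) λ colour → ∀ i j → SupergraphAdjacent i j → colour i ≢ colour j

  IsStrongNetworkDecomposition : ℝ → ℕ → Set
  IsStrongNetworkDecomposition D χ =
    (∀ i → StrongDiameterAtMost D i) × SupergraphColorable χ

-- Each vertex v of the graph has its identity number ident v (counted from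
-- 0) and labels its potential edges by ports, the edge to w having the port
-- port v ⟨$⟩ʳ w. The labelling is arbitrary, so ports carry no information
-- about identities.
record Network (n : ℕ) : Set where
  field
    graph : Graph n
    ident : Permutation′ n
    port  : Fin n → Permutation′ n

open Network public

Message : Set
Message = List Bool

-- The program run by every processor. Initially a processor knows its
-- identity number, which of its ports carry an edge, and its private coin
-- flips. In each round it sends a message through every port, and receives
-- one through every port ([] where there is no edge). After the last round it
-- outputs the identifier of its cluster.
record Algorithm (n : ℕ) : Set₁ where
  field
    coins   : ℕ
    State   : Set
    init    : Fin n → (Fin n → Bool) → Vec Bool coins → State
    send    : State → Fin n → Message
    receive : State → (Fin n → Message) → State
    rounds  : ℕ
    output  : State → ℕ

open Algorithm public

module Execution {n : ℕ} (A : Algorithm n) (N : Network n) where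

  Outcome : Set
  Outcome = Vec (Vec Bool (coins A)) n

  state : Outcome → ℕ → Fin n → State A
  -- The message u sends to its neighbour v in round suc t.
  message : Outcome → ℕ → Fin n → Fin n → Message

  state ω zero v =
    init A (ident N ⟨$⟩ʳ v) (λ p → adj (graph N) v (port N v ⟨$⟩ˡ p)) (Vec.lookup ω v)
  state ω (suc t) v = receive A (state ω t v) λ p →
    let w = port N v ⟨$⟩ˡ p in if adj (graph N) v w then message ω t w v else []

  message ω t u v = send A (state ω t u) (port N u ⟨$⟩ʳ v)

  clustering : Outcome → Clustering n
  clustering ω v = output A (state ω (rounds A) v)

  fairCoin : (Bool → ℚ) → ℚ
  fairCoin f = ½ ℚ.* f true ℚ.+ ½ ℚ.* f false

  independent : ∀ {X : Set} k → ((X → ℚ) → ℚ) → (Vec X k → ℚ) → ℚ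
  independent zero    E f = f []
  independent (suc k) E f = E λ x → independent k E λ xs → f (x ∷ xs)

  expectation : (Outcome → ℚ) → ℚ
  expectation = independent n (independent (coins A) fairCoin)

  probability : (Outcome → Bool) → ℚ
  probability S = expectation λ ω → if S ω then 1ℚ else 0ℚ

  -- Events involving real numbers need not be decidable. A lower bound on
  -- the probability of such an event is one on that of a decidable part of it.
  HoldsWithProbabilityAtLeast : ℝ → (Outcome → Set) → Set
  HoldsWithProbabilityAtLeast p E =
    ∃ λ (S : Outcome → Bool) → (∀ ω → T (S ω) → E ω) × p ≤ fromℚ (probability S)

{-# OPTIONS --safe #-}

-- Following Elkin and Neiman, there are λ phases of k rounds each. In a phase,
-- every remaining vertex u draws a geometric radius r, truncated at k, and starts
-- to broadcast its identity at time k - r; hence the time at which y hears of u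
-- encodes r - d(u, y). A vertex joins the first vertex that it hears if the
-- runner-up comes more than one round later, ties being broken by identity. Then
-- the vertices on the way do so as well, and adjacent vertices that join agree.
-- The least and the greatest identity heard so far suffice for this test, so
-- that messages are short. As the geometric distribution is memoryless, the
-- first vertex heard has the required lead with probability at least 1 - q, where
-- q is the probability that a trial ends the run. So the algorithm fails with
-- probability at most n q ^ λ + n Σ_{t < λ} q ^ t (1 - q) ^ k, the second term being
-- due to truncation, and this is at most 3 / c for q slightly above (c n) ^ (- 1 / λ).
module Submission where

open import Data.Bool.Base using (Bool; true; false; T; not; _∧_; if_then_else_)
import Data.Bool.Properties as Boolₚ
open import Data.Empty using (⊥)
open import Data.Fin.Base using (Fin; zero; suc; toℕ; fromℕ<)
open import Data.Fin.Permutation using (_⟨$⟩ʳ_; _⟨$⟩ˡ_; inverseˡ)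
import Data.Fin.Properties as Fₚ
import Data.Integer.Base as ℤ
open import Data.List.Base as List using (List; []; _∷_; length)
import Data.List.Properties as Listₚ
open import Data.Maybe.Base using (Maybe; just; nothing; fromMaybe; is-just; is-nothing; _<∣>_)
open import Data.Nat.Base as ℕ using (ℕ; zero; suc; NonZero)
import Data.Nat.DivMod as ℕ
open import Data.Nat.Induction using (<-rec)
open import Data.Nat.Logarithm using (⌈log₂_⌉; ⌈log₂⌈n/2⌉⌉≡⌈log₂n⌉∸1; ⌈log₂⌉-mono-≤)
import Data.Nat.Properties as ℕₚ
open import Data.Product.Base using (Σ; ∃; _×_; _,_; proj₁; proj₂)
open import Data.Rational.Base as ℚ using (ℚ; 0ℚ; 1ℚ; ½)
import Data.Rational.Properties as ℚₚ
open import Data.Rational.Solver using (module +-*-Solver)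
open import Data.Sum.Base using (_⊎_; inj₁; inj₂; [_,_]′)
open import Data.Vec.Base as Vec using (Vec; []; _∷_; _++_; concat; updateAt)
import Data.Vec.Properties as Vecₚ
open import Function.Base using (_∘_; const)
open import Function.Bundles using (Equivalence)
open import Level using (0ℓ)
open import Relation.Binary.Core using (Rel)
open import Relation.Binary.Definitions using (tri<; tri≈; tri>)
open import Relation.Binary.PropositionalEquality
open import Relation.Nullary.Decidable
  using (Dec; yes; no; ⌊_⌋; _×-dec_; _⊎-dec_; _→-dec_; ¬?; T?; map′; toWitness; fromWitness; from-yes)
open import Relation.Nullary.Negation using (¬_; contradiction; contradiction-irr)
open import Algebra.Properties.CommutativeMonoid.Sum ℚₚ.+-0-commutativeMonoid
  using (sum; sum-cong-≗)
open import Defs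

open +-*-Solver using (solve; _:=_; _:+_; _:*_; _:-_; :-_; con)

-- Expectations

-- The claim leaves no room for rounding. With x = (c n) ^ (1 / λ) and l = ln (c n), a phase may
-- take at most x l rounds, so k is x l rounded down, which costs about q in the exponent of (1 - q)
-- ^ k. The room is found in the constant 3. Of it, 1.37 is granted to surviving all phases, which
-- lets q exceed 1 / x so far that q x ≥ 1 + 1 / (4 λ); as l ≥ λ, this adds about 1 / 4 to q x l.
-- The quadratic term of - ln (1 - q), of which q ^ 2 / 4 is used, adds about q l / 4. Since q ≤ 5 /
-- 13, both together outweigh the rounding, and c n (1 - q) ^ k ≤ 1. Truncation then takes 13 / 8 =
-- 1 / (1 - 5 / 13) of the 3, up to a small error.
--
-- Comparison of reals is undecidable and the coins are fair. Hence k and q are computed from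
-- rational approximations, q is a dyadic fraction, and the resulting errors are budgeted in
-- thousandths.
--
-- Conditional probabilities are avoided: overwriting one block of coins by an independent copy
-- preserves expectations, so a single radius can be averaged while everything else stays fixed.

𝟙 : Bool → ℚ
𝟙 b = if b then 1ℚ else 0ℚ

0≤𝟙 : ∀ b → 0ℚ ℚ.≤ 𝟙 b
0≤𝟙 true  = 0≤1
0≤𝟙 false = ℚₚ.≤-refl

𝟙≤1 : ∀ b → 𝟙 b ℚ.≤ 1ℚ
𝟙≤1 true  = ℚₚ.≤-refl
𝟙≤1 false = 0≤1

𝟙-mono : ∀ {a b} → (T a → T b) → 𝟙 a ℚ.≤ 𝟙 b
𝟙-mono {true}  {true}  _   = ℚₚ.≤-refl
𝟙-mono {true}  {false} a⇒b with () ← a⇒b _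
𝟙-mono {false} {b}     _   = 0≤𝟙 b

𝟙-∧ : ∀ a b → 𝟙 (a ∧ b) ≡ 𝟙 a ℚ.* 𝟙 b
𝟙-∧ true  b = sym (ℚₚ.*-identityˡ (𝟙 b))
𝟙-∧ false b = sym (ℚₚ.*-zeroˡ (𝟙 b))

𝟙-not : ∀ b → 𝟙 b ≡ 1ℚ ℚ.- 𝟙 (not b)
𝟙-not true  = refl
𝟙-not false = refl

¬T⇒≡false : ∀ {b} → ¬ T b → b ≡ false
¬T⇒≡false {true}  ¬t = contradiction _ ¬t
¬T⇒≡false {false} _  = refl

p≤q+p : ∀ {q} p → 0ℚ ℚ.≤ q → p ℚ.≤ q ℚ.+ p
p≤q+p {q} p 0≤q = subst (p ℚ.≤_) (ℚₚ.+-comm p q) (p≤p+q p 0≤q)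

sum-mono : ∀ {n} {f g : Fin n → ℚ} → (∀ i → f i ℚ.≤ g i) → sum f ℚ.≤ sum g
sum-mono {zero}  f≤g = ℚₚ.≤-refl
sum-mono {suc n} f≤g = ℚₚ.+-mono-≤ (f≤g zero) (sum-mono (f≤g ∘ suc))

0≤sum : ∀ {n} {f : Fin n → ℚ} → (∀ i → 0ℚ ℚ.≤ f i) → 0ℚ ℚ.≤ sum f
0≤sum {zero}  0≤f = ℚₚ.≤-refl
0≤sum {suc n} 0≤f = 0≤+ (0≤f zero) (0≤sum (0≤f ∘ suc))

≤sum : ∀ {n} {f : Fin n → ℚ} → (∀ i → 0ℚ ℚ.≤ f i) → ∀ i → f i ℚ.≤ sum f
≤sum {f = f} 0≤f zero = p≤p+q (f zero) (0≤sum (0≤f ∘ suc))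
≤sum {f = f} 0≤f (suc i) = ℚₚ.≤-trans (≤sum (0≤f ∘ suc) i) (p≤q+p (sum (f ∘ suc)) (0≤f zero))

*-distrib-sum : ∀ {n} a (f : Fin n → ℚ) → a ℚ.* sum f ≡ sum (λ i → a ℚ.* f i)
*-distrib-sum {zero}  a f = ℚₚ.*-zeroʳ a
*-distrib-sum {suc n} a f = trans (ℚₚ.*-distribˡ-+ a (f zero) (sum (f ∘ suc)))
  (cong (a ℚ.* f zero ℚ.+_) (*-distrib-sum a (f ∘ suc)))

sum-const : ∀ n a → sum {n} (const a) ≡ ℕ→ℚ n ℚ.* a
sum-const zero    a = sym (ℚₚ.*-zeroˡ a)
sum-const (suc n) a = trans (cong (a ℚ.+_) (sum-const n a))
  (trans (ring (ℕ→ℚ n) a) (cong (ℚ._* a) (sym (ℕ→ℚ-suc n))))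
  where
  ring : ∀ m a → a ℚ.+ m ℚ.* a ≡ (m ℚ.+ 1ℚ) ℚ.* a
  ring = solve 2 (λ m a → a :+ m :* a := (m :+ con 1ℚ) :* a) refl

sum-zero : ∀ {n} {f : Fin n → ℚ} → (∀ i → f i ≡ 0ℚ) → sum f ≡ 0ℚ
sum-zero {n} f≡0 = trans (sum-cong-≗ f≡0) (trans (sum-const n 0ℚ) (ℚₚ.*-zeroʳ (ℕ→ℚ n)))

sum-exclusive : ∀ {n} (b : Fin n → Bool) → (∀ i j → T (b i) → T (b j) → i ≡ j) →
                sum (𝟙 ∘ b) ℚ.≤ 1ℚ
sum-exclusive {zero}  b excl = 0≤1
sum-exclusive {suc n} b excl = go (b zero) refl
  where
  open ℚₚ.≤-Reasoning
  rest-false : T (b zero) → ∀ i → b (suc i) ≡ false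
  rest-false b₀ i = ¬T⇒≡false λ bᵢ → Fₚ.0≢1+n (excl zero (suc i) b₀ bᵢ)
  go : ∀ c → b zero ≡ c → 𝟙 (b zero) ℚ.+ sum (𝟙 ∘ b ∘ suc) ℚ.≤ 1ℚ
  go true eq = ℚₚ.≤-reflexive (cong₂ ℚ._+_ (cong 𝟙 eq)
    (sum-zero λ i → cong 𝟙 (rest-false (subst T (sym eq) _) i)))
  go false eq = begin
    𝟙 (b zero) ℚ.+ sum (𝟙 ∘ b ∘ suc)  ≡⟨ cong (λ c → 𝟙 c ℚ.+ sum (𝟙 ∘ b ∘ suc)) eq ⟩
    0ℚ ℚ.+ sum (𝟙 ∘ b ∘ suc)          ≡⟨ ℚₚ.+-identityˡ _ ⟩
    sum (𝟙 ∘ b ∘ suc)                 ≤⟨ sum-exclusive (b ∘ suc) (λ i j bi bj → Fₚ.suc-injective (excl (suc i) (suc j) bi bj)) ⟩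
    1ℚ                                ∎

-- Tests whether a `b`-bit number is below `j`, leading digit first, where `true` stands for the
-- digit 0. This is how fair coins realise a bad trial of probability `j / 2 ^ b`.
dyadic : ∀ b → ℕ → Vec Bool b → Bool
dyadic zero    j []           = 0 ℕ.<ᵇ j
dyadic (suc b) j (true  ∷ xs) = dyadic b j xs
dyadic (suc b) j (false ∷ xs) = dyadic b (j ℕ.∸ 2 ℕ.^ b) xs

-- With `m = 2 ^ b`, this counts the numbers of `b + 1` bits below `j` by their leading digit. The
-- right-hand side has the form to which `j ⊓ 2 ^ suc b` computes.
⊓-halves : ∀ j m → (j ℕ.⊓ m) ℕ.+ ((j ℕ.∸ m) ℕ.⊓ m) ≡ j ℕ.⊓ (m ℕ.+ (m ℕ.+ 0))
⊓-halves j m with ℕₚ.≤-total j m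
... | inj₁ j≤m = trans (cong₂ ℕ._+_ (ℕₚ.m≤n⇒m⊓n≡m j≤m) (cong (ℕ._⊓ m) (ℕₚ.m≤n⇒m∸n≡0 j≤m)))
  (trans (ℕₚ.+-identityʳ j) (sym (ℕₚ.m≤n⇒m⊓n≡m (ℕₚ.≤-trans j≤m (ℕₚ.m≤m+n m _)))))
... | inj₂ m≤j = trans (cong (ℕ._+ ((j ℕ.∸ m) ℕ.⊓ m)) (ℕₚ.m≥n⇒m⊓n≡n m≤j))
  (trans (ℕₚ.+-distribˡ-⊓ m (j ℕ.∸ m) m)
    (cong₂ ℕ._⊓_ (ℕₚ.m+[n∸m]≡n m≤j) (cong (m ℕ.+_) (sym (ℕₚ.+-identityʳ m)))))

ℕ→ℚ-+ : ∀ m k → ℕ→ℚ (m ℕ.+ k) ≡ ℕ→ℚ m ℚ.+ ℕ→ℚ k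
ℕ→ℚ-+ zero    k = sym (ℚₚ.+-identityˡ (ℕ→ℚ k))
ℕ→ℚ-+ (suc m) k = trans (ℕ→ℚ-suc (m ℕ.+ k)) (trans (cong (ℚ._+ 1ℚ) (ℕ→ℚ-+ m k))
  (trans (ring (ℕ→ℚ m) (ℕ→ℚ k)) (cong (ℚ._+ ℕ→ℚ k) (sym (ℕ→ℚ-suc m)))))
  where
  ring : ∀ a b → (a ℚ.+ b) ℚ.+ 1ℚ ≡ (a ℚ.+ 1ℚ) ℚ.+ b
  ring = solve 2 (λ a b → (a :+ b) :+ con 1ℚ := (a :+ con 1ℚ) :+ b) refl

-- Expectation functionals, independence and resampling

record IsExpectation {X : Set} (E : (X → ℚ) → ℚ) : Set where
  field
    mono  : ∀ {f g} → (∀ x → f x ℚ.≤ g x) → E f ℚ.≤ E g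
    add   : ∀ f g → E (λ x → f x ℚ.+ g x) ≡ E f ℚ.+ E g
    scale : ∀ a f → E (λ x → a ℚ.* f x) ≡ a ℚ.* E f
    constant : ∀ a → E (λ _ → a) ≡ a

  ext : ∀ {f g} → (∀ x → f x ≡ g x) → E f ≡ E g
  ext f≗g = ℚₚ.≤-antisym (mono (ℚₚ.≤-reflexive ∘ f≗g)) (mono (ℚₚ.≤-reflexive ∘ sym ∘ f≗g))

  E-sum : ∀ {n} (f : Fin n → X → ℚ) → E (λ x → sum (λ i → f i x)) ≡ sum (λ i → E (f i))
  E-sum {zero}  f = constant 0ℚ
  E-sum {suc n} f = trans (add (f zero) _) (cong (E (f zero) ℚ.+_) (E-sum (f ∘ suc)))

-- Fubini's theorem for `E`. It holds for coin flips because `E` is then a finite combination of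
-- point evaluations and `F` is linear.
Commutes : {X : Set} → ((X → ℚ) → ℚ) → Set₁
Commutes {X} E = ∀ {Y : Set} {F : (Y → ℚ) → ℚ} → IsExpectation F → (f : X → Y → ℚ) →
  E (λ x → F (f x)) ≡ F (λ y → E (λ x → f x y))

-- Replacing, by means of h, a part of a random x by an independent sample of β
-- does not change the distribution of x.
Resamples : {X Y : Set} → ((X → ℚ) → ℚ) → ((Y → ℚ) → ℚ) → (Y → X → X) → Set
Resamples E β h = ∀ g → E g ≡ E (λ x → β (λ y → g (h y x)))

module Coins {n : ℕ} (A : Algorithm n) (N : Network n) where
  open Execution A N

  fairCoin-isExpectation : IsExpectation fairCoin
  fairCoin-isExpectation = record
    { mono  = λ f≤g → ℚₚ.+-mono-≤ (*-monoʳ ½ 0≤½ (f≤g true)) (*-monoʳ ½ 0≤½ (f≤g false))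
    ; add   = λ f g → ring₁ ½ (f true) (f false) (g true) (g false)
    ; scale = λ a f → ring₂ ½ a (f true) (f false)
    ; constant = λ a → trans (sym (ℚₚ.*-distribʳ-+ a ½ ½)) (ℚₚ.*-identityˡ a)
    }
    where
    0≤½ = ℚₚ.nonNegative⁻¹ ½
    ring₁ : ∀ h a b c d → h ℚ.* (a ℚ.+ c) ℚ.+ h ℚ.* (b ℚ.+ d) ≡ (h ℚ.* a ℚ.+ h ℚ.* b) ℚ.+ (h ℚ.* c ℚ.+ h ℚ.* d)
    ring₁ = solve 5 (λ h a b c d → h :* (a :+ c) :+ h :* (b :+ d) := (h :* a :+ h :* b) :+ (h :* c :+ h :* d)) refl
    ring₂ : ∀ h a c d → h ℚ.* (a ℚ.* c) ℚ.+ h ℚ.* (a ℚ.* d) ≡ a ℚ.* (h ℚ.* c ℚ.+ h ℚ.* d)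
    ring₂ = solve 4 (λ h a c d → h :* (a :* c) :+ h :* (a :* d) := a :* (h :* c :+ h :* d)) refl

  fairCoin-commutes : Commutes fairCoin
  fairCoin-commutes F-exp f = sym (trans (add _ _) (cong₂ ℚ._+_ (scale ½ (f true)) (scale ½ (f false))))
    where open IsExpectation F-exp

  module _ {X : Set} {E : (X → ℚ) → ℚ} (E-exp : IsExpectation E) where
    private module E = IsExpectation E-exp

    independent-isExpectation : ∀ k → IsExpectation (independent k E)
    independent-isExpectation zero = record
      { mono = λ f≤g → f≤g [] ; add = λ _ _ → refl ; scale = λ _ _ → refl ; constant = λ _ → refl }
    independent-isExpectation (suc k) = record
      { mono  = λ f≤g → E.mono λ x → I.mono λ xs → f≤g (x ∷ xs)
      ; add   = λ f g → trans (E.ext λ x → I.add _ _) (E.add _ _)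
      ; scale = λ a f → trans (E.ext λ x → I.scale a _) (E.scale a _)
      ; constant = λ a → trans (E.ext λ x → I.constant a) (E.constant a)
      }
      where module I = IsExpectation (independent-isExpectation k)

    independent-commutes : Commutes E → ∀ k → Commutes (independent k E)
    independent-commutes E-comm zero    F-exp f = refl
    independent-commutes E-comm (suc k) F-exp f = trans
      (E.ext λ x → independent-commutes E-comm k F-exp (λ xs → f (x ∷ xs)))
      (E-comm F-exp _)

    independent-++ : ∀ m k (f : Vec X (m ℕ.+ k) → ℚ) →
      independent (m ℕ.+ k) E f ≡ independent m E (λ xs → independent k E (λ ys → f (xs ++ ys)))
    independent-++ zero    k f = refl
    independent-++ (suc m) k f = E.ext λ x → independent-++ m k (λ xs → f (x ∷ xs))

    independent-concat : ∀ m k (f : Vec X (m ℕ.* k) → ℚ) →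
      independent (m ℕ.* k) E f ≡ independent m (independent k E) (f ∘ concat)
    independent-concat zero    k f = refl
    independent-concat (suc m) k f = trans (independent-++ k (m ℕ.* k) f)
      (IsExpectation.ext (independent-isExpectation k)
        λ xs → independent-concat m k (λ ys → f (xs ++ ys)))

    -- The hypothesis draws the fresh sample right beside the coordinate that it changes, the
    -- conclusion draws it after all coordinates; `Commutes` moves it past the later ones.
    independent-resamples : ∀ {Y} {β : (Y → ℚ) → ℚ} {h : Y → X → X} → IsExpectation β → Commutes β →
      Resamples E β h → ∀ k i → Resamples (independent k E) β (λ y xs → updateAt xs i (h y))
    independent-resamples β-exp β-comm E-res (suc k) zero g = trans
      (E-res (λ x → independent k E λ xs → g (x ∷ xs)))
      (E.ext λ x → β-comm (independent-isExpectation k) _)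
    independent-resamples β-exp β-comm E-res (suc k) (suc i) g =
      E.ext λ x → independent-resamples β-exp β-comm E-res k i (λ xs → g (x ∷ xs))

    resamples-self : Resamples E E (λ y _ → y)
    resamples-self g = sym (E.constant (E g))

    independent-map : ∀ {Y} {F : (Y → ℚ) → ℚ} (h : Y → X) → (∀ f → E f ≡ F (f ∘ h)) → IsExpectation F →
      ∀ k f → independent k E f ≡ independent k F (f ∘ Vec.map h)
    independent-map h eq F-exp zero    f = refl
    independent-map h eq F-exp (suc k) f = trans (eq _)
      (IsExpectation.ext F-exp λ y → independent-map h eq F-exp k (λ xs → f (h y ∷ xs)))

  dyadic-probability : ∀ b j → independent b fairCoin (𝟙 ∘ dyadic b j) ≡ ℕ→ℚ (j ℕ.⊓ 2 ℕ.^ b) ℚ.* ½ ^ b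
  dyadic-probability zero zero          = refl
  dyadic-probability zero (suc zero)    = refl
  dyadic-probability zero (suc (suc j)) = refl
  dyadic-probability (suc b) j = begin
    ½ ℚ.* independent b fairCoin (𝟙 ∘ dyadic b j) ℚ.+
    ½ ℚ.* independent b fairCoin (𝟙 ∘ dyadic b (j ℕ.∸ 2 ℕ.^ b))
      ≡⟨ cong₂ (λ x y → ½ ℚ.* x ℚ.+ ½ ℚ.* y) (dyadic-probability b j) (dyadic-probability b (j ℕ.∸ 2 ℕ.^ b)) ⟩
    ½ ℚ.* (ℕ→ℚ u ℚ.* ½ ^ b) ℚ.+ ½ ℚ.* (ℕ→ℚ v ℚ.* ½ ^ b)
      ≡⟨ ring ½ (ℕ→ℚ u) (ℕ→ℚ v) (½ ^ b) ⟩
    (ℕ→ℚ u ℚ.+ ℕ→ℚ v) ℚ.* (½ ℚ.* ½ ^ b)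
      ≡⟨ cong (ℚ._* (½ ℚ.* ½ ^ b)) (trans (sym (ℕ→ℚ-+ u v)) (cong ℕ→ℚ (⊓-halves j (2 ℕ.^ b)))) ⟩
    ℕ→ℚ (j ℕ.⊓ 2 ℕ.^ suc b) ℚ.* (½ ℚ.* ½ ^ b) ∎
    where
    open ≡-Reasoning
    u = j ℕ.⊓ 2 ℕ.^ b
    v = (j ℕ.∸ 2 ℕ.^ b) ℕ.⊓ 2 ℕ.^ b
    ring : ∀ h a b p → h ℚ.* (a ℚ.* p) ℚ.+ h ℚ.* (b ℚ.* p) ≡ (a ℚ.+ b) ℚ.* (h ℚ.* p)
    ring = solve 4 (λ h a b p → h :* (a :* p) :+ h :* (b :* p) := (a :+ b) :* (h :* p)) refl

-- Truncated geometric runs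

run : ∀ {Y : Set} → (Y → Bool) → ∀ {k} → Vec Y k → ℕ
run bad []       = 0
run bad (y ∷ ys) = if bad y then 0 else suc (run bad ys)

run≤ : ∀ {Y : Set} (bad : Y → Bool) {k} (ys : Vec Y k) → run bad ys ℕ.≤ k
run≤ bad [] = ℕ.z≤n
run≤ bad (y ∷ ys) with bad y
... | true  = ℕ.z≤n
... | false = ℕ.s≤s (run≤ bad ys)

-- For an increasing `g` this singles out the one index at which `g` switches to `true`.
first : (ℕ → Bool) → ℕ → Bool
first g zero    = g zero
first g (suc i) = g (suc i) ∧ not (g i)

module Geometric {n : ℕ} (A : Algorithm n) (N : Network n)
  {Y : Set} {F : (Y → ℚ) → ℚ} (F-exp : IsExpectation F) (bad : Y → Bool) where
  open Execution A N
  open Coins A N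
  private
    module F = IsExpectation F-exp
    module I k = IsExpectation (independent-isExpectation F-exp k)

  q : ℚ
  q = F (𝟙 ∘ bad)

  0≤q : 0ℚ ℚ.≤ q
  0≤q = subst (ℚ._≤ q) (F.constant 0ℚ) (F.mono (0≤𝟙 ∘ bad))

  q≤1 : q ℚ.≤ 1ℚ
  q≤1 = subst (q ℚ.≤_) (F.constant 1ℚ) (F.mono (𝟙≤1 ∘ bad))

  -- Conditioning on the first trial: the average over the later trials is an affine function of the
  -- indicator of a bad first one.
  run-step : ∀ k (φ : ℕ → ℚ) → independent (suc k) F (φ ∘ run bad) ≡
    q ℚ.* φ 0 ℚ.+ (1ℚ ℚ.- q) ℚ.* independent k F (φ ∘ suc ∘ run bad)
  run-step k φ = begin
    F (λ y → independent k F λ ys → φ (run bad (y ∷ ys)))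
      ≡⟨ F.ext (λ y → pointwise y (bad y) refl) ⟩
    F (λ y → (φ 0 ℚ.- R) ℚ.* 𝟙 (bad y) ℚ.+ R)
      ≡⟨ trans (F.add _ _) (cong₂ ℚ._+_ (F.scale (φ 0 ℚ.- R) (𝟙 ∘ bad)) (F.constant R)) ⟩
    (φ 0 ℚ.- R) ℚ.* q ℚ.+ R
      ≡⟨ ring (φ 0) R q ⟩
    q ℚ.* φ 0 ℚ.+ (1ℚ ℚ.- q) ℚ.* R ∎
    where
    open ≡-Reasoning
    R = independent k F (φ ∘ suc ∘ run bad)
    ring : ∀ a r q → (a ℚ.- r) ℚ.* q ℚ.+ r ≡ q ℚ.* a ℚ.+ (1ℚ ℚ.- q) ℚ.* r
    ring = solve 3 (λ a r q → (a :- r) :* q :+ r := q :* a :+ (con 1ℚ :- q) :* r) refl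
    ring₀ : ∀ a r → a ≡ (a ℚ.- r) ℚ.* 1ℚ ℚ.+ r
    ring₀ = solve 2 (λ a r → a := (a :- r) :* con 1ℚ :+ r) refl
    ring₁ : ∀ a r → r ≡ (a ℚ.- r) ℚ.* 0ℚ ℚ.+ r
    ring₁ = solve 2 (λ a r → r := (a :- r) :* con 0ℚ :+ r) refl
    pointwise : ∀ y c → bad y ≡ c → independent k F (λ ys → φ (run bad (y ∷ ys))) ≡ (φ 0 ℚ.- R) ℚ.* 𝟙 (bad y) ℚ.+ R
    pointwise y true  eq rewrite eq = trans (I.constant k (φ 0)) (ring₀ (φ 0) R)
    pointwise y false eq rewrite eq = ring₁ (φ 0) R

  run-full : ∀ k → independent k F (λ ys → 𝟙 (run bad ys ℕ.≡ᵇ k)) ≡ (1ℚ ℚ.- q) ^ k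
  run-full zero    = refl
  run-full (suc k) = trans (run-step k (λ i → 𝟙 (i ℕ.≡ᵇ suc k)))
    (trans (ring q ((1ℚ ℚ.- q) ℚ.* independent k F (λ ys → 𝟙 (run bad ys ℕ.≡ᵇ k))))
           (cong ((1ℚ ℚ.- q) ℚ.*_) (run-full k)))
    where
    ring : ∀ q r → q ℚ.* 0ℚ ℚ.+ r ≡ r
    ring = solve 2 (λ q r → q :* con 0ℚ :+ r := r) refl

  -- Memorylessness: the run reaches the first index at which the increasing g
  -- holds with probability E g, and it stops right there only if the next trial
  -- is bad.
  run-first : ∀ k (g : ℕ → Bool) → (∀ i → T (g i) → T (g (suc i))) →
    independent k F (λ ys → 𝟙 (first g (run bad ys) ∧ (run bad ys ℕ.<ᵇ k))) ℚ.≤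
    q ℚ.* independent k F (λ ys → 𝟙 (g (run bad ys)))
  run-first zero g g-mono = subst (ℚ._≤ q ℚ.* 𝟙 (g 0)) (cong 𝟙 (sym (Boolₚ.∧-zeroʳ (g 0))))
    (0≤* 0≤q (0≤𝟙 (g 0)))
  run-first (suc k) g g-mono = go (g 0) refl
    where
    open ℚₚ.≤-Reasoning
    ψ : ℕ → ℚ
    ψ i = 𝟙 (first g i ∧ (i ℕ.<ᵇ suc k))
    all-true : g 0 ≡ true → ∀ i → g i ≡ true
    all-true g0 zero    = g0
    all-true g0 (suc i) with g i | g (suc i) | all-true g0 i | g-mono i
    ... | .true | true  | refl | _    = refl
    ... | .true | false | refl | i⇒si with () ← i⇒si _
    ring₀ : ∀ q → q ℚ.* 1ℚ ℚ.+ (1ℚ ℚ.- q) ℚ.* 0ℚ ≡ q ℚ.* 1ℚ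
    ring₀ = solve 1 (λ q → q :* con 1ℚ :+ (con 1ℚ :- q) :* con 0ℚ := q :* con 1ℚ) refl
    ring₁ : ∀ q r → q ℚ.* 0ℚ ℚ.+ r ≡ r
    ring₁ = solve 2 (λ q r → q :* con 0ℚ :+ r := r) refl
    ring₂ : ∀ q r → (1ℚ ℚ.- q) ℚ.* (q ℚ.* r) ≡ q ℚ.* (q ℚ.* 0ℚ ℚ.+ (1ℚ ℚ.- q) ℚ.* r)
    ring₂ = solve 2 (λ q r → (con 1ℚ :- q) :* (q :* r) := q :* (q :* con 0ℚ :+ (con 1ℚ :- q) :* r)) refl
    go : ∀ c → g 0 ≡ c → independent (suc k) F (ψ ∘ run bad) ℚ.≤ q ℚ.* independent (suc k) F (𝟙 ∘ g ∘ run bad)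
    -- If `g 0` holds, the switch is at 0 and only a bad first trial counts. Otherwise a good first
    -- trial leaves the same problem for `g ∘ suc`.
    go true g0 = ℚₚ.≤-reflexive (trans (run-step k ψ) (trans
      (cong₂ (λ a b → q ℚ.* a ℚ.+ (1ℚ ℚ.- q) ℚ.* b)
        (cong (λ c → 𝟙 (c ∧ true)) g0)
        (trans (I.ext k λ ys → cong (λ c → 𝟙 (c ∧ (suc (run bad ys) ℕ.<ᵇ suc k)))
          (trans (cong (λ c → g (suc (run bad ys)) ∧ not c) (all-true g0 (run bad ys))) (Boolₚ.∧-zeroʳ _)))
          (I.constant k 0ℚ)))
      (trans (ring₀ q) (cong (q ℚ.*_) (sym (trans
        (I.ext (suc k) λ ys → cong 𝟙 (all-true g0 (run bad ys))) (I.constant (suc k) 1ℚ)))))))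
    go false g0 = begin
      independent (suc k) F (ψ ∘ run bad)
        ≡⟨ run-step k ψ ⟩
      q ℚ.* ψ 0 ℚ.+ (1ℚ ℚ.- q) ℚ.* independent k F (ψ ∘ suc ∘ run bad)
        ≡⟨ trans (cong (λ c → q ℚ.* 𝟙 (c ∧ true) ℚ.+ (1ℚ ℚ.- q) ℚ.* independent k F (ψ ∘ suc ∘ run bad)) g0)
                 (ring₁ q _) ⟩
      (1ℚ ℚ.- q) ℚ.* independent k F (ψ ∘ suc ∘ run bad)
        ≡⟨ cong ((1ℚ ℚ.- q) ℚ.*_) (I.ext k λ ys → cong (λ c → 𝟙 (c ∧ (run bad ys ℕ.<ᵇ k))) (first-suc (run bad ys))) ⟩
      (1ℚ ℚ.- q) ℚ.* independent k F (λ ys → 𝟙 (first (g ∘ suc) (run bad ys) ∧ (run bad ys ℕ.<ᵇ k)))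
        ≤⟨ *-monoʳ (1ℚ ℚ.- q) (0≤diff q≤1) (run-first k (g ∘ suc) (g-mono ∘ suc)) ⟩
      (1ℚ ℚ.- q) ℚ.* (q ℚ.* independent k F (𝟙 ∘ g ∘ suc ∘ run bad))
        ≡⟨ ring₂ q _ ⟩
      q ℚ.* (q ℚ.* 0ℚ ℚ.+ (1ℚ ℚ.- q) ℚ.* independent k F (𝟙 ∘ g ∘ suc ∘ run bad))
        ≡⟨ cong (λ c → q ℚ.* (q ℚ.* 𝟙 c ℚ.+ (1ℚ ℚ.- q) ℚ.* independent k F (𝟙 ∘ g ∘ suc ∘ run bad))) g0 ⟨
      q ℚ.* (q ℚ.* 𝟙 (g 0) ℚ.+ (1ℚ ℚ.- q) ℚ.* independent k F (𝟙 ∘ g ∘ suc ∘ run bad))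
        ≡⟨ cong (q ℚ.*_) (run-step k (𝟙 ∘ g)) ⟨
      q ℚ.* independent (suc k) F (𝟙 ∘ g ∘ run bad) ∎
      where
      first-suc : ∀ i → first g (suc i) ≡ first (g ∘ suc) i
      first-suc zero    = trans (cong (λ c → g 1 ∧ not c) g0) (Boolₚ.∧-identityʳ (g 1))
      first-suc (suc i) = refl

-- Shifted broadcasts

maximal : ∀ {n} (f : Fin n → ℕ) {P : Fin n → Set} → (∀ u → Dec (P u)) → ∃ P →
          ∃ λ u → P u × ∀ w → P w → f w ℕ.≤ f u
maximal {suc n} f {P} P? (u₀ , p₀) with Fₚ.any? (P? ∘ suc)
... | no none = zero , only-zero u₀ p₀ , λ { zero _ → ℕₚ.≤-refl ; (suc w) pw → contradiction (w , pw) none }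
  where
  only-zero : ∀ u → P u → P zero
  only-zero zero    p = p
  only-zero (suc u) p = contradiction (u , p) none
... | yes some with maximal (f ∘ suc) (P? ∘ suc) some | P? zero
...   | u , pu , max | no ¬p0 = suc u , pu , λ { zero p → contradiction p ¬p0 ; (suc w) → max w }
...   | u , pu , max | yes p0 with ℕₚ.≤-total (f zero) (f (suc u))
...     | inj₁ 0≤u = suc u , pu , λ { zero _ → 0≤u ; (suc w) → max w }
...     | inj₂ u≤0 = zero , p0 , λ { zero _ → ℕₚ.≤-refl ; (suc w) pw → ℕₚ.≤-trans (max w pw) u≤0 }

⌊⌋-cong : {P Q : Set} → (P → Q) → (Q → P) → (P? : Dec P) (Q? : Dec Q) → ⌊ P? ⌋ ≡ ⌊ Q? ⌋
⌊⌋-cong P⇒Q Q⇒P (yes _) (yes _) = refl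
⌊⌋-cong P⇒Q Q⇒P (yes p) (no ¬q) = contradiction (P⇒Q p) ¬q
⌊⌋-cong P⇒Q Q⇒P (no ¬p) (yes q) = contradiction (Q⇒P q) ¬p
⌊⌋-cong P⇒Q Q⇒P (no _)  (no _)  = refl

least : {P : ℕ → Set} → (∀ m → Dec (P m)) → ∀ {k} → P k → ∃ λ d → d ℕ.≤ k × P d × ∀ m → P m → d ℕ.≤ m
least P? {zero}  p = 0 , ℕ.z≤n , p , λ _ _ → ℕ.z≤n
least P? {suc k} p with P? 0
... | yes p₀ = 0 , ℕ.z≤n , p₀ , λ _ _ → ℕ.z≤n
... | no ¬p₀ = let d , d≤k , pd , minimal = least (P? ∘ suc) p in
  suc d , ℕ.s≤s d≤k , pd , λ { zero p₀ → contradiction p₀ ¬p₀ ; (suc m) pm → ℕ.s≤s (minimal m pm) }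

-- Walks inside a cluster

module _ {A : Set} {_∼_ : Rel A 0ℓ} where

  _◅◅_ : ∀ {j k u v w} → Walk _∼_ j u v → Walk _∼_ k v w → Walk _∼_ (j ℕ.+ k) u w
  stay     ◅◅ q = q
  step e p ◅◅ q = step e (p ◅◅ q)

  reverse : (∀ {u v} → u ∼ v → v ∼ u) → ∀ {k u v} → Walk _∼_ k u v → Walk _∼_ k v u
  reverse sym-∼ stay = stay
  reverse sym-∼ (step {k} {u} {v} {w} e p) =
    subst (λ j → Walk _∼_ j w u) (ℕₚ.+-comm k 1) (reverse sym-∼ p ◅◅ step (sym-∼ e) stay)

module ClusterWalks {n : ℕ} (G : Graph n) (P : Clustering n) (i : ℕ) where

  Cluster-≡ : ∀ {u v : Cluster G P i} → proj₁ u ≡ proj₁ v → u ≡ v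
  Cluster-≡ {u , p} {.u , p′} refl = cong (u ,_) (ℕₚ.≡-irrelevant p p′)

  -- Decidability turns the existence of some walk into an exact distance, which `IsDistance`
  -- demands.
  walk? : ∀ k u v → Dec (Walk (InducedAdjacent G P i) k u v)
  walk? zero u v with proj₁ u Fₚ.≟ proj₁ v
  ... | yes u≡v = yes (subst (Walk _ 0 u) (Cluster-≡ u≡v) stay)
  ... | no  u≢v = no λ { stay → u≢v refl }
  walk? (suc k) (u , u∈) v = map′ (λ { (w , w∈ , e , p) → step e p }) (λ { (step {v = w , w∈} e p) → w , w∈ , e , p })
    (Fₚ.any? λ w → via w (P w ℕₚ.≟ i))
    where
    via : ∀ w → Dec (P w ≡ i) → Dec (Σ (P w ≡ i) λ w∈ → Adjacent G u w × Walk (InducedAdjacent G P i) k (w , w∈) v)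
    via w (no w∉)  = no (w∉ ∘ proj₁)
    via w (yes w∈) = map′ (w∈ ,_)
      (λ { (w∈′ , e , p) → e , subst (λ x → Walk (InducedAdjacent G P i) k x v) (Cluster-≡ refl) p })
      (T? _ ×-dec walk? k (w , w∈) v)

  -- A walk of `G` through vertices with `Q`. It can be built before the clusters of these vertices
  -- are known; `path⇒walk` later places it in the induced subgraph.
  data Path (Q : Fin n → Set) : ℕ → Fin n → Fin n → Set where
    stay : ∀ {u} → Q u → Path Q 0 u u
    step : ∀ {k u v w} → Q u → Adjacent G u v → Path Q k v w → Path Q (suc k) u w

  path-end : ∀ {Q k u v} → Path Q k u v → Q v
  path-end (stay q)     = q
  path-end (step _ _ p) = path-end p

  path⇒walk : ∀ {Q} → (∀ {v} → Q v → P v ≡ i) → ∀ {k u v} → Path Q k u v →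
              ∀ u∈ v∈ → Walk (InducedAdjacent G P i) k (u , u∈) (v , v∈)
  path⇒walk Q⇒i (stay _)      u∈ v∈ = subst (Walk _ 0 _) (Cluster-≡ refl) stay
  path⇒walk Q⇒i (step _ e p) u∈ v∈ = step {v = _ , Q⇒i (head p)} e (path⇒walk Q⇒i p _ v∈)
    where
    head : ∀ {Q k u v} → Path Q k u v → Q u
    head (stay q)     = q
    head (step q _ _) = q

  distance : ∀ {k u v} → Walk (InducedAdjacent G P i) k u v →
             ∃ λ d → IsDistance (InducedAdjacent G P i) u v d × d ℕ.≤ k
  distance p = let d , d≤k , q , minimal = least (λ m → walk? m _ _) p in d , (q , minimal) , d≤k

module Shifts {n : ℕ} (G : Graph n) (rank : Fin n → ℕ) (rank-injective : ∀ {u v} → rank u ≡ rank v → u ≡ v) (k : ℕ) where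

  adjacent-sym : ∀ {u v} → Adjacent G u v → Adjacent G v u
  adjacent-sym {u} {v} = subst T (adj-sym G u v)

  -- A vertex u with radius i starts to broadcast at time k ∸ i. It has been
  -- heard by y (through the set A) before time s.
  Heard : (Fin n → Bool) → ℕ → ℕ → Fin n → Fin n → Set
  Heard A i zero    u y = ⊥
  Heard A i (suc s) u y =
    T (A y) × ((u ≡ y × k ℕ.≤ s ℕ.+ i) ⊎ Heard A i s u y ⊎ ∃ λ z → Adjacent G y z × Heard A i s u z)

  heard? : ∀ A i s u y → Dec (Heard A i s u y)
  heard? A i zero    u y = no λ ()
  heard? A i (suc s) u y = T? (A y) ×-dec ((u Fₚ.≟ y ×-dec k ℕₚ.≤? s ℕ.+ i) ⊎-dec
    (heard? A i s u y ⊎-dec Fₚ.any? λ z → T? _ ×-dec heard? A i s u z))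

  module _ {A : Fin n → Bool} where

    heard-alive : ∀ {i} s {u y} → Heard A i s u y → T (A y)
    heard-alive (suc s) = proj₁

    heard-source : ∀ {i} s {u y} → Heard A i s u y → T (A u)
    heard-source (suc s) (y∈A , inj₁ (refl , _)) = y∈A
    heard-source (suc s) (_ , inj₂ (inj₁ h)) = heard-source s h
    heard-source (suc s) (_ , inj₂ (inj₂ (_ , _ , h))) = heard-source s h

    heard-suc : ∀ {i} s {u y} → Heard A i s u y → Heard A i (suc s) u y
    heard-suc s h = heard-alive s h , inj₂ (inj₁ h)

    heard-hop : ∀ {i} s {u y z} → T (A y) → Adjacent G y z → Heard A i s u z → Heard A i (suc s) u y
    heard-hop s y∈A e h = y∈A , inj₂ (inj₂ (_ , e , h))

    heard-mono : ∀ {i s s′ u y} → s ℕ.≤ s′ → Heard A i s u y → Heard A i s′ u y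
    heard-mono {i} {s} {u = u} {y} s≤s′ h = go (ℕₚ.≤⇒≤′ s≤s′)
      where
      go : ∀ {s′} → s ℕ.≤′ s′ → Heard A i s′ u y
      go ℕ.≤′-refl = h
      go (ℕ.≤′-step {s′} s≤s′) = heard-suc s′ (go s≤s′)

    heard-mono-radius : ∀ {i j} s {u y} → i ℕ.≤ j → Heard A i s u y → Heard A j s u y
    heard-mono-radius (suc s) i≤j (y∈A , inj₁ (u≡y , k≤)) = y∈A , inj₁ (u≡y , ℕₚ.≤-trans k≤ (ℕₚ.+-monoʳ-≤ s i≤j))
    heard-mono-radius (suc s) i≤j (y∈A , inj₂ (inj₁ h)) = y∈A , inj₂ (inj₁ (heard-mono-radius s i≤j h))
    heard-mono-radius (suc s) i≤j (y∈A , inj₂ (inj₂ (z , e , h))) = y∈A , inj₂ (inj₂ (z , e , heard-mono-radius s i≤j h))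

    -- One more unit of radius is worth one round. Hearing at time 0, which could not be advanced,
    -- is ruled out by `i < k`.
    heard-advance : ∀ {i} s {u y} → i ℕ.< k → Heard A i (suc s) u y → Heard A (suc i) s u y
    heard-advance zero i<k (_ , inj₁ (_ , k≤i)) = contradiction i<k (ℕₚ.≤⇒≯ k≤i)
    heard-advance zero i<k (_ , inj₂ (inj₁ ()))
    heard-advance zero i<k (_ , inj₂ (inj₂ (_ , _ , ())))
    heard-advance {i} (suc s) i<k (y∈A , inj₁ (u≡y , k≤)) = y∈A , inj₁ (u≡y , subst (k ℕ.≤_) (sym (ℕₚ.+-suc s i)) k≤)
    heard-advance (suc s) i<k (y∈A , inj₂ (inj₁ h)) = y∈A , inj₂ (inj₁ (heard-advance s i<k h))
    heard-advance (suc s) i<k (y∈A , inj₂ (inj₂ (z , e , h))) = y∈A , inj₂ (inj₂ (z , e , heard-advance s i<k h))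

  module _ (A : Fin n → Bool) (r : Fin n → ℕ) where

    -- At time s + 1 the lead of u over its competitors is certain to exceed one
    -- round, up to ties, which the greater rank wins.
    Settles : ℕ → Fin n → Fin n → Set
    Settles s y u = Heard A (r u) (suc s) u y
      × (∀ w → Heard A (r w) (suc s) w y → rank u ℕ.≤ rank w)
      × (∀ w → Heard A (r w) (suc (suc s)) w y → rank w ℕ.≤ rank u)

    settles? : ∀ s y u → Dec (Settles s y u)
    settles? s y u = heard? _ _ _ _ _ ×-dec
      (Fₚ.all? (λ w → heard? _ _ _ _ _ →-dec (rank u ℕₚ.≤? rank w)) ×-dec
       Fₚ.all? (λ w → heard? _ _ _ _ _ →-dec (rank w ℕₚ.≤? rank u)))

    -- The test at `s` looks one round ahead, so `s < k` makes a phase fit into exactly `k` rounds.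
    Joins : Fin n → Fin n → Set
    Joins y u = ∃ λ s → s ℕ.< k × Settles s y u

    joins? : ∀ y u → Dec (Joins y u)
    joins? y u = ℕₚ.anyUpTo? (λ s → settles? s y u) k

    -- The radius of u is i here, not r u.
    Wins : ℕ → Fin n → Fin n → Set
    Wins i y u = ∃ λ s → s ℕ.< suc k × Heard A i (suc s) u y ×
      ∀ w → w ≢ u → ¬ Heard A (r w) s w y × (Heard A (r w) (suc s) w y → rank w ℕ.< rank u)

    wins? : ∀ i y u → Dec (Wins i y u)
    wins? i y u = ℕₚ.anyUpTo? (λ s → heard? A i (suc s) u y ×-dec
      Fₚ.all? λ w → (¬? (w Fₚ.≟ u)) →-dec ((¬? (heard? _ _ _ _ _)) ×-dec (heard? _ _ _ _ _ →-dec (rank w ℕₚ.<? rank u)))) (suc k)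

    -- One more round carries `u` from `y` to `z`, where the upper bound gives `rank u ≤ rank w`.
    -- Conversely, if `s < s′`, then `u` reaches `z` early enough for the lower bound there; if the
    -- times agree, `w` reaches `y` in time for the upper bound at `y`.
    settles-joins-≤ : ∀ {s s′ y z u w} → s ℕ.≤ s′ → Adjacent G y z → Settles s y u → Settles s′ z w → u ≡ w
    settles-joins-≤ {s} {s′} s≤s′ e (hu , _ , maxu) (hw , minw , maxw) = rank-injective
      (ℕₚ.≤-antisym (maxw _ (heard-mono (ℕ.s≤s (ℕ.s≤s s≤s′)) hu′)) w≤u)
      where
      hu′ = heard-hop (suc s) (heard-alive (suc s′) hw) (adjacent-sym e) hu
      w≤u : _
      w≤u with ℕₚ.m≤n⇒m<n∨m≡n s≤s′
      ... | inj₁ s<s′ = minw _ (heard-mono (ℕ.s≤s s<s′) hu′)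
      ... | inj₂ refl = maxu _ (heard-hop (suc s) (heard-alive (suc s) hu) e hw)

    joins-adjacent : ∀ {y z u w} → Adjacent G y z → Joins y u → Joins z w → u ≡ w
    joins-adjacent e (s , _ , S) (s′ , _ , S′) with ℕₚ.≤-total s s′
    ... | inj₁ s≤s′ = settles-joins-≤ s≤s′ e S S′
    ... | inj₂ s′≤s = sym (settles-joins-≤ s′≤s (adjacent-sym e) S′ S)

    settles-unique-≤ : ∀ {s s′ y u w} → s ℕ.≤ s′ → Settles s y u → Settles s′ y w → u ≡ w
    settles-unique-≤ s≤s′ (hu , _) (hw , minw , maxw) = rank-injective (ℕₚ.≤-antisym
      (maxw _ (heard-mono (ℕ.s≤s (ℕₚ.m≤n⇒m≤1+n s≤s′)) hu))
      (minw _ (heard-mono (ℕ.s≤s s≤s′) hu)))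

    joins-unique : ∀ {y u w} → Joins y u → Joins y w → u ≡ w
    joins-unique (s , _ , S) (s′ , _ , S′) with ℕₚ.≤-total s s′
    ... | inj₁ s≤s′ = settles-unique-≤ s≤s′ S S′
    ... | inj₂ s′≤s = sym (settles-unique-≤ s′≤s S′ S)

    -- The neighbour through which `y` heard `u` settles on `u` one step earlier: all that it hears
    -- reaches `y` a round later, so the bounds at `y` apply to it. Descending in `s` leads to `u`
    -- through vertices that all join `u`.
    joins-path : ∀ {P : Clustering n} {i} s {y u} → s ℕ.< k → Settles s y u →
                 ∃ λ j → j ℕ.≤ s × ClusterWalks.Path G P i (λ v → Joins v u) j y u
    joins-path s s<k S@((_ , inj₁ (refl , _)) , _) = 0 , ℕ.z≤n , ClusterWalks.stay (s , s<k , S)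
    joins-path (suc s) s<k ((y∈A , inj₂ (inj₁ h)) , minu , maxu) =
      let j , j≤s , p = joins-path s (ℕₚ.<⇒≤ s<k)
            (h , (λ w → minu w ∘ heard-suc (suc s)) , (λ w → maxu w ∘ heard-suc (suc (suc s))))
      in j , ℕₚ.m≤n⇒m≤1+n j≤s , p
    joins-path (suc s) s<k S@((y∈A , inj₂ (inj₂ (z , e , h))) , minu , maxu) =
      let j , j≤s , p = joins-path s (ℕₚ.<⇒≤ s<k)
            (h , (λ w → minu w ∘ heard-hop (suc s) y∈A e) , (λ w → maxu w ∘ heard-hop (suc (suc s)) y∈A e))
      in suc j , ℕ.s≤s j≤s , ClusterWalks.step (suc s , s<k , S) e p

    wins-mono : ∀ {i y u} → Wins i y u → Wins (suc i) y u
    wins-mono (s , s≤k , h , best) = s , s≤k , heard-mono-radius (suc s) (ℕₚ.n≤1+n _) h , best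

    wins-unique : ∀ {y u w} → Wins (r u) y u → Wins (r w) y w → u ≡ w
    wins-unique {y} {u} {w} (s , _ , h , best) (s′ , _ , h′ , best′) with u Fₚ.≟ w
    ... | yes u≡w = u≡w
    ... | no  u≢w with ℕₚ.<-cmp s s′
    ...   | tri< s<s′ _ _ = contradiction (heard-mono s<s′ h) (proj₁ (best′ u u≢w))
    ...   | tri> _ _ s′<s = contradiction (heard-mono s′<s h′) (proj₁ (best w (u≢w ∘ sym)))
    ...   | tri≈ _ refl _ = contradiction (proj₂ (best′ u u≢w) h) (ℕₚ.<-asym (proj₂ (best w (u≢w ∘ sym)) h′))

    -- A remaining vertex hears itself at time `k` at the latest, so there is a first time at which
    -- it hears anyone; among the vertices heard then, the one of greatest rank wins.
    wins-exists : ∀ {y} → T (A y) → ∃ λ u → Wins (r u) y u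
    wins-exists {y} y∈A =
      let s , s≤k , some , minimal = least {P = λ s → ∃ λ u → Heard A (r u) (suc s) u y}
            (λ s → Fₚ.any? λ u → heard? _ _ _ _ _) {k} (y , y∈A , inj₁ (refl , ℕₚ.m≤m+n k (r y)))
          u , h , max = maximal rank (λ u → heard? _ (r u) _ _ _) some
      in u , s , ℕ.s≤s s≤k , h , λ w w≢u → earlier s minimal w , λ (h′ : Heard A (r w) (suc s) w y) → ℕₚ.≤∧≢⇒< (max w h′) (w≢u ∘ rank-injective)
      where
      earlier : ∀ s → (∀ m → (∃ λ u → Heard A (r u) (suc m) u y) → s ℕ.≤ m) → ∀ w → ¬ Heard A (r w) s w y
      earlier (suc s) minimal w h = ℕₚ.1+n≰n (minimal s (w , h))

    -- A winner that would still win with a smaller radius is far enough ahead.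
    wins-joins : ∀ {i y u} → i ℕ.< k → r u ≡ suc i → Wins i y u → Joins y u
    wins-joins i<k _ (zero , _ , h , _) with () ← heard-advance {A} zero i<k h
    wins-joins {i} {y} {u} i<k ru≡ (suc s , s<k , h , best) = s , ℕ.s≤s⁻¹ s<k ,
      subst (λ j → Heard A j (suc s) u y) (sym ru≡) (heard-advance (suc s) i<k h) , lower , upper
      where
      lower : ∀ w → Heard A (r w) (suc s) w y → rank u ℕ.≤ rank w
      lower w h′ with w Fₚ.≟ u
      ... | yes refl = ℕₚ.≤-refl
      ... | no  w≢u  = contradiction h′ (proj₁ (best w w≢u))
      upper : ∀ w → Heard A (r w) (suc (suc s)) w y → rank w ℕ.≤ rank u
      upper w h′ with w Fₚ.≟ u
      ... | yes refl = ℕₚ.≤-refl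
      ... | no  w≢u  = ℕₚ.<⇒≤ (proj₂ (best w w≢u) h′)

  heard-cong : ∀ {A A′} → (∀ v → A v ≡ A′ v) → ∀ {i} s {u y} → Heard A i s u y → Heard A′ i s u y
  heard-cong A≗A′ (suc s) (y∈A , start) = subst T (A≗A′ _) y∈A , hearing start
    where
    hearing : _ → _
    hearing (inj₁ own) = inj₁ own
    hearing (inj₂ (inj₁ h)) = inj₂ (inj₁ (heard-cong A≗A′ s h))
    hearing (inj₂ (inj₂ (z , e , h))) = inj₂ (inj₂ (z , e , heard-cong A≗A′ s h))

  joins-cong : ∀ {A A′ r r′} → (∀ v → A v ≡ A′ v) → (∀ v → r v ≡ r′ v) → ∀ {y u} → Joins A r y u → Joins A′ r′ y u
  joins-cong {A} {A′} {r} {r′} A≗A′ r≗r′ {y} {u} (s , s<k , h , lower , upper) = s , s<k ,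
    to h , (λ w → lower w ∘ from) , (λ w → upper w ∘ from)
    where
    to : ∀ {s w} → Heard A (r w) s w y → Heard A′ (r′ w) s w y
    to {s} {w} h = subst (λ i → Heard A′ i s w y) (r≗r′ w) (heard-cong A≗A′ s h)
    from : ∀ {s w} → Heard A′ (r′ w) s w y → Heard A (r w) s w y
    from {s} {w} h = subst (λ i → Heard A i s w y) (sym (r≗r′ w)) (heard-cong (sym ∘ A≗A′) s h)

  -- `Wins i y u` never consults `r u`, so agreement away from `u` suffices. This is what makes the
  -- event independent of the radius of `u`.
  wins-cong : ∀ {A A′ r r′ u} → (∀ v → A v ≡ A′ v) → (∀ v → v ≢ u → r v ≡ r′ v) → ∀ {i y} → Wins A r i y u → Wins A′ r′ i y u
  wins-cong {A} {A′} {r} {r′} {u} A≗A′ r≗r′ {y = y} (s , s≤k , h , best) = s , s≤k ,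
    heard-cong A≗A′ (suc s) h , λ w w≢u → proj₁ (best w w≢u) ∘ from w w≢u , proj₂ (best w w≢u) ∘ from w w≢u
    where
    from : ∀ w → w ≢ u → ∀ {s} → Heard A′ (r′ w) s w y → Heard A (r w) s w y
    from w w≢u {s} h = subst (λ i → Heard A i s w y) (sym (r≗r′ w w≢u)) (heard-cong (sym ∘ A≗A′) s h)

  -- Successive phases and the resulting decomposition

  alive : (ℕ → Fin n → ℕ) → ℕ → Fin n → Bool
  alive ρ zero    v = true
  alive ρ (suc t) v = alive ρ t v ∧ not ⌊ Fₚ.any? (joins? (alive ρ t) (ρ t) v) ⌋

  JoinsAt : (ℕ → Fin n → ℕ) → ℕ → Fin n → Fin n → Set
  JoinsAt ρ t = Joins (alive ρ t) (ρ t)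

  alive-cong : ∀ {ρ ρ′} t → (∀ t′ → t′ ℕ.< t → ∀ v → ρ t′ v ≡ ρ′ t′ v) → ∀ v → alive ρ t v ≡ alive ρ′ t v
  alive-cong zero    _    v = refl
  alive-cong {ρ} {ρ′} (suc t) ρ≗ρ′ v = cong₂ _∧_ (before v) (cong not (⌊⌋-cong
    (λ (u , J) → u , joins-cong before (ρ≗ρ′ t ℕₚ.≤-refl) J)
    (λ (u , J) → u , joins-cong (sym ∘ before) (sym ∘ ρ≗ρ′ t ℕₚ.≤-refl) J) _ _))
    where
    before : ∀ v → alive ρ t v ≡ alive ρ′ t v
    before = alive-cong t λ t′ t′<t → ρ≗ρ′ t′ (ℕₚ.m≤n⇒m≤1+n t′<t)

  module _ (ρ : ℕ → Fin n → ℕ) where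

    joinsAt-alive : ∀ {t y u} → JoinsAt ρ t y u → T (alive ρ t y)
    joinsAt-alive (s , _ , h , _) = heard-alive (suc s) h

    alive-antitone : ∀ {t t′ v} → t ℕ.≤ t′ → T (alive ρ t′ v) → T (alive ρ t v)
    alive-antitone {t} {v = v} t≤t′ = go (ℕₚ.≤⇒≤′ t≤t′)
      where
      go : ∀ {t′} → t ℕ.≤′ t′ → T (alive ρ t′ v) → T (alive ρ t v)
      go ℕ.≤′-refl v∈ = v∈
      go (ℕ.≤′-step t≤t′) v∈ = go t≤t′ (proj₁ (Equivalence.to Boolₚ.T-∧ v∈))

    joins-dies : ∀ {t y u} → JoinsAt ρ t y u → ¬ T (alive ρ (suc t) y)
    joins-dies {t} {y} J y∈ with Fₚ.any? (joins? (alive ρ t) (ρ t) y)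
    ... | yes _   = proj₂ (Equivalence.to (Boolₚ.T-∧ {alive ρ t y}) y∈)
    ... | no none = none (_ , J)

    joinsAt-unique : ∀ {t t′ y u u′} → JoinsAt ρ t y u → JoinsAt ρ t′ y u′ → t ≡ t′ × u ≡ u′
    joinsAt-unique {t} {t′} J J′ with ℕₚ.<-cmp t t′
    ... | tri< t<t′ _ _ = contradiction (alive-antitone t<t′ (joinsAt-alive J′)) (joins-dies J)
    ... | tri> _ _ t′<t = contradiction (alive-antitone t′<t (joinsAt-alive J)) (joins-dies J′)
    ... | tri≈ _ refl _ = refl , joins-unique (alive ρ t) (ρ t) J J′

    module _ (lam : ℕ) .{{_ : NonZero lam}} where

      -- A cluster is named by its phase and its centre in mixed radix, so that the remainder modulo
      -- `lam` is the phase, which serves as the colour.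
      identifier : ℕ → Fin n → ℕ
      identifier t u = t ℕ.+ rank u ℕ.* lam

      identifier-phase : ∀ {t} u → t ℕ.< lam → identifier t u ℕ.% lam ≡ t
      identifier-phase {t} u t<lam = trans (ℕ.[m+kn]%n≡m%n t (rank u) lam) (ℕ.m<n⇒m%n≡m t<lam)

      identifier-injective : ∀ {t t′ u u′} → t ℕ.< lam → t′ ℕ.< lam → identifier t u ≡ identifier t′ u′ → t ≡ t′ × u ≡ u′
      identifier-injective {t} {t′} {u} {u′} t< t′< eq = t≡t′ ,
        rank-injective (ℕₚ.*-cancelʳ-≡ _ _ lam (ℕₚ.+-cancelˡ-≡ t _ _ (trans eq (cong (ℕ._+ rank u′ ℕ.* lam) (sym t≡t′)))))
        where
        t≡t′ = trans (sym (identifier-phase u t<)) (trans (cong (ℕ._% lam) eq) (identifier-phase u′ t′<))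

      module _ {P : Clustering n} (labelled : ∀ v → ∃ λ t → ∃ λ u → t ℕ.< lam × JoinsAt ρ t v u × P v ≡ identifier t u) where

        joins-label : ∀ {t u v} → JoinsAt ρ t v u → P v ≡ identifier t u
        joins-label {v = v} J =
          let t , u , t< , J′ , Pv≡ = labelled v
              t≡ , u≡ = joinsAt-unique J′ J
          in trans Pv≡ (cong₂ identifier t≡ u≡)

        -- Adjacent vertices of equal colour joined in the same phase; by `joins-adjacent` they have
        -- the same centre, hence the same cluster.
        colorable : SupergraphColorable G P lam
        colorable = (λ i → i ℕ.mod lam) , proper
          where
          phase : ∀ i v → P v ≡ i → ∀ {t u} → t ℕ.< lam → P v ≡ identifier t u → toℕ (i ℕ.mod lam) ≡ t
          phase i v Pv≡i t< eq = trans (Fₚ.toℕ-fromℕ< (ℕ.m%n<n i lam)) (trans (cong (ℕ._% lam) (trans (sym Pv≡i) eq)) (identifier-phase _ t<))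
          proper : ∀ i j → SupergraphAdjacent G P i j → i ℕ.mod lam ≢ j ℕ.mod lam
          proper i j (i≢j , (v , Pv≡i) , (w , Pw≡j) , e) same =
            let t , u , t< , J , Pv≡ = labelled v
                t′ , u′ , t′< , J′ , Pw≡ = labelled w
                t≡t′ = trans (sym (phase i v Pv≡i t< Pv≡)) (trans (cong toℕ same) (phase j w Pw≡j t′< Pw≡))
                u≡u′ = joins-adjacent (alive ρ t) (ρ t) e J (subst (λ t → JoinsAt ρ t w u′) (sym t≡t′) J′)
            in i≢j (trans (sym Pv≡i) (trans Pv≡ (trans (cong₂ identifier t≡t′ u≡u′) (trans (sym Pw≡) Pw≡j))))

        -- Both vertices reach their common centre in fewer than `k` steps, along vertices that join
        -- it in the same phase and so carry the same label.
        diameter : ∀ i (v w : Cluster G P i) → ∃ λ d → IsDistance (InducedAdjacent G P i) v w d × d ℕ.≤ k ℕ.+ k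
        diameter i (v , v∈) (w , w∈) =
          let t , u , t< , J@(s , s<k , S) , Pv≡ = labelled v
              t′ , u′ , t′< , (s′ , s′<k , S′) , Pw≡ = labelled w
              t≡ , u≡ = identifier-injective t′< t< (trans (sym Pw≡) (trans w∈ (trans (sym v∈) Pv≡)))
              S″ = subst₂ (λ t u → Settles (alive ρ t) (ρ t) s′ w u) t≡ u≡ S′
              j , j≤s , p = joins-path (alive ρ t) (ρ t) {P} {i} s s<k S
              j′ , j′≤s′ , p′ = joins-path (alive ρ t) (ρ t) {P} {i} s′ s′<k S″
              Q⇒i = λ {v} (J′ : JoinsAt ρ t v u) → trans (joins-label J′) (trans (sym Pv≡) v∈)
              u∈ = Q⇒i (path-end p)
              d , dist , d≤ = distance (path⇒walk Q⇒i p v∈ u∈ ◅◅ reverse adjacent-sym (path⇒walk Q⇒i p′ w∈ u∈))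
          in d , dist , ℕₚ.≤-trans d≤ (ℕₚ.+-mono-≤ (ℕₚ.≤-trans j≤s (ℕₚ.<⇒≤ s<k)) (ℕₚ.≤-trans j′≤s′ (ℕₚ.<⇒≤ s′<k)))
          where open ClusterWalks G P i

-- Survival probabilities

T-∧⁻ : ∀ {a b} → T (a ∧ b) → T a × T b
T-∧⁻ = Equivalence.to Boolₚ.T-∧

T-∧⁺ : ∀ {a b} → T a → T b → T (a ∧ b)
T-∧⁺ ta tb = Equivalence.from Boolₚ.T-∧ (ta , tb)

T-not : ∀ {b} → ¬ T b → T (not b)
T-not {true}  ¬t = ¬t _
T-not {false} _  = _

module _ {Y : Set} (bad : Y → Bool) {k : ℕ} where

  -- The default 0 allows phases to be plain natural numbers; the run ends by entering phase `lam`,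
  -- for which there is no sample.
  radiusAt : ∀ {m} → Vec (Vec Y k) m → ℕ → ℕ
  radiusAt []       t       = 0
  radiusAt (b ∷ bs) zero    = run bad b
  radiusAt (b ∷ bs) (suc t) = radiusAt bs t

  radiusAt≤ : ∀ {m} (bs : Vec (Vec Y k) m) t → radiusAt bs t ℕ.≤ k
  radiusAt≤ []       t       = ℕ.z≤n
  radiusAt≤ (b ∷ bs) zero    = run≤ bad b
  radiusAt≤ (b ∷ bs) (suc t) = radiusAt≤ bs t

  radiusAt-updated : ∀ {m} (bs : Vec (Vec Y k) m) t ζ → radiusAt (updateAt bs t (λ _ → ζ)) (toℕ t) ≡ run bad ζ
  radiusAt-updated (b ∷ bs) zero    ζ = refl
  radiusAt-updated (b ∷ bs) (suc t) ζ = radiusAt-updated bs t ζ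

  radiusAt-other : ∀ {m} (bs : Vec (Vec Y k) m) t ζ t′ → t′ ≢ toℕ t → radiusAt (updateAt bs t (λ _ → ζ)) t′ ≡ radiusAt bs t′
  radiusAt-other (b ∷ bs) zero    ζ zero     t≢ = contradiction refl t≢
  radiusAt-other (b ∷ bs) zero    ζ (suc t′) t≢ = refl
  radiusAt-other (b ∷ bs) (suc t) ζ zero     t≢ = refl
  radiusAt-other (b ∷ bs) (suc t) ζ (suc t′) t≢ = radiusAt-other bs t ζ t′ (t≢ ∘ cong suc)

geometricSum : ℚ → ℕ → ℚ
geometricSum q zero    = 0ℚ
geometricSum q (suc t) = geometricSum q t ℚ.+ q ^ t

module Survival {n : ℕ} (A : Algorithm n) (N : Network n)
  (G : Graph n) (rank : Fin n → ℕ) (rank-injective : ∀ {u v} → rank u ≡ rank v → u ≡ v)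
  {Y : Set} {F : (Y → ℚ) → ℚ} (F-exp : IsExpectation F) (F-comm : Commutes F) (bad : Y → Bool) (k lam : ℕ) where

  open Execution A N using (independent)
  open Coins A N
  open Geometric A N F-exp bad
  open Shifts G rank rank-injective k

  p : ℚ
  p = 1ℚ ℚ.- q

  Samples : Set
  Samples = Vec (Vec (Vec Y k) lam) n

  radii : Samples → ℕ → Fin n → ℕ
  radii ω t u = radiusAt bad (Vec.lookup ω u) t

  𝔼 : (Samples → ℚ) → ℚ
  𝔼 = independent n (independent lam (independent k F))

  𝔼-exp : IsExpectation 𝔼
  𝔼-exp = independent-isExpectation (independent-isExpectation (independent-isExpectation F-exp k) lam) n

  private
    module 𝔼 = IsExpectation 𝔼-exp
    module Block = IsExpectation (independent-isExpectation F-exp k)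

  resample : Fin lam → Fin n → Vec Y k → Samples → Samples
  resample t u ζ ω = updateAt ω u (λ bs → updateAt bs t (λ _ → ζ))

  𝔼-resamples : ∀ t u → Resamples 𝔼 (independent k F) (resample t u)
  𝔼-resamples t u = independent-resamples (independent-isExpectation block-exp lam) block-exp block-comm
    (independent-resamples block-exp block-exp block-comm (resamples-self block-exp) lam t) n u
    where
    block-exp = independent-isExpectation F-exp k
    block-comm : Commutes (independent k F)
    block-comm = independent-commutes F-exp F-comm k

  radii-resampled : ∀ t u ζ ω → radii (resample t u ζ ω) (toℕ t) u ≡ run bad ζ
  radii-resampled t u ζ ω = trans (cong (λ bs → radiusAt bad bs (toℕ t)) (Vecₚ.lookup∘updateAt u ω)) (radiusAt-updated bad (Vec.lookup ω u) t ζ)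

  radii-unchanged : ∀ t u ζ ω t′ v → t′ ≢ toℕ t ⊎ v ≢ u → radii (resample t u ζ ω) t′ v ≡ radii ω t′ v
  radii-unchanged t u ζ ω t′ v other with v Fₚ.≟ u
  ... | no v≢u = cong (λ bs → radiusAt bad bs t′) (Vecₚ.lookup∘updateAt′ v u v≢u ω)
  radii-unchanged t u ζ ω t′ .u (inj₁ t≢) | yes refl =
    trans (cong (λ bs → radiusAt bad bs t′) (Vecₚ.lookup∘updateAt u ω)) (radiusAt-other bad (Vec.lookup ω u) t ζ t′ t≢)
  radii-unchanged t u ζ ω t′ v (inj₂ v≢u) | yes v≡u = contradiction v≡u v≢u

  -- Overwriting the block of `t` and `u` preserves `𝔼`. As `φ` does not react to that, only its
  -- second argument sees the fresh block.
  radius-independent : ∀ t u (φ : Samples → ℕ → ℚ) → (∀ ζ ω i → φ (resample t u ζ ω) i ≡ φ ω i) →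
    𝔼 (λ ω → φ ω (radii ω (toℕ t) u)) ≡ 𝔼 (λ ω → independent k F (λ ζ → φ ω (run bad ζ)))
  radius-independent t u φ φ-inv = trans (𝔼-resamples t u _) (𝔼.ext λ ω → Block.ext λ ζ →
    trans (cong (φ (resample t u ζ ω)) (radii-resampled t u ζ ω)) (φ-inv ζ ω (run bad ζ)))

  untruncated? : ∀ (ρ : ℕ → Fin n → ℕ) t → Dec (∀ u → T (alive ρ t u) → ρ t u ℕ.< k)
  untruncated? ρ t = Fₚ.all? λ u → T? _ →-dec (ρ t u ℕₚ.<? k)

  -- The maximal radius k may be a truncated one, for which memorylessness fails.
  safe : (ℕ → Fin n → ℕ) → ℕ → Bool
  safe ρ zero    = true
  safe ρ (suc t) = safe ρ t ∧ ⌊ untruncated? ρ t ⌋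

  -- Survival is followed only while no truncation has occurred; runs with truncation are charged to
  -- `truncations`.
  live : (ℕ → Fin n → ℕ) → ℕ → Fin n → Bool
  live ρ t y = safe ρ t ∧ alive ρ t y

  safe-cong : ∀ {ρ ρ′} t → (∀ t′ → t′ ℕ.< t → ∀ v → ρ t′ v ≡ ρ′ t′ v) → safe ρ t ≡ safe ρ′ t
  safe-cong zero    _ = refl
  safe-cong {ρ} {ρ′} (suc t) ρ≗ρ′ = cong₂ _∧_ (safe-cong t before) (⌊⌋-cong
    (λ <k u u∈ → subst (ℕ._< k) (ρ≗ρ′ t ℕₚ.≤-refl u) (<k u (subst T (sym (alive-cong t before u)) u∈)))
    (λ <k u u∈ → subst (ℕ._< k) (sym (ρ≗ρ′ t ℕₚ.≤-refl u)) (<k u (subst T (alive-cong t before u) u∈))) _ _)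
    where
    before : ∀ t′ → t′ ℕ.< t → ∀ v → ρ t′ v ≡ ρ′ t′ v
    before t′ t′<t = ρ≗ρ′ t′ (ℕₚ.m≤n⇒m≤1+n t′<t)

  alive-resampled : ∀ t u ζ ω v → alive (radii (resample t u ζ ω)) (toℕ t) v ≡ alive (radii ω) (toℕ t) v
  alive-resampled t u ζ ω = alive-cong (toℕ t) λ t′ t′<t v → radii-unchanged t u ζ ω t′ v (inj₁ (ℕₚ.<⇒≢ t′<t))

  live-resampled : ∀ t u ζ ω v → live (radii (resample t u ζ ω)) (toℕ t) v ≡ live (radii ω) (toℕ t) v
  live-resampled t u ζ ω v = cong₂ _∧_
    (safe-cong (toℕ t) λ t′ t′<t v → radii-unchanged t u ζ ω t′ v (inj₁ (ℕₚ.<⇒≢ t′<t)))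
    (alive-resampled t u ζ ω v)

  winning : Samples → ℕ → Fin n → Fin n → ℕ → Bool
  winning ω t y u i = ⌊ wins? (alive (radii ω) t) (radii ω t) i y u ⌋

  winning-resampled : ∀ t u ζ ω y i → winning (resample t u ζ ω) (toℕ t) y u i ≡ winning ω (toℕ t) y u i
  winning-resampled t u ζ ω y i = ⌊⌋-cong
    (wins-cong (alive-resampled t u ζ ω) (λ v v≢u → radii-unchanged t u ζ ω (toℕ t) v (inj₂ v≢u)))
    (wins-cong (sym ∘ alive-resampled t u ζ ω) (λ v v≢u → sym (radii-unchanged t u ζ ω (toℕ t) v (inj₂ v≢u)))) _ _

  first-winning-resampled : ∀ t u ζ ω y i →
    first (winning (resample t u ζ ω) (toℕ t) y u) i ≡ first (winning ω (toℕ t) y u) i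
  first-winning-resampled t u ζ ω y zero    = winning-resampled t u ζ ω y zero
  first-winning-resampled t u ζ ω y (suc i) =
    cong₂ (λ a b → a ∧ not b) (winning-resampled t u ζ ω y (suc i)) (winning-resampled t u ζ ω y i)

  survives-by : Samples → ℕ → Fin n → Fin n → Bool
  survives-by ω t y u = live (radii ω) t y ∧ (first (winning ω t y u) (radii ω t u) ∧ (radii ω t u ℕ.<ᵇ k))

  -- Take the winner at `y`, whose radius is not truncated. If it still won with a radius smaller by
  -- one, `y` would join it by `wins-joins`. So its radius is the least with which it wins.
  survives : ∀ ω t y → T (live (radii ω) (suc t) y) → ∃ λ u → T (survives-by ω t y u)
  survives ω t y L =
    let S , y∈′ = T-∧⁻ {safe ρ (suc t)} L
        S′ , <k = T-∧⁻ {safe ρ t} S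
        y∈ , stays = T-∧⁻ {alive ρ t y} y∈′
        u , W@(s , _ , h , _) = wins-exists (alive ρ t) (ρ t) y∈
        r<k = toWitness <k u (heard-source (suc s) h)
    in u , T-∧⁺ (T-∧⁺ S′ y∈) (T-∧⁺ (leads y∈′ u r<k W (ρ t u) refl) (ℕₚ.<⇒<ᵇ r<k))
    where
    ρ = radii ω
    leads : T (alive ρ (suc t) y) → ∀ u → ρ t u ℕ.< k → Wins (alive ρ t) (ρ t) (ρ t u) y u →
            ∀ i → ρ t u ≡ i → T (first (winning ω t y u) i)
    leads y∈′ u r<k W zero    eq = fromWitness (subst (λ i → Wins _ _ i y u) eq W)
    leads y∈′ u r<k W (suc i) eq = T-∧⁺ {winning ω t y u (suc i)} {not (winning ω t y u i)}
      (fromWitness (subst (λ i → Wins _ _ i y u) eq W)) (T-not {winning ω t y u i} λ w → joins-dies ρ {t} (wins-joins (alive ρ t) (ρ t)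
        (ℕₚ.<-trans (ℕₚ.n<1+n i) (subst (ℕ._< k) eq r<k)) eq (toWitness w)) y∈′)

  -- With all other radii fixed, `run-first` bounds the probability that the radius of `u` is
  -- exactly the least winning one by `q` times the probability that `u` wins. The union bound over
  -- `u` costs nothing further, because winning is exclusive.
  live-step : ∀ (t : Fin lam) y →
    𝔼 (λ ω → 𝟙 (live (radii ω) (suc (toℕ t)) y)) ℚ.≤ q ℚ.* 𝔼 (λ ω → 𝟙 (live (radii ω) (toℕ t) y))
  live-step t y = begin
    𝔼 (λ ω → 𝟙 (live (radii ω) (suc (toℕ t)) y))
      ≤⟨ 𝔼.mono (λ ω → union ω) ⟩
    𝔼 (λ ω → sum λ u → 𝟙 (survives-by ω (toℕ t) y u))
      ≡⟨ 𝔼.E-sum (λ u ω → 𝟙 (survives-by ω (toℕ t) y u)) ⟩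
    sum (λ u → 𝔼 λ ω → 𝟙 (survives-by ω (toℕ t) y u))
      ≤⟨ sum-mono single ⟩
    sum (λ u → 𝔼 λ ω → q ℚ.* 𝟙 (L ω ∧ winning ω (toℕ t) y u (radii ω (toℕ t) u)))
      ≡⟨ 𝔼.E-sum (λ u ω → q ℚ.* 𝟙 (L ω ∧ winning ω (toℕ t) y u (radii ω (toℕ t) u))) ⟨
    𝔼 (λ ω → sum λ u → q ℚ.* 𝟙 (L ω ∧ winning ω (toℕ t) y u (radii ω (toℕ t) u)))
      ≤⟨ 𝔼.mono disjoint ⟩
    𝔼 (λ ω → q ℚ.* 𝟙 (L ω))
      ≡⟨ 𝔼.scale q _ ⟩
    q ℚ.* 𝔼 (λ ω → 𝟙 (L ω)) ∎
    where
    open ℚₚ.≤-Reasoning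
    L : Samples → Bool
    L ω = live (radii ω) (toℕ t) y
    union : ∀ ω → 𝟙 (live (radii ω) (suc (toℕ t)) y) ℚ.≤ sum (λ u → 𝟙 (survives-by ω (toℕ t) y u))
    union ω with live (radii ω) (suc (toℕ t)) y in eq
    ... | false = 0≤sum (λ u → 0≤𝟙 (survives-by ω (toℕ t) y u))
    ... | true  = let u , S = survives ω (toℕ t) y (subst T (sym eq) _) in
      ℚₚ.≤-trans (𝟙-mono {true} {survives-by ω (toℕ t) y u} (λ _ → S)) (≤sum (λ u → 0≤𝟙 (survives-by ω (toℕ t) y u)) u)
    single : ∀ u → 𝔼 (λ ω → 𝟙 (survives-by ω (toℕ t) y u)) ℚ.≤
                   𝔼 (λ ω → q ℚ.* 𝟙 (L ω ∧ winning ω (toℕ t) y u (radii ω (toℕ t) u)))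
    single u = begin
      𝔼 (λ ω → 𝟙 (survives-by ω (toℕ t) y u))
        ≡⟨ radius-independent t u (λ ω i → 𝟙 (L ω ∧ (first (winning ω (toℕ t) y u) i ∧ (i ℕ.<ᵇ k))))
             (λ ζ ω i → cong₂ (λ a b → 𝟙 (a ∧ (b ∧ (i ℕ.<ᵇ k)))) (live-resampled t u ζ ω y) (first-winning-resampled t u ζ ω y i)) ⟩
      𝔼 (λ ω → independent k F λ ζ → 𝟙 (L ω ∧ (first (winning ω (toℕ t) y u) (run bad ζ) ∧ (run bad ζ ℕ.<ᵇ k))))
        ≡⟨ 𝔼.ext (λ ω → trans (Block.ext λ ζ → 𝟙-∧ (L ω) _) (Block.scale (𝟙 (L ω)) _)) ⟩
      𝔼 (λ ω → 𝟙 (L ω) ℚ.* independent k F λ ζ → 𝟙 (first (winning ω (toℕ t) y u) (run bad ζ) ∧ (run bad ζ ℕ.<ᵇ k)))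
        ≤⟨ 𝔼.mono (λ ω → *-monoʳ (𝟙 (L ω)) (0≤𝟙 (L ω)) (run-first k (winning ω (toℕ t) y u)
             λ i w → fromWitness (wins-mono (alive (radii ω) (toℕ t)) (radii ω (toℕ t)) (toWitness w)))) ⟩
      𝔼 (λ ω → 𝟙 (L ω) ℚ.* (q ℚ.* independent k F λ ζ → 𝟙 (winning ω (toℕ t) y u (run bad ζ))))
        ≡⟨ 𝔼.ext (λ ω → trans (ring (𝟙 (L ω)) q _) (cong (q ℚ.*_) (sym (trans (Block.ext λ ζ → 𝟙-∧ (L ω) _) (Block.scale (𝟙 (L ω)) _))))) ⟩
      𝔼 (λ ω → q ℚ.* independent k F λ ζ → 𝟙 (L ω ∧ winning ω (toℕ t) y u (run bad ζ)))
        ≡⟨ 𝔼.ext (λ ω → sym (Block.scale q _)) ⟩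
      𝔼 (λ ω → independent k F λ ζ → q ℚ.* 𝟙 (L ω ∧ winning ω (toℕ t) y u (run bad ζ)))
        ≡⟨ radius-independent t u (λ ω i → q ℚ.* 𝟙 (L ω ∧ winning ω (toℕ t) y u i))
             (λ ζ ω i → cong₂ (λ a b → q ℚ.* 𝟙 (a ∧ b)) (live-resampled t u ζ ω y) (winning-resampled t u ζ ω y i)) ⟨
      𝔼 (λ ω → q ℚ.* 𝟙 (L ω ∧ winning ω (toℕ t) y u (radii ω (toℕ t) u))) ∎
      where
      ring : ∀ a b c → a ℚ.* (b ℚ.* c) ≡ b ℚ.* (a ℚ.* c)
      ring = solve 3 (λ a b c → a :* (b :* c) := b :* (a :* c)) refl
    disjoint : ∀ ω → sum (λ u → q ℚ.* 𝟙 (L ω ∧ winning ω (toℕ t) y u (radii ω (toℕ t) u))) ℚ.≤ q ℚ.* 𝟙 (L ω)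
    disjoint ω = begin
      sum (λ u → q ℚ.* 𝟙 (L ω ∧ W u))
        ≡⟨ *-distrib-sum q (λ u → 𝟙 (L ω ∧ W u)) ⟨
      q ℚ.* sum (λ u → 𝟙 (L ω ∧ W u))
        ≡⟨ cong (q ℚ.*_) (trans (sum-cong-≗ λ u → 𝟙-∧ (L ω) (W u)) (sym (*-distrib-sum (𝟙 (L ω)) (𝟙 ∘ W)))) ⟩
      q ℚ.* (𝟙 (L ω) ℚ.* sum (𝟙 ∘ W))
        ≤⟨ *-monoʳ q 0≤q (*-monoʳ (𝟙 (L ω)) (0≤𝟙 (L ω)) (sum-exclusive W λ u w Wu Ww →
             wins-unique (alive (radii ω) (toℕ t)) (radii ω (toℕ t)) (toWitness Wu) (toWitness Ww))) ⟩
      q ℚ.* (𝟙 (L ω) ℚ.* 1ℚ)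
        ≡⟨ cong (q ℚ.*_) (ℚₚ.*-identityʳ (𝟙 (L ω))) ⟩
      q ℚ.* 𝟙 (L ω) ∎
      where
      W : Fin n → Bool
      W u = winning ω (toℕ t) y u (radii ω (toℕ t) u)

  live-decay : ∀ t → t ℕ.≤ lam → ∀ y → 𝔼 (λ ω → 𝟙 (live (radii ω) t y)) ℚ.≤ q ^ t
  live-decay zero    _   y = ℚₚ.≤-reflexive (𝔼.constant 1ℚ)
  live-decay (suc t) t<lam y = ℚₚ.≤-trans
    (subst (λ t → 𝔼 (λ ω → 𝟙 (live (radii ω) (suc t) y)) ℚ.≤ q ℚ.* 𝔼 (λ ω → 𝟙 (live (radii ω) t y)))
      (Fₚ.toℕ-fromℕ< t<lam) (live-step (fromℕ< t<lam) y))
    (*-monoʳ q 0≤q (live-decay t (ℕₚ.<⇒≤ t<lam) y))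

  truncations : Samples → ℕ → ℚ
  truncations ω zero    = 0ℚ
  truncations ω (suc t) = truncations ω t ℚ.+ sum (λ u → 𝟙 (live (radii ω) t u ∧ (radii ω t u ℕ.≡ᵇ k)))

  0≤truncations : ∀ ω t → 0ℚ ℚ.≤ truncations ω t
  0≤truncations ω zero    = ℚₚ.≤-refl
  0≤truncations ω (suc t) = 0≤+ (0≤truncations ω t) (0≤sum λ u → 0≤𝟙 (live (radii ω) t u ∧ (radii ω t u ℕ.≡ᵇ k)))

  truncated-expected : ∀ (t : Fin lam) u →
    𝔼 (λ ω → 𝟙 (live (radii ω) (toℕ t) u ∧ (radii ω (toℕ t) u ℕ.≡ᵇ k))) ≡ p ^ k ℚ.* 𝔼 (λ ω → 𝟙 (live (radii ω) (toℕ t) u))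
  truncated-expected t u = begin
    𝔼 (λ ω → 𝟙 (live (radii ω) (toℕ t) u ∧ (radii ω (toℕ t) u ℕ.≡ᵇ k)))
      ≡⟨ radius-independent t u (λ ω i → 𝟙 (live (radii ω) (toℕ t) u ∧ (i ℕ.≡ᵇ k)))
           (λ ζ ω i → cong (λ a → 𝟙 (a ∧ (i ℕ.≡ᵇ k))) (live-resampled t u ζ ω u)) ⟩
    𝔼 (λ ω → independent k F λ ζ → 𝟙 (live (radii ω) (toℕ t) u ∧ (run bad ζ ℕ.≡ᵇ k)))
      ≡⟨ 𝔼.ext (λ ω → trans (Block.ext λ ζ → 𝟙-∧ (live (radii ω) (toℕ t) u) _)
           (trans (Block.scale (𝟙 (live (radii ω) (toℕ t) u)) _) (trans (cong (𝟙 (live (radii ω) (toℕ t) u) ℚ.*_) (run-full k)) (ℚₚ.*-comm _ (p ^ k))))) ⟩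
    𝔼 (λ ω → p ^ k ℚ.* 𝟙 (live (radii ω) (toℕ t) u))
      ≡⟨ 𝔼.scale (p ^ k) _ ⟩
    p ^ k ℚ.* 𝔼 (λ ω → 𝟙 (live (radii ω) (toℕ t) u)) ∎
    where open ≡-Reasoning

  0≤p^ : ∀ j → 0ℚ ℚ.≤ p ^ j
  0≤p^ zero    = 0≤1
  0≤p^ (suc j) = 0≤* (0≤diff q≤1) (0≤p^ j)

  truncations-expected : ∀ t → t ℕ.≤ lam → 𝔼 (λ ω → truncations ω t) ℚ.≤ geometricSum q t ℚ.* (ℕ→ℚ n ℚ.* p ^ k)
  truncations-expected zero    _ = ℚₚ.≤-reflexive (trans (𝔼.constant 0ℚ) (sym (ℚₚ.*-zeroˡ (ℕ→ℚ n ℚ.* p ^ k))))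
  truncations-expected (suc t) t<lam = begin
    𝔼 (λ ω → truncations ω t ℚ.+ sum (trunc ω))
      ≡⟨ 𝔼.add _ _ ⟩
    𝔼 (λ ω → truncations ω t) ℚ.+ 𝔼 (λ ω → sum (trunc ω))
      ≤⟨ ℚₚ.+-mono-≤ (truncations-expected t (ℕₚ.<⇒≤ t<lam)) (begin
           𝔼 (λ ω → sum (trunc ω))              ≡⟨ 𝔼.E-sum (λ u ω → trunc ω u) ⟩
           sum (λ u → 𝔼 λ ω → trunc ω u)        ≤⟨ sum-mono single ⟩
           sum {n} (λ _ → p ^ k ℚ.* q ^ t)      ≡⟨ sum-const n _ ⟩
           ℕ→ℚ n ℚ.* (p ^ k ℚ.* q ^ t)          ∎) ⟩
    geometricSum q t ℚ.* (ℕ→ℚ n ℚ.* p ^ k) ℚ.+ ℕ→ℚ n ℚ.* (p ^ k ℚ.* q ^ t)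
      ≡⟨ ring (geometricSum q t) (ℕ→ℚ n) (p ^ k) (q ^ t) ⟩
    (geometricSum q t ℚ.+ q ^ t) ℚ.* (ℕ→ℚ n ℚ.* p ^ k) ∎
    where
    open ℚₚ.≤-Reasoning
    trunc : Samples → Fin n → ℚ
    trunc ω u = 𝟙 (live (radii ω) t u ∧ (radii ω t u ℕ.≡ᵇ k))
    single : ∀ u → 𝔼 (λ ω → trunc ω u) ℚ.≤ p ^ k ℚ.* q ^ t
    single u = ℚₚ.≤-trans
      (ℚₚ.≤-reflexive (subst (λ t → 𝔼 (λ ω → 𝟙 (live (radii ω) t u ∧ (radii ω t u ℕ.≡ᵇ k))) ≡ p ^ k ℚ.* 𝔼 (λ ω → 𝟙 (live (radii ω) t u)))
        (Fₚ.toℕ-fromℕ< t<lam) (truncated-expected (fromℕ< t<lam) u)))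
      (*-monoʳ (p ^ k) (0≤p^ k) (live-decay t (ℕₚ.<⇒≤ t<lam) u))
    ring : ∀ s n r x → s ℚ.* (n ℚ.* r) ℚ.+ n ℚ.* (r ℚ.* x) ≡ (s ℚ.+ x) ℚ.* (n ℚ.* r)
    ring = solve 4 (λ s n r x → s :* (n :* r) :+ n :* (r :* x) := (s :+ x) :* (n :* r)) refl

  -- In the first phase that is not safe, all earlier phases are, so the remaining vertex with
  -- radius `k` is live and is counted.
  safe-or-truncated : ∀ ω t → 𝟙 (not (safe (radii ω) t)) ℚ.≤ truncations ω t
  safe-or-truncated ω zero = ℚₚ.≤-refl
  safe-or-truncated ω (suc t) with safe (radii ω) t in eq | untruncated? (radii ω) t
  ... | false | _     = ℚₚ.≤-trans (subst (λ b → 𝟙 (not b) ℚ.≤ truncations ω t) eq (safe-or-truncated ω t))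
                          (p≤p+q _ (0≤sum {n} {λ u → 𝟙 (alive-false u)} λ u → 0≤𝟙 (alive-false u)))
    where
    alive-false : Fin n → Bool
    alive-false u = false ∧ alive (radii ω) t u ∧ (radii ω t u ℕ.≡ᵇ k)
  ... | true | yes _ = (0≤+ (0≤truncations ω t) (0≤sum λ u → 0≤𝟙 ((true ∧ alive (radii ω) t u) ∧ (radii ω t u ℕ.≡ᵇ k))))
  ... | true | no ¬all with Fₚ.any? (λ u → T? (alive (radii ω) t u ∧ (radii ω t u ℕ.≡ᵇ k)))
  ...   | yes (u , U) = ℚₚ.≤-trans (𝟙-mono {true} {alive (radii ω) t u ∧ (radii ω t u ℕ.≡ᵇ k)} (λ _ → U))
          (ℚₚ.≤-trans (≤sum (λ u → 0≤𝟙 (alive (radii ω) t u ∧ (radii ω t u ℕ.≡ᵇ k))) u)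
            (p≤q+p _ (0≤truncations ω t)))
  ...   | no none = contradiction (λ u u∈ → ℕₚ.≤∧≢⇒< (radiusAt≤ bad (Vec.lookup ω u) t)
          λ eq → none (u , T-∧⁺ u∈ (ℕₚ.≡⇒≡ᵇ _ k eq))) ¬all

  someAlive : Samples → Bool
  someAlive ω = ⌊ Fₚ.any? (λ y → T? (alive (radii ω) lam y)) ⌋

  failure-bound : 𝔼 (λ ω → 𝟙 (someAlive ω)) ℚ.≤ ℕ→ℚ n ℚ.* q ^ lam ℚ.+ geometricSum q lam ℚ.* (ℕ→ℚ n ℚ.* p ^ k)
  failure-bound = begin
    𝔼 (λ ω → 𝟙 (someAlive ω))
      ≤⟨ 𝔼.mono pointwise ⟩
    𝔼 (λ ω → sum (λ y → 𝟙 (live (radii ω) lam y)) ℚ.+ truncations ω lam)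
      ≡⟨ trans (𝔼.add _ _) (cong (ℚ._+ 𝔼 (λ ω → truncations ω lam)) (𝔼.E-sum (λ y ω → 𝟙 (live (radii ω) lam y)))) ⟩
    sum (λ y → 𝔼 λ ω → 𝟙 (live (radii ω) lam y)) ℚ.+ 𝔼 (λ ω → truncations ω lam)
      ≤⟨ ℚₚ.+-mono-≤ (sum-mono (live-decay lam ℕₚ.≤-refl)) (truncations-expected lam ℕₚ.≤-refl) ⟩
    sum {n} (λ _ → q ^ lam) ℚ.+ geometricSum q lam ℚ.* (ℕ→ℚ n ℚ.* p ^ k)
      ≡⟨ cong (ℚ._+ geometricSum q lam ℚ.* (ℕ→ℚ n ℚ.* p ^ k)) (sum-const n (q ^ lam)) ⟩
    ℕ→ℚ n ℚ.* q ^ lam ℚ.+ geometricSum q lam ℚ.* (ℕ→ℚ n ℚ.* p ^ k) ∎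
    where
    open ℚₚ.≤-Reasoning
    pointwise : ∀ ω → 𝟙 (someAlive ω) ℚ.≤ sum (λ y → 𝟙 (live (radii ω) lam y)) ℚ.+ truncations ω lam
    pointwise ω with safe (radii ω) lam in eq
    ... | false = ℚₚ.≤-trans (𝟙≤1 (someAlive ω)) (ℚₚ.≤-trans
      (subst (λ b → 𝟙 (not b) ℚ.≤ truncations ω lam) eq (safe-or-truncated ω lam))
      (p≤q+p (truncations ω lam) (0≤sum {n} {λ y → 𝟙 (false ∧ alive (radii ω) lam y)} λ y → ℚₚ.≤-refl)))
    ... | true with Fₚ.any? (λ y → T? (alive (radii ω) lam y))
    ...   | no _ = 0≤+ (0≤sum λ y → 0≤𝟙 (alive (radii ω) lam y)) (0≤truncations ω lam)
    ...   | yes (y , y∈) = ℚₚ.≤-trans (𝟙-mono {true} {alive (radii ω) lam y} (λ _ → y∈))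
            (ℚₚ.≤-trans (≤sum (λ y → 0≤𝟙 (alive (radii ω) lam y)) y) (p≤p+q _ (0≤truncations ω lam)))

-- The algorithm

n≤2^⌈log₂n⌉ : ∀ n → n ℕ.≤ 2 ℕ.^ ⌈log₂ n ⌉
n≤2^⌈log₂n⌉ = <-rec _ go
  where
  open ℕₚ.≤-Reasoning
  go : ∀ n → (∀ {m} → m ℕ.< n → m ℕ.≤ 2 ℕ.^ ⌈log₂ m ⌉) → n ℕ.≤ 2 ℕ.^ ⌈log₂ n ⌉
  go zero       _   = ℕ.z≤n
  go (suc zero) _   = ℕₚ.≤-refl
  go n@(suc (suc m)) rec = begin
    n                                       ≡⟨ ℕₚ.⌊n/2⌋+⌈n/2⌉≡n n ⟨
    ℕ.⌊ n /2⌋ ℕ.+ ℕ.⌈ n /2⌉                 ≤⟨ ℕₚ.+-monoˡ-≤ ℕ.⌈ n /2⌉ (ℕₚ.⌊n/2⌋≤⌈n/2⌉ n) ⟩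
    ℕ.⌈ n /2⌉ ℕ.+ ℕ.⌈ n /2⌉                 ≤⟨ ℕₚ.+-mono-≤ half≤ half≤ ⟩
    2 ℕ.^ w ℕ.+ 2 ℕ.^ w                     ≡⟨ cong (2 ℕ.^ w ℕ.+_) (ℕₚ.+-identityʳ (2 ℕ.^ w)) ⟨
    2 ℕ.^ suc w                             ≡⟨ cong (2 ℕ.^_) (ℕₚ.m+[n∸m]≡n 1≤log) ⟩
    2 ℕ.^ ⌈log₂ n ⌉                         ∎
    where
    w = ⌈log₂ n ⌉ ℕ.∸ 1
    1≤log : 1 ℕ.≤ ⌈log₂ n ⌉
    1≤log = ⌈log₂⌉-mono-≤ {2} {n} (ℕ.s≤s (ℕ.s≤s ℕ.z≤n))
    half≤ : ℕ.⌈ n /2⌉ ℕ.≤ 2 ℕ.^ w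
    half≤ = subst (λ l → ℕ.⌈ n /2⌉ ℕ.≤ 2 ℕ.^ l) (⌈log₂⌈n/2⌉⌉≡⌈log₂n⌉∸1 n) (rec (ℕₚ.⌈n/2⌉<n m))

-- Encoding intervals of identities as messages

bits : ℕ → ℕ → List Bool
bits zero    m = []
bits (suc w) m = (m ℕ.% 2 ℕ.≡ᵇ 1) ∷ bits w (m ℕ./ 2)

value : List Bool → ℕ
value []       = 0
value (x ∷ xs) = (if x then 1 else 0) ℕ.+ value xs ℕ.* 2

length-bits : ∀ w m → length (bits w m) ≡ w
length-bits zero    m = refl
length-bits (suc w) m = cong suc (length-bits w (m ℕ./ 2))

value-bits : ∀ w {m} → m ℕ.< 2 ℕ.^ w → value (bits w m) ≡ m
value-bits zero    {zero}  _ = refl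
value-bits zero    {suc m} (ℕ.s≤s ())
value-bits (suc w) {m} m< = trans (cong₂ ℕ._+_ (parity (m ℕ.% 2) (ℕ.m%n<n m 2))
    (cong (ℕ._* 2) (value-bits w (ℕ.m<n*o⇒m/o<n (subst (m ℕ.<_) (ℕₚ.*-comm 2 (2 ℕ.^ w)) m<)))))
  (sym (ℕ.m≡m%n+[m/n]*n m 2))
  where
  parity : ∀ r → r ℕ.< 2 → (if r ℕ.≡ᵇ 1 then 1 else 0) ≡ r
  parity zero          _ = refl
  parity (suc zero)    _ = refl
  parity (suc (suc r)) (ℕ.s≤s (ℕ.s≤s ()))

take-++ : ∀ {A : Set} (xs ys : List A) → List.take (length xs) (xs List.++ ys) ≡ xs
take-++ []       ys = refl
take-++ (x ∷ xs) ys = cong (x ∷_) (take-++ xs ys)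

drop-++ : ∀ {A : Set} (xs ys : List A) → List.drop (length xs) (xs List.++ ys) ≡ ys
drop-++ []       ys = refl
drop-++ (x ∷ xs) ys = drop-++ xs ys

Interval : Set
Interval = Maybe (ℕ × ℕ)

-- The empty message is also what arrives where there is no edge, so both decode to `nothing`. The
-- leading bit keeps every other message nonempty even for `w = 0`.
encode : ℕ → Interval → Message
encode w nothing        = []
encode w (just (a , b)) = true ∷ bits w a List.++ bits w b

decode : ℕ → Message → Interval
decode w []       = nothing
decode w (_ ∷ xs) = just (value (List.take w xs) , value (List.drop w xs))

decode-encode : ∀ w {a b} → a ℕ.< 2 ℕ.^ w → b ℕ.< 2 ℕ.^ w → decode w (encode w (just (a , b))) ≡ just (a , b)
decode-encode w {a} {b} a< b< = cong₂ (λ x y → just (x , y))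
  (trans (cong value (trans (cong (λ l → List.take l (bits w a List.++ bits w b)) (sym (length-bits w a)))
    (take-++ (bits w a) (bits w b)))) (value-bits w a<))
  (trans (cong value (trans (cong (λ l → List.drop l (bits w a List.++ bits w b)) (sym (length-bits w a)))
    (drop-++ (bits w a) (bits w b)))) (value-bits w b<))

length-encode : ∀ w I → length (encode w I) ℕ.≤ suc (w ℕ.+ w)
length-encode w nothing        = ℕ.z≤n
length-encode w (just (a , b)) = ℕₚ.≤-reflexive (cong suc
  (trans (Listₚ.length-++ (bits w a)) (cong₂ ℕ._+_ (length-bits w a) (length-bits w b))))

merge : Interval → Interval → Interval
merge nothing        J              = J
merge (just I)       nothing        = just I
merge (just (a , b)) (just (c , d)) = just (a ℕ.⊓ c , b ℕ.⊔ d)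

mergeAll : ∀ {m} → (Fin m → Interval) → Interval
mergeAll {zero}  I = nothing
mergeAll {suc m} I = merge (I zero) (mergeAll (I ∘ suc))

module _ {n : ℕ} (rank : Fin n → ℕ) where

  -- The interval consists of the extreme ranks in `S`. That they are attained lets `verdict` name a
  -- vertex that has actually been heard.
  Hull : Interval → (Fin n → Set) → Set
  Hull nothing        S = ∀ u → ¬ S u
  Hull (just (a , b)) S = (∃ λ u → S u × rank u ≡ a) × (∃ λ u → S u × rank u ≡ b) ×
                          ∀ u → S u → a ℕ.≤ rank u × rank u ℕ.≤ b

  hull-⇔ : ∀ I {S S′ : Fin n → Set} → (∀ {u} → S u → S′ u) → (∀ {u} → S′ u → S u) → Hull I S → Hull I S′
  hull-⇔ nothing        S⇒S′ S′⇒S none u = none u ∘ S′⇒S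
  hull-⇔ (just (a , b)) S⇒S′ S′⇒S ((u , u∈ , u≡) , (w , w∈ , w≡) , bounds) =
    (u , S⇒S′ u∈ , u≡) , (w , S⇒S′ w∈ , w≡) , λ v → bounds v ∘ S′⇒S

  hull-merge : ∀ I J {S S′ : Fin n → Set} → Hull I S → Hull J S′ → Hull (merge I J) (λ u → S u ⊎ S′ u)
  hull-merge nothing  J       none h = hull-⇔ J inj₂ (λ { (inj₁ s) → contradiction s (none _) ; (inj₂ s) → s }) h
  hull-merge (just I) nothing h none = hull-⇔ (just I) inj₁ (λ { (inj₁ s) → s ; (inj₂ s) → contradiction s (none _) }) h
  hull-merge (just (a , b)) (just (c , d)) {S} {S′} ((u , u∈ , u≡) , (v , v∈ , v≡) , bounds) ((u′ , u′∈ , u′≡) , (v′ , v′∈ , v′≡) , bounds′) =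
    lowest , highest , λ where
      w (inj₁ w∈) → ℕₚ.m≤n⇒m⊓o≤n c (proj₁ (bounds w w∈)) , ℕₚ.m≤n⇒m≤n⊔o d (proj₂ (bounds w w∈))
      w (inj₂ w∈) → ℕₚ.m≤n⇒o⊓m≤n a (proj₁ (bounds′ w w∈)) , ℕₚ.m≤n⇒m≤o⊔n b (proj₂ (bounds′ w w∈))
    where
    lowest : ∃ λ w → (S w ⊎ S′ w) × rank w ≡ a ℕ.⊓ c
    lowest with ℕₚ.⊓-sel a c
    ... | inj₁ eq = u  , inj₁ u∈  , trans u≡  (sym eq)
    ... | inj₂ eq = u′ , inj₂ u′∈ , trans u′≡ (sym eq)
    highest : ∃ λ w → (S w ⊎ S′ w) × rank w ≡ b ℕ.⊔ d
    highest with ℕₚ.⊔-sel b d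
    ... | inj₁ eq = v  , inj₁ v∈  , trans v≡  (sym eq)
    ... | inj₂ eq = v′ , inj₂ v′∈ , trans v′≡ (sym eq)

  hull-mergeAll : ∀ {m} (I : Fin m → Interval) {S : Fin m → Fin n → Set} → (∀ p → Hull (I p) (S p)) →
                  Hull (mergeAll I) (λ u → ∃ λ p → S p u)
  hull-mergeAll {zero}  I h u ()
  hull-mergeAll {suc m} I h = hull-⇔ (mergeAll I)
    (λ { (inj₁ s) → zero , s ; (inj₂ (p , s)) → suc p , s })
    (λ { (zero , s) → inj₁ s ; (suc p , s) → inj₂ (p , s) })
    (hull-merge (I zero) (mergeAll (I ∘ suc)) (h zero) (hull-mergeAll (I ∘ suc) (h ∘ suc)))

  hull-decode : ∀ w I {S} → (∀ u → rank u ℕ.< 2 ℕ.^ w) → Hull I S → Hull (decode w (encode w I)) S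
  hull-decode w nothing        rank< h = h
  hull-decode w (just (a , b)) {S} rank< h@((u , _ , refl) , (v , _ , refl) , _) =
    subst (λ I → Hull I S) (sym (decode-encode w (rank< u) (rank< v))) h

concat-injective : ∀ {A : Set} {m k} (xss yss : Vec (Vec A k) m) → concat xss ≡ concat yss → xss ≡ yss
concat-injective []         []         _  = refl
concat-injective (xs ∷ xss) (ys ∷ yss) eq =
  let xs≡ys , rest = Vecₚ.++-injective xs ys eq in cong₂ _∷_ xs≡ys (concat-injective xss yss rest)

chunks : ∀ {A : Set} m k → Vec A (m ℕ.* k) → Vec (Vec A k) m
chunks m k xs = proj₁ (Vec.group m k xs)

chunks-concat : ∀ {A : Set} {m k} (xss : Vec (Vec A k) m) → chunks m k (concat xss) ≡ xss
chunks-concat {m = m} {k} xss = sym (concat-injective xss _ (proj₂ (Vec.group m k (concat xss))))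

-- The program of a processor and its invariant

module Decomposition (lam k′ b j : ℕ) where

  k : ℕ
  k = suc k′

  samples : Vec Bool (lam ℕ.* (k ℕ.* b)) → Vec (Vec (Vec Bool b) k) lam
  samples coins = Vec.map (chunks k b) (chunks lam (k ℕ.* b) coins)

  record Processor : Set where
    constructor processor
    field
      self       : ℕ
      radius     : ℕ → ℕ
      phase time : ℕ
      active     : Bool
      heard      : Interval
      label      : Maybe ℕ

  open Processor

  start : ℕ → ℕ → ℕ → Interval
  start self s r = if k ℕ.≤ᵇ s ℕ.+ r then just (self , self) else nothing

  -- The intervals belong to consecutive times. `Settles` says that `rank u` is the least rank heard
  -- at the earlier and the greatest heard at the later one, so comparing these two numbers decides
  -- it.
  verdict : ℕ → Interval → Interval → Maybe ℕ
  verdict t (just (a , _)) (just (_ , b)) = if a ℕ.≡ᵇ b then just (t ℕ.+ a ℕ.* lam) else nothing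
  verdict t _              _              = nothing

  beginPhase : ℕ → (ℕ → ℕ) → ℕ → Bool → Maybe ℕ → Processor
  beginPhase self radius t active label =
    processor self radius t 0 active (if active then start self 0 (radius t) else nothing) label

  listen : Processor → Interval → Processor
  listen σ I = finish (suc (time σ) ℕₚ.≟ k)
    where
    heard′ = if active σ then merge (start (self σ) (suc (time σ)) (radius σ (phase σ))) (merge (heard σ) I) else nothing
    label′ = label σ <∣> verdict (phase σ) (heard σ) heard′
    finish : Dec (suc (time σ) ≡ k) → Processor
    finish (no  _) = processor (self σ) (radius σ) (phase σ) (suc (time σ)) (active σ) heard′ label′
    -- The last verdict of a phase and the broadcasts at time 0 of the next one share a round, so no
    -- round is lost between phases.
    finish (yes _) = beginPhase (self σ) (radius σ) (suc (phase σ)) (active σ ∧ is-nothing label′) label′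

  algorithm : ∀ n → Algorithm n
  algorithm n = record
    { coins   = lam ℕ.* (k ℕ.* b)
    ; State   = Processor
    ; init    = λ i _ ω → beginPhase (toℕ i) (radiusAt (dyadic b j) (samples ω)) 0 true nothing
    ; send    = λ σ _ → encode ⌈log₂ n ⌉ (heard σ)
    ; receive = λ σ msgs → listen σ (mergeAll (decode ⌈log₂ n ⌉ ∘ msgs))
    ; rounds  = lam ℕ.* k
    ; output  = λ σ → fromMaybe 0 (label σ)
    }

  module Correctness {n : ℕ} (N : Network n) .{{_ : NonZero lam}} where

    open Execution (algorithm n) N
    open Network N using () renaming (graph to G)

    rank : Fin n → ℕ
    rank v = toℕ (ident N ⟨$⟩ʳ v)

    rank-injective : ∀ {u v} → rank u ≡ rank v → u ≡ v
    rank-injective {u} {v} eq = trans (sym (inverseˡ (ident N)))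
      (trans (cong (ident N ⟨$⟩ˡ_) (Fₚ.toℕ-injective eq)) (inverseˡ (ident N)))

    rank< : ∀ v → rank v ℕ.< 2 ℕ.^ ⌈log₂ n ⌉
    rank< v = ℕₚ.<-≤-trans (Fₚ.toℕ<n _) (n≤2^⌈log₂n⌉ n)

    open Shifts G rank rank-injective k

    module _ (ω : Outcome) where

      ρ : ℕ → Fin n → ℕ
      ρ t v = radiusAt (dyadic b j) (samples (Vec.lookup ω v)) t

      HeardAt : ℕ → ℕ → Fin n → Fin n → Set
      HeardAt t s v u = Heard (alive ρ t) (ρ t u) s u v

      -- `unlabelled` also records that the vertex remains and has not settled so far; hence a
      -- vertex without a label on entering phase `lam` has survived all phases.
      data Labelled (t s : ℕ) (v : Fin n) : Maybe ℕ → Set where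
        unlabelled : T (alive ρ t v) → (∀ s′ → s′ ℕ.< s → ∀ u → ¬ Settles (alive ρ t) (ρ t) s′ v u) → Labelled t s v nothing
        now    : ∀ {s′ u} → s′ ℕ.< s → Settles (alive ρ t) (ρ t) s′ v u → Labelled t s v (just (identifier ρ lam t u))
        before : ∀ {t′ u} → t′ ℕ.< t → JoinsAt ρ t′ v u → Labelled t s v (just (identifier ρ lam t′ u))

      record Spec (t s : ℕ) (v : Fin n) (σ : Processor) : Set where
        field
          self≡    : self σ ≡ rank v
          radius≡  : ∀ t → radius σ t ≡ ρ t v
          phase≡   : phase σ ≡ t
          time≡    : time σ ≡ s
          active≡  : active σ ≡ alive ρ t v
          hull     : Hull rank (heard σ) (HeardAt t (suc s) v)
          labelled : Labelled t s v (label σ)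

      start-hull : ∀ s r v → Hull rank (start (rank v) s r) (λ u → u ≡ v × k ℕ.≤ s ℕ.+ r)
      start-hull s r v with k ℕ.≤ᵇ s ℕ.+ r in eq
      ... | true  = (v , (refl , k≤) , refl) , (v , (refl , k≤) , refl) , λ { u (refl , _) → ℕₚ.≤-refl , ℕₚ.≤-refl }
        where k≤ = ℕₚ.≤ᵇ⇒≤ k _ (subst T (sym eq) _)
      ... | false = λ u (_ , k≤) → subst T eq (ℕₚ.≤⇒≤ᵇ k≤)

      beginPhase-spec : ∀ {self radius t active label v} → self ≡ rank v → (∀ t → radius t ≡ ρ t v) →
        active ≡ alive ρ t v → Labelled t 0 v label → Spec t 0 v (beginPhase self radius t active label)
      beginPhase-spec {radius = radius} {t = t} {v = v} refl radius≡ refl L = record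
        { self≡ = refl ; radius≡ = radius≡ ; phase≡ = refl ; time≡ = refl ; active≡ = refl ; labelled = L
        ; hull = initial (alive ρ t v) refl }
        where
        initial : ∀ c → alive ρ t v ≡ c → Hull rank (if c then start (rank v) 0 (radius t) else nothing) (HeardAt t 1 v)
        initial false v∉ u (v∈ , _) = subst T v∉ v∈
        initial true  v∈ rewrite radius≡ t = hull-⇔ rank (start (rank v) 0 (ρ t v))
          (λ { (refl , k≤) → subst T (sym v∈) _ , inj₁ (refl , k≤) })
          (λ { (_ , inj₁ (refl , k≤)) → refl , k≤ ; (_ , inj₂ (inj₁ ())) ; (_ , inj₂ (inj₂ (_ , _ , ()))) })
          (start-hull 0 (ρ t v) v)

      verdict-spec : ∀ {t s v} I J → Hull rank I (HeardAt t (suc s) v) → Hull rank J (HeardAt t (suc (suc s)) v) →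
        (∃ λ u → verdict t I J ≡ just (identifier ρ lam t u) × Settles (alive ρ t) (ρ t) s v u) ⊎
        (verdict t I J ≡ nothing × ∀ u → ¬ Settles (alive ρ t) (ρ t) s v u)
      verdict-spec nothing J none _ = inj₂ (refl , λ u (h , _) → none u h)
      verdict-spec (just _) nothing _ none = inj₂ (refl , λ u (h , _) → none u (heard-suc (suc _) h))
      verdict-spec {s = s} (just (a , _)) (just (_ , b)) ((u , hu , refl) , _ , bounds) (_ , (w , hw , refl) , bounds′)
        with rank u ℕ.≡ᵇ rank w in eq
      ... | true  = inj₁ (u , refl , hu , (λ x → proj₁ ∘ bounds x) ,
              λ x h → subst (rank x ℕ.≤_) (sym (ℕₚ.≡ᵇ⇒≡ (rank u) (rank w) (subst T (sym eq) _))) (proj₂ (bounds′ x h)))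
      ... | false = inj₂ (refl , λ x (h , lower , upper) → subst T eq (ℕₚ.≡⇒≡ᵇ (rank u) (rank w)
              (trans (ℕₚ.≤-antisym (proj₁ (bounds x h)) (lower u hu))
                     (ℕₚ.≤-antisym (proj₂ (bounds′ x (heard-suc (suc s) h))) (upper w hw)))))

      relabel : ∀ {t s v ℓ} I J → Hull rank I (HeardAt t (suc s) v) → Hull rank J (HeardAt t (suc (suc s)) v) →
        Labelled t s v ℓ → Labelled t (suc s) v (ℓ <∣> verdict t I J)
      relabel I J hI hJ (now s′<s S) = now (ℕₚ.m≤n⇒m≤1+n s′<s) S
      relabel I J hI hJ (before t′<t J′) = before t′<t J′
      relabel {t} {s} {v} I J hI hJ (unlabelled v∈ none) with verdict-spec I J hI hJ
      ... | inj₁ (u , eq , S) = subst (Labelled t (suc s) v) (sym eq) (now ℕₚ.≤-refl S)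
      ... | inj₂ (eq , ¬S) = subst (Labelled t (suc s) v) (sym eq) (unlabelled v∈ none′)
        where
        none′ : ∀ s′ → s′ ℕ.< suc s → ∀ u → ¬ Settles (alive ρ t) (ρ t) s′ v u
        none′ s′ s′<1+s with ℕₚ.m≤n⇒m<n∨m≡n (ℕ.s≤s⁻¹ s′<1+s)
        ... | inj₁ s′<s = none s′ s′<s
        ... | inj₂ refl = ¬S

      inactive : ∀ {t v} → ¬ T (alive ρ (suc t) v) → alive ρ t v ∧ false ≡ alive ρ (suc t) v
      inactive {t} {v} v∉ = trans (Boolₚ.∧-zeroʳ (alive ρ t v)) (sym (¬T⇒≡false v∉))

      next-phase : ∀ {t v ℓ} → Labelled t k v ℓ → Labelled (suc t) 0 v ℓ × alive ρ t v ∧ is-nothing ℓ ≡ alive ρ (suc t) v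
      next-phase {t} {v} (unlabelled v∈ none) =
        unlabelled (T-∧⁺ v∈ still) (λ _ ()) , cong (alive ρ t v ∧_) (sym (Equivalence.to Boolₚ.T-≡ still))
        where
        still : T (not ⌊ Fₚ.any? (joins? (alive ρ t) (ρ t) v) ⌋)
        still = T-not {⌊ Fₚ.any? (joins? (alive ρ t) (ρ t) v) ⌋} λ joined → let u , s , s<k , S = toWitness {a? = Fₚ.any? (joins? (alive ρ t) (ρ t) v)} joined in none s s<k u S
      next-phase {t} {v} (now s<k S) = before ℕₚ.≤-refl (_ , s<k , S) , inactive (joins-dies ρ {t} (_ , s<k , S))
      next-phase {t} {v} (before {t′} t′<t J) = before (ℕₚ.m≤n⇒m≤1+n t′<t) J ,
        inactive (λ v∈ → joins-dies ρ {t′} J (alive-antitone ρ (ℕₚ.m≤n⇒m≤1+n t′<t) v∈))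

      listen-spec : ∀ {t s v σ I} → Spec t s v σ →
        Hull rank I (λ u → ∃ λ z → Adjacent G v z × HeardAt t (suc s) z u) →
        (suc s ℕ.< k → Spec t (suc s) v (listen σ I)) × (suc s ≡ k → Spec (suc t) 0 v (listen σ I))
      listen-spec {t} {s} {v} {processor self radius .t .s active I ℓ} {J}
        record { self≡ = refl ; radius≡ = radius≡ ; phase≡ = refl ; time≡ = refl ; active≡ = refl ; hull = hull ; labelled = L } hJ
        = same , next
        where
        heard′ : Interval
        heard′ = if active then merge (start self (suc s) (radius t)) (merge I J) else nothing
        hull′ : ∀ c → alive ρ t v ≡ c →
          Hull rank (if c then merge (start self (suc s) (radius t)) (merge I J) else nothing) (HeardAt t (suc (suc s)) v)
        hull′ false v∉ u (v∈ , _) = subst T v∉ v∈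
        hull′ true  v∈ rewrite radius≡ t = hull-⇔ rank (merge (start self (suc s) (ρ t v)) (merge I J))
          (λ { (inj₁ (refl , k≤)) → subst T (sym v∈) _ , inj₁ (refl , k≤) ; (inj₂ h) → subst T (sym v∈) _ , inj₂ h })
          (λ { (_ , inj₁ (refl , k≤)) → inj₁ (refl , k≤) ; (_ , inj₂ h) → inj₂ h })
          (hull-merge rank _ (merge I J) (start-hull (suc s) (ρ t v) v) (hull-merge rank I J hull hJ))
        L′ : Labelled t (suc s) v (ℓ <∣> verdict t I heard′)
        L′ = relabel I heard′ hull (hull′ active refl) L
        same : suc s ℕ.< k → Spec t (suc s) v (listen (processor self radius t s active I ℓ) J)
        same 1+s<k with suc s ℕₚ.≟ k
        ... | yes 1+s≡k = contradiction 1+s≡k (ℕₚ.<⇒≢ 1+s<k)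
        ... | no  _ = record { self≡ = refl ; radius≡ = radius≡ ; phase≡ = refl ; time≡ = refl ; active≡ = refl
                             ; hull = hull′ active refl ; labelled = L′ }
        next : suc s ≡ k → Spec (suc t) 0 v (listen (processor self radius t s active I ℓ) J)
        next 1+s≡k with suc s ℕₚ.≟ k
        ... | no 1+s≢k = contradiction 1+s≡k 1+s≢k
        ... | yes _ = let L″ , active″ = next-phase (subst (λ s → Labelled t s v (ℓ <∣> verdict t I heard′)) 1+s≡k L′) in
                beginPhase-spec refl radius≡ active″ L″

      state-step : ∀ {t s} m → (∀ v → Spec t s v (state ω m v)) → ∀ v →
        (suc s ℕ.< k → Spec t (suc s) v (state ω (suc m) v)) × (suc s ≡ k → Spec (suc t) 0 v (state ω (suc m) v))
      state-step {t} {s} m specs v = listen-spec (specs v) (hull-⇔ rank (mergeAll received)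
        (λ (p , e , h) → port N v ⟨$⟩ˡ p , e , h)
        (λ (z , e , h) → port N v ⟨$⟩ʳ z , subst (λ z → Adjacent G v z × HeardAt t (suc s) z _) (sym (inverseˡ (port N v))) (e , h))
        (hull-mergeAll rank received receives))
        where
        sender : Fin n → Fin n
        sender p = port N v ⟨$⟩ˡ p
        received : Fin n → Interval
        received p = decode ⌈log₂ n ⌉ (if adj G v (sender p) then message ω m (sender p) v else [])
        receives : ∀ p → Hull rank (received p) (λ u → Adjacent G v (sender p) × HeardAt t (suc s) (sender p) u)
        receives p with adj G v (sender p)
        ... | false = λ u ()
        ... | true  = hull-decode rank ⌈log₂ n ⌉ (heard (state ω m (sender p))) rank<
          (hull-⇔ rank (heard (state ω m (sender p))) (λ h → _ , h) proj₂ (Spec.hull (specs (sender p))))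

      state-spec : ∀ t s → s ℕ.< k → ∀ v → Spec t s v (state ω (s ℕ.+ t ℕ.* k) v)
      state-spec zero zero _ v = beginPhase-spec refl (λ _ → refl) refl (unlabelled _ λ _ ())
      state-spec (suc t) zero _ v = proj₂ (state-step (k′ ℕ.+ t ℕ.* k) (state-spec t k′ ℕₚ.≤-refl) v) refl
      state-spec t (suc s) 1+s<k v = proj₁ (state-step (s ℕ.+ t ℕ.* k) (state-spec t s (ℕₚ.<-trans (ℕₚ.n<1+n s) 1+s<k)) v) 1+s<k

      final-label : Fin n → Maybe ℕ
      final-label v = label (state ω (lam ℕ.* k) v)

      complete? : Dec (∀ v → T (is-just (final-label v)))
      complete? = Fₚ.all? λ v → T? _

      final-labelled : ∀ v → Labelled lam 0 v (final-label v)
      final-labelled v = Spec.labelled (state-spec lam 0 (ℕ.s≤s ℕ.z≤n) v)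

      complete-labels : (∀ v → T (is-just (final-label v))) → ∀ v →
        ∃ λ t → ∃ λ u → t ℕ.< lam × JoinsAt ρ t v u × clustering ω v ≡ identifier ρ lam t u
      complete-labels complete v with final-label v | final-labelled v | complete v
      ... | .(just _) | before t<lam J | _ = _ , _ , t<lam , J , refl

      incomplete-alive : ¬ (∀ v → T (is-just (final-label v))) → ∃ λ v → T (alive ρ lam v)
      incomplete-alive incomplete with Fₚ.any? (λ v → T? (alive ρ lam v))
      ... | yes some = some
      ... | no none = contradiction finished incomplete
        where
        finished : ∀ v → T (is-just (final-label v))
        finished v with final-label v | final-labelled v
        ... | .nothing  | unlabelled v∈ _ = none (v , v∈)
        ... | .(just _) | now _ _         = _
        ... | .(just _) | before _ _      = _

    message-length : ∀ ω t u v → length (message ω t u v) ℕ.≤ suc (⌈log₂ n ⌉ ℕ.+ ⌈log₂ n ⌉)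
    message-length ω t u v = length-encode ⌈log₂ n ⌉ (heard (state ω t u))

    open Coins (algorithm n) N
    open Survival (algorithm n) N G rank rank-injective (independent-isExpectation fairCoin-isExpectation b)
      (independent-commutes fairCoin-isExpectation fairCoin-commutes b) (dyadic b j) k lam
      using (𝔼; 𝔼-exp; radii; someAlive; failure-bound)
    open Geometric (algorithm n) N (independent-isExpectation fairCoin-isExpectation b) (dyadic b j) using (q)

    private
      module 𝔼 = IsExpectation 𝔼-exp

    complete : Outcome → Bool
    complete ω = ⌊ complete? ω ⌋

    flatten : Vec (Vec (Vec Bool b) k) lam → Vec Bool (lam ℕ.* (k ℕ.* b))
    flatten xss = concat (Vec.map concat xss)

    samples-flatten : ∀ xss → samples (flatten xss) ≡ xss
    samples-flatten xss = begin
      Vec.map (chunks k b) (chunks lam (k ℕ.* b) (flatten xss))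
        ≡⟨ cong (Vec.map (chunks k b)) (chunks-concat (Vec.map concat xss)) ⟩
      Vec.map (chunks k b) (Vec.map concat xss)
        ≡⟨ Vecₚ.map-∘ (chunks k b) concat xss ⟨
      Vec.map (chunks k b ∘ concat) xss
        ≡⟨ Vecₚ.map-cong chunks-concat xss ⟩
      Vec.map (λ ys → ys) xss
        ≡⟨ Vecₚ.map-id xss ⟩
      xss ∎
      where open ≡-Reasoning

    -- The flat string of coins of a processor is distributed like a flattened table of independent
    -- trials of `b` bits, so the analysis may be carried out on tables.
    expectation-𝔼 : ∀ f → expectation f ≡ 𝔼 (f ∘ Vec.map flatten)
    expectation-𝔼 f = independent-map (independent-isExpectation fairCoin-isExpectation (lam ℕ.* (k ℕ.* b))) flatten
      (λ g → trans (independent-concat fairCoin-isExpectation lam (k ℕ.* b) g)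
        (independent-map (independent-isExpectation fairCoin-isExpectation (k ℕ.* b)) concat
          (independent-concat fairCoin-isExpectation k b)
          (independent-isExpectation (independent-isExpectation fairCoin-isExpectation b) k) lam (g ∘ concat)))
      (independent-isExpectation (independent-isExpectation (independent-isExpectation fairCoin-isExpectation b) k) lam) n f

    incomplete⇒someAlive : ∀ xsss → T (not (complete (Vec.map flatten xsss))) → T (someAlive xsss)
    incomplete⇒someAlive xsss incomplete = fromWitness (v , subst T (alive-cong {ρ ω} {radii xsss} lam (λ t _ → same t) v) v∈)
      where
      ω = Vec.map flatten xsss
      some = incomplete-alive ω λ labels → subst (T ∘ not) (Equivalence.to Boolₚ.T-≡ (fromWitness {a? = complete? ω} labels)) incomplete
      v  = proj₁ some
      v∈ = proj₂ some
      same : ∀ t u → ρ ω t u ≡ radii xsss t u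
      same t u = cong (λ bs → radiusAt (dyadic b j) bs t)
        (trans (cong samples (Vecₚ.lookup-map u flatten xsss)) (samples-flatten (Vec.lookup xsss u)))

    success-bound : 1ℚ ℚ.- (ℕ→ℚ n ℚ.* q ^ lam ℚ.+ geometricSum q lam ℚ.* (ℕ→ℚ n ℚ.* (1ℚ ℚ.- q) ^ k)) ℚ.≤ probability complete
    success-bound = begin
      1ℚ ℚ.- bound
        ≤⟨ ℚₚ.+-monoʳ-≤ 1ℚ (ℚₚ.neg-antimono-≤ failure-bound) ⟩
      1ℚ ℚ.- 𝔼 (λ xsss → 𝟙 (someAlive xsss))
        ≡⟨ cong₂ ℚ._+_ (𝔼.constant 1ℚ) (trans (𝔼.scale (ℚ.- 1ℚ) (λ xsss → 𝟙 (someAlive xsss))) (ring (𝔼 λ xsss → 𝟙 (someAlive xsss)))) ⟨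
      𝔼 (λ _ → 1ℚ) ℚ.+ 𝔼 (λ xsss → ℚ.- 1ℚ ℚ.* 𝟙 (someAlive xsss))
        ≡⟨ 𝔼.add (λ _ → 1ℚ) (λ xsss → ℚ.- 1ℚ ℚ.* 𝟙 (someAlive xsss)) ⟨
      𝔼 (λ xsss → 1ℚ ℚ.+ ℚ.- 1ℚ ℚ.* 𝟙 (someAlive xsss))
        ≤⟨ 𝔼.mono pointwise ⟩
      𝔼 (λ xsss → 𝟙 (complete (Vec.map flatten xsss)))
        ≡⟨ expectation-𝔼 (𝟙 ∘ complete) ⟨
      probability complete ∎
      where
      open ℚₚ.≤-Reasoning
      bound = ℕ→ℚ n ℚ.* q ^ lam ℚ.+ geometricSum q lam ℚ.* (ℕ→ℚ n ℚ.* (1ℚ ℚ.- q) ^ k)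
      ring : ∀ a → ℚ.- 1ℚ ℚ.* a ≡ ℚ.- a
      ring = solve 1 (λ a → :- con 1ℚ :* a := :- a) refl
      pointwise : ∀ xsss → 1ℚ ℚ.+ ℚ.- 1ℚ ℚ.* 𝟙 (someAlive xsss) ℚ.≤ 𝟙 (complete (Vec.map flatten xsss))
      pointwise xsss = begin
        1ℚ ℚ.+ ℚ.- 1ℚ ℚ.* 𝟙 (someAlive xsss)
          ≡⟨ cong (1ℚ ℚ.+_) (ring (𝟙 (someAlive xsss))) ⟩
        1ℚ ℚ.- 𝟙 (someAlive xsss)
          ≤⟨ ℚₚ.+-monoʳ-≤ 1ℚ (ℚₚ.neg-antimono-≤ (𝟙-mono (incomplete⇒someAlive xsss))) ⟩
        1ℚ ℚ.- 𝟙 (not (complete (Vec.map flatten xsss)))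
          ≡⟨ 𝟙-not (complete (Vec.map flatten xsss)) ⟨
        𝟙 (complete (Vec.map flatten xsss)) ∎

    decomposes : ∀ {D} → fromℕ (2 ℕ.* k) ≤ D → ∀ ω → T (complete ω) → IsStrongNetworkDecomposition G (clustering ω) D lam
    decomposes {D} 2k≤D ω C = (λ i v w → let d , dist , d≤2k = diameter (ρ ω) lam labels i v w in d , dist , below d d≤2k) ,
      colorable (ρ ω) lam labels
      where
      labels = complete-labels ω (toWitness C)
      below : ∀ d → d ℕ.≤ k ℕ.+ k → fromℕ d ≤ D
      below d d≤2k ε 0<ε = let M , 2k≤ = 2k≤D ε 0<ε in M , λ m M≤m → ℚₚ.≤-trans
        (ℕ→ℚ-mono (subst (λ j → d ℕ.≤ k ℕ.+ j) (sym (ℕₚ.+-identityʳ k)) d≤2k)) (2k≤ m M≤m)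

-- Estimates of powers and of the exponential function

0≤^ : ∀ m {a} → 0ℚ ℚ.≤ a → 0ℚ ℚ.≤ a ^ m
0≤^ zero    0≤a = 0≤1
0≤^ (suc m) 0≤a = 0≤* 0≤a (0≤^ m 0≤a)

*-mono-≤ : ∀ {a b c d} → 0ℚ ℚ.≤ b → 0ℚ ℚ.≤ c → a ℚ.≤ b → c ℚ.≤ d → a ℚ.* c ℚ.≤ b ℚ.* d
*-mono-≤ {b = b} {c} 0≤b 0≤c a≤b c≤d = ℚₚ.≤-trans (*-monoˡ c 0≤c a≤b) (*-monoʳ b 0≤b c≤d)

^-mono : ∀ m {a b} → 0ℚ ℚ.≤ a → a ℚ.≤ b → a ^ m ℚ.≤ b ^ m
^-mono zero    0≤a a≤b = ℚₚ.≤-refl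
^-mono (suc m) 0≤a a≤b = *-mono-≤ (ℚₚ.≤-trans 0≤a a≤b) (0≤^ m 0≤a) a≤b (^-mono m 0≤a a≤b)

1≤^ : ∀ m {a} → 1ℚ ℚ.≤ a → 1ℚ ℚ.≤ a ^ m
1≤^ zero    1≤a = ℚₚ.≤-refl
1≤^ (suc m) {a} 1≤a = *-mono-≤ (ℚₚ.≤-trans 0≤1 1≤a) 0≤1 1≤a (1≤^ m 1≤a)

a≤a^suc : ∀ m {a} → 1ℚ ℚ.≤ a → a ℚ.≤ a ^ suc m
a≤a^suc m {a} 1≤a = subst (ℚ._≤ a ^ suc m) (ℚₚ.*-identityʳ a) (*-monoʳ a (ℚₚ.≤-trans 0≤1 1≤a) (1≤^ m 1≤a))

^-distrib-* : ∀ m a b → (a ℚ.* b) ^ m ≡ a ^ m ℚ.* b ^ m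
^-distrib-* zero    a b = refl
^-distrib-* (suc m) a b = trans (cong ((a ℚ.* b) ℚ.*_) (^-distrib-* m a b)) (ring a b (a ^ m) (b ^ m))
  where
  ring : ∀ a b c d → (a ℚ.* b) ℚ.* (c ℚ.* d) ≡ (a ℚ.* c) ℚ.* (b ℚ.* d)
  ring = solve 4 (λ a b c d → (a :* b) :* (c :* d) := (a :* c) :* (b :* d)) refl

^-+ : ∀ m k a → a ^ (m ℕ.+ k) ≡ a ^ m ℚ.* a ^ k
^-+ zero    k a = sym (ℚₚ.*-identityˡ (a ^ k))
^-+ (suc m) k a = trans (cong (a ℚ.*_) (^-+ m k a)) (sym (ℚₚ.*-assoc a (a ^ m) (a ^ k)))

^-^ : ∀ m k a → (a ^ k) ^ m ≡ a ^ (m ℕ.* k)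
^-^ zero    k a = refl
^-^ (suc m) k a = trans (cong (a ^ k ℚ.*_) (^-^ m k a)) (sym (^-+ k (m ℕ.* k) a))

-- Bernoulli's inequality in reciprocal form, `(1 + a) ^ m ≤ 1 / (1 - m a)`. The left side decreases
-- in `m`; `d` is the decrease.
bernoulli : ∀ m {a} → 0ℚ ℚ.≤ a → (1ℚ ℚ.+ a) ^ m ℚ.* (1ℚ ℚ.- ℕ→ℚ m ℚ.* a) ℚ.≤ 1ℚ
bernoulli zero {a} 0≤a = ℚₚ.≤-reflexive (ring a)
  where
  ring : ∀ a → 1ℚ ℚ.* (1ℚ ℚ.- 0ℚ ℚ.* a) ≡ 1ℚ
  ring = solve 1 (λ a → con 1ℚ :* (con 1ℚ :- con 0ℚ :* a) := con 1ℚ) refl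
bernoulli (suc m) {a} 0≤a = ℚₚ.≤-trans (certify d 0≤d
  (trans (cong (λ μ → (1ℚ ℚ.+ a) ^ m ℚ.* (1ℚ ℚ.- ℕ→ℚ m ℚ.* a) ℚ.- (1ℚ ℚ.+ a) ℚ.* (1ℚ ℚ.+ a) ^ m ℚ.* (1ℚ ℚ.- μ ℚ.* a)) (ℕ→ℚ-suc m))
    (ring a ((1ℚ ℚ.+ a) ^ m) (ℕ→ℚ m)))) (bernoulli m 0≤a)
  where
  d = (1ℚ ℚ.+ a) ^ m ℚ.* ((ℕ→ℚ m ℚ.+ 1ℚ) ℚ.* (a ℚ.* a))
  0≤d : 0ℚ ℚ.≤ d
  0≤d = 0≤* (0≤^ m (0≤1+ 0≤a)) (0≤* (0≤+ (0≤ℕ→ℚ m) 0≤1) (0≤* 0≤a 0≤a))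
  ring : ∀ a p m → p ℚ.* (1ℚ ℚ.- m ℚ.* a) ℚ.- (1ℚ ℚ.+ a) ℚ.* p ℚ.* (1ℚ ℚ.- (m ℚ.+ 1ℚ) ℚ.* a) ≡ p ℚ.* ((m ℚ.+ 1ℚ) ℚ.* (a ℚ.* a))
  ring = solve 3 (λ a p m → p :* (con 1ℚ :- m :* a) :- (con 1ℚ :+ a) :* p :* (con 1ℚ :- (m :+ con 1ℚ) :* a) := p :* ((m :+ con 1ℚ) :* (a :* a))) refl

expSum-cancel-≤ : ∀ m {a b} → 0ℚ ℚ.≤ b → expSum a (suc m) ℚ.≤ expSum b (suc m) → a ℚ.≤ b
expSum-cancel-≤ m {a} {b} 0≤b le with ℚₚ.≤-total a b
... | inj₁ a≤b = a≤b
... | inj₂ b≤a = certify _ (0≤diff (ℚₚ.≤-trans (expSum-expand m 0≤b b≤a) le)) (ring a b (expSum b (suc m)))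
  where
  ring : ∀ a b e → b ℚ.- a ≡ e ℚ.- (e ℚ.+ (a ℚ.- b))
  ring = solve 3 (λ a b e → b :- a := e :- (e :+ (a :- b))) refl

-- e ^ (j δ) ≤ (1 - δ) ^ (- j)
expSum-upper : ∀ m j {δ} → 0ℚ ℚ.≤ δ → δ ℚ.≤ 1ℚ → expSum (ℕ→ℚ j ℚ.* δ) (suc m) ℚ.* (1ℚ ℚ.- δ) ^ j ℚ.≤ 1ℚ
expSum-upper m zero {δ} 0≤δ δ≤1 = ℚₚ.≤-reflexive (trans (ℚₚ.*-identityʳ _)
  (trans (cong (λ q → expSum q (suc m)) (ℚₚ.*-zeroˡ δ)) (expSum-base (suc m))))
expSum-upper m (suc j) {δ} 0≤δ δ≤1 = ℚₚ.≤-trans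
  (certify (P ℚ.* ((Sa ℚ.+ Sb ℚ.* (b ℚ.- a)) ℚ.- Sb)) (0≤* 0≤P (0≤diff lip))
    (trans (cong (λ d → Sa ℚ.* P ℚ.- Sb ℚ.* (d ℚ.* P)) 1-δ≡) (ring Sa Sb P (b ℚ.- a))))
  (expSum-upper m j 0≤δ δ≤1)
  where
  a = ℕ→ℚ j ℚ.* δ
  b = ℕ→ℚ (suc j) ℚ.* δ
  Sa = expSum a (suc m)
  Sb = expSum b (suc m)
  P = (1ℚ ℚ.- δ) ^ j
  0≤P = 0≤^ j (0≤diff δ≤1)
  0≤a = 0≤* (0≤ℕ→ℚ j) 0≤δ
  b≡ : b ≡ a ℚ.+ δ
  b≡ = trans (cong (ℚ._* δ) (ℕ→ℚ-suc j)) (trans (ℚₚ.*-distribʳ-+ δ (ℕ→ℚ j) 1ℚ) (cong (a ℚ.+_) (ℚₚ.*-identityˡ δ)))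
  a≤b : a ℚ.≤ b
  a≤b = subst (a ℚ.≤_) (sym b≡) (p≤p+q a 0≤δ)
  1-δ≡ : 1ℚ ℚ.- δ ≡ 1ℚ ℚ.- (b ℚ.- a)
  1-δ≡ = trans (ring₀ a δ) (cong (λ b → 1ℚ ℚ.- (b ℚ.- a)) (sym b≡))
    where
    ring₀ : ∀ a δ → 1ℚ ℚ.- δ ≡ 1ℚ ℚ.- ((a ℚ.+ δ) ℚ.- a)
    ring₀ = solve 2 (λ a δ → con 1ℚ :- δ := con 1ℚ :- ((a :+ δ) :- a)) refl
  -- The derivative of a partial sum is the preceding partial sum, so the slope on this step is at
  -- most the value at its right end; hence `Sb * (1 - δ) ≤ Sa`.
  lip : Sb ℚ.≤ Sa ℚ.+ Sb ℚ.* (b ℚ.- a)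
  lip = ℚₚ.≤-trans (expSum-lipschitz m 0≤a a≤b)
    (ℚₚ.+-monoʳ-≤ Sa (*-monoˡ (b ℚ.- a) (0≤diff a≤b) (expSum-increasing (ℚₚ.≤-trans 0≤a a≤b) (ℕₚ.n≤1+n m))))
  ring : ∀ s t p d → s ℚ.* p ℚ.- t ℚ.* ((1ℚ ℚ.- d) ℚ.* p) ≡ p ℚ.* ((s ℚ.+ t ℚ.* d) ℚ.- t)
  ring = solve 4 (λ s t p d → s :* p :- t :* ((con 1ℚ :- d) :* p) := p :* ((s :+ t :* d) :- t)) refl

-- Serves to bound the truncation probability: `(1 - δ) ^ j` is at most `1 / b` as soon as `j * δ`
-- reaches a logarithm of `b`.
exp-below : ∀ m j {a δ b} → 0ℚ ℚ.≤ a → 0ℚ ℚ.≤ δ → δ ℚ.≤ 1ℚ → a ℚ.≤ ℕ→ℚ j ℚ.* δ → b ℚ.≤ expSum a (suc m) →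
            b ℚ.* (1ℚ ℚ.- δ) ^ j ℚ.≤ 1ℚ
exp-below m j {a} {δ} 0≤a 0≤δ δ≤1 a≤jδ b≤exp = ℚₚ.≤-trans
  (*-monoˡ ((1ℚ ℚ.- δ) ^ j) (0≤^ j (0≤diff δ≤1)) (ℚₚ.≤-trans b≤exp (expSum-mono (suc m) 0≤a a≤jδ)))
  (expSum-upper m j 0≤δ δ≤1)

-- The contrapositive of `exp-below`: a lower bound on a logarithm, verified by computing one power.
exp-exceeds : ∀ m j {a δ b b′} → 0ℚ ℚ.≤ a → 0ℚ ℚ.≤ δ → δ ℚ.≤ 1ℚ → 1ℚ ℚ.< b′ ℚ.* (1ℚ ℚ.- δ) ^ j → b′ ℚ.≤ b →
              b ℚ.≤ expSum a (suc m) → ℕ→ℚ j ℚ.* δ ℚ.≤ a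
exp-exceeds m j {a} {δ} 0≤a 0≤δ δ≤1 1<b′ b′≤b b≤exp with ℚₚ.≤-total (ℕ→ℚ j ℚ.* δ) a
... | inj₁ le = le
... | inj₂ ge = contradiction (ℚₚ.<-≤-trans 1<b′ (ℚₚ.≤-trans (*-monoˡ ((1ℚ ℚ.- δ) ^ j) (0≤^ j (0≤diff δ≤1)) b′≤b)
  (exp-below m j 0≤a 0≤δ δ≤1 ge b≤exp))) (ℚₚ.<-irrefl refl)

-- These are the two leading terms of the binomial expansion of `(a + h) ^ (k + 1) / (k + 1)!`. The
-- factorials cancel through `vanish₁` and `vanish₂`.
expTerm-growth : ∀ k {a h} → 0ℚ ℚ.≤ a → 0ℚ ℚ.≤ h →
  expTerm a (suc k) ℚ.+ expTerm a k ℚ.* h ℚ.≤ expTerm (a ℚ.+ h) (suc k)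
expTerm-growth zero {a} {h} 0≤a 0≤h = ℚₚ.≤-reflexive (ring a h)
  where
  ring : ∀ a h → 1ℚ ℚ.* (a ℚ.* 1ℚ) ℚ.+ 1ℚ ℚ.* h ≡ 1ℚ ℚ.* ((a ℚ.+ h) ℚ.* 1ℚ)
  ring = solve 2 (λ a h → con 1ℚ :* (a :* con 1ℚ) :+ con 1ℚ :* h := con 1ℚ :* ((a :+ h) :* con 1ℚ)) refl
expTerm-growth (suc k) {a} {h} 0≤a 0≤h = certify d
  (0≤+ (0≤* (0≤diff (expTerm-growth k 0≤a 0≤h)) (0≤* (0≤+ 0≤a 0≤h) 0≤s)) (0≤* (0≤expTerm k 0≤a) (0≤* (0≤* 0≤h 0≤h) 0≤s)))
  (trans (ring u T′ a h r s m) (trans (cong₂ (λ v w → (d ℚ.- (u ℚ.* a ℚ.* s ℚ.* h) ℚ.* v) ℚ.- (u ℚ.* (a ℚ.* r) ℚ.* h) ℚ.* w) vanish₁ vanish₂)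
    (ring′ d (u ℚ.* a ℚ.* s ℚ.* h) (u ℚ.* (a ℚ.* r) ℚ.* h))))
  where
  u = expTerm a k
  T′ = expTerm (a ℚ.+ h) (suc k)
  r = 1/suc k
  s = 1/suc (suc k)
  m = ℕ→ℚ (suc k)
  0≤s = ℚₚ.<⇒≤ (0<1/suc (suc k))
  d = (T′ ℚ.- (u ℚ.* (a ℚ.* r) ℚ.+ u ℚ.* h)) ℚ.* ((a ℚ.+ h) ℚ.* s) ℚ.+ u ℚ.* ((h ℚ.* h) ℚ.* s)
  vanish₁ : r ℚ.* m ℚ.- 1ℚ ≡ 0ℚ
  vanish₁ = trans (cong (ℚ._- 1ℚ) (1/suc-inverse k)) (ℚₚ.+-inverseʳ 1ℚ)
  vanish₂ : 1ℚ ℚ.- s ℚ.* (m ℚ.+ 1ℚ) ≡ 0ℚ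
  vanish₂ = trans (cong (λ j → 1ℚ ℚ.- s ℚ.* j) (sym (ℕ→ℚ-suc (suc k))))
                  (trans (cong (λ j → 1ℚ ℚ.- j) (1/suc-inverse (suc k))) (ℚₚ.+-inverseʳ 1ℚ))
  ring′ : ∀ d x y → (d ℚ.- x ℚ.* 0ℚ) ℚ.- y ℚ.* 0ℚ ≡ d
  ring′ = solve 3 (λ d x y → (d :- x :* con 0ℚ) :- y :* con 0ℚ := d) refl
  ring : ∀ u T a h r s m →
    T ℚ.* ((a ℚ.+ h) ℚ.* s) ℚ.- (u ℚ.* (a ℚ.* r) ℚ.* (a ℚ.* s) ℚ.+ u ℚ.* (a ℚ.* r) ℚ.* h) ≡
    (((T ℚ.- (u ℚ.* (a ℚ.* r) ℚ.+ u ℚ.* h)) ℚ.* ((a ℚ.+ h) ℚ.* s) ℚ.+ u ℚ.* ((h ℚ.* h) ℚ.* s))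
      ℚ.- (u ℚ.* a ℚ.* s ℚ.* h) ℚ.* (r ℚ.* m ℚ.- 1ℚ)) ℚ.- (u ℚ.* (a ℚ.* r) ℚ.* h) ℚ.* (1ℚ ℚ.- s ℚ.* (m ℚ.+ 1ℚ))
  ring = solve 7 (λ u T a h r s m →
    T :* ((a :+ h) :* s) :- (u :* (a :* r) :* (a :* s) :+ u :* (a :* r) :* h) :=
    (((T :- (u :* (a :* r) :+ u :* h)) :* ((a :+ h) :* s) :+ u :* ((h :* h) :* s))
      :- (u :* a :* s :* h) :* (r :* m :- con 1ℚ)) :- (u :* (a :* r) :* h) :* (con 1ℚ :- s :* (m :+ con 1ℚ))) refl

expSum-growth : ∀ m {a h} → 0ℚ ℚ.≤ a → 0ℚ ℚ.≤ h →
  expSum a (suc m) ℚ.+ expSum a m ℚ.* h ℚ.≤ expSum (a ℚ.+ h) (suc m)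
expSum-growth zero {a} {h} 0≤a 0≤h = ℚₚ.≤-reflexive (ring a h)
  where
  ring : ∀ a h → (1ℚ ℚ.+ 1ℚ ℚ.* (a ℚ.* 1ℚ)) ℚ.+ 1ℚ ℚ.* h ≡ 1ℚ ℚ.+ 1ℚ ℚ.* ((a ℚ.+ h) ℚ.* 1ℚ)
  ring = solve 2 (λ a h → (con 1ℚ :+ con 1ℚ :* (a :* con 1ℚ)) :+ con 1ℚ :* h := con 1ℚ :+ con 1ℚ :* ((a :+ h) :* con 1ℚ)) refl
expSum-growth (suc m) {a} {h} 0≤a 0≤h = subst (ℚ._≤ expSum (a ℚ.+ h) (suc (suc m)))
  (ring (expSum a (suc m)) (expSum a m) (expTerm a (suc (suc m))) (expTerm a (suc m)) h)
  (ℚₚ.+-mono-≤ (expSum-growth m 0≤a 0≤h) (expTerm-growth (suc m) 0≤a 0≤h))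
  where
  ring : ∀ s S t T h → (s ℚ.+ S ℚ.* h) ℚ.+ (t ℚ.+ T ℚ.* h) ≡ (s ℚ.+ t) ℚ.+ (S ℚ.+ T) ℚ.* h
  ring = solve 5 (λ s S t T h → (s :+ S :* h) :+ (t :+ T :* h) := (s :+ t) :+ (S :+ T) :* h) refl

-- (1 + h) ^ j ≤ e ^ (j h)
expSum-lower : ∀ j m {h} → 0ℚ ℚ.≤ h → (1ℚ ℚ.+ h) ^ j ℚ.≤ expSum (ℕ→ℚ j ℚ.* h) (j ℕ.+ m)
expSum-lower zero m {h} 0≤h = ℚₚ.≤-reflexive (sym (trans (cong (λ q → expSum q m) (ℚₚ.*-zeroˡ h)) (expSum-base m)))
expSum-lower (suc j) m {h} 0≤h = begin
  (1ℚ ℚ.+ h) ℚ.* (1ℚ ℚ.+ h) ^ j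
    ≤⟨ *-monoʳ (1ℚ ℚ.+ h) (0≤1+ 0≤h) (expSum-lower j m 0≤h) ⟩
  (1ℚ ℚ.+ h) ℚ.* expSum a i
    ≡⟨ ring h (expSum a i) ⟩
  expSum a i ℚ.+ expSum a i ℚ.* h
    ≤⟨ ℚₚ.+-monoˡ-≤ (expSum a i ℚ.* h) (expSum-increasing 0≤a (ℕₚ.n≤1+n i)) ⟩
  expSum a (suc i) ℚ.+ expSum a i ℚ.* h
    ≤⟨ expSum-growth i 0≤a 0≤h ⟩
  expSum (a ℚ.+ h) (suc i)
    ≡⟨ cong (λ q → expSum q (suc i)) (trans (cong (ℚ._* h) (ℕ→ℚ-suc j)) (ring′ (ℕ→ℚ j) h)) ⟨
  expSum (ℕ→ℚ (suc j) ℚ.* h) (suc i) ∎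
  where
  open ℚₚ.≤-Reasoning
  a = ℕ→ℚ j ℚ.* h
  i = j ℕ.+ m
  0≤a = 0≤* (0≤ℕ→ℚ j) 0≤h
  ring : ∀ h e → (1ℚ ℚ.+ h) ℚ.* e ≡ e ℚ.+ e ℚ.* h
  ring = solve 2 (λ h e → (con 1ℚ :+ h) :* e := e :+ e :* h) refl
  ring′ : ∀ j h → (j ℚ.+ 1ℚ) ℚ.* h ≡ j ℚ.* h ℚ.+ h
  ring′ = solve 2 (λ j h → (j :+ con 1ℚ) :* h := j :* h :+ h) refl

0≤geometricSum : ∀ t {q} → 0ℚ ℚ.≤ q → 0ℚ ℚ.≤ geometricSum q t
0≤geometricSum zero    0≤q = ℚₚ.≤-refl
0≤geometricSum (suc t) 0≤q = 0≤+ (0≤geometricSum t 0≤q) (0≤^ t 0≤q)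

geometricSum-bound : ∀ t {q} → 0ℚ ℚ.≤ q → geometricSum q t ℚ.* (1ℚ ℚ.- q) ℚ.≤ 1ℚ
geometricSum-bound t {q} 0≤q = certify (q ^ t) (0≤^ t 0≤q) (telescope t)
  where
  ring₀ : ∀ q → 1ℚ ℚ.- 0ℚ ℚ.* (1ℚ ℚ.- q) ≡ 1ℚ
  ring₀ = solve 1 (λ q → con 1ℚ :- con 0ℚ :* (con 1ℚ :- q) := con 1ℚ) refl
  ring : ∀ g p q → 1ℚ ℚ.- (g ℚ.+ p) ℚ.* (1ℚ ℚ.- q) ≡ (1ℚ ℚ.- g ℚ.* (1ℚ ℚ.- q)) ℚ.- p ℚ.* (1ℚ ℚ.- q)
  ring = solve 3 (λ g p q → con 1ℚ :- (g :+ p) :* (con 1ℚ :- q) := (con 1ℚ :- g :* (con 1ℚ :- q)) :- p :* (con 1ℚ :- q)) refl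
  ring′ : ∀ p q → p ℚ.- p ℚ.* (1ℚ ℚ.- q) ≡ q ℚ.* p
  ring′ = solve 2 (λ p q → p :- p :* (con 1ℚ :- q) := q :* p) refl
  telescope : ∀ t → 1ℚ ℚ.- geometricSum q t ℚ.* (1ℚ ℚ.- q) ≡ q ^ t
  telescope zero    = ring₀ q
  telescope (suc t) = trans (ring (geometricSum q t) (q ^ t) q)
    (trans (cong (ℚ._- q ^ t ℚ.* (1ℚ ℚ.- q)) (telescope t)) (ring′ (q ^ t) q))

abstract

  -- `P 0` is never tested; 0 is also the answer when nothing is found, whence the extra case of
  -- `largest-holds`.
  largest : {P : ℕ → Set} → (∀ m → Dec (P m)) → ℕ → ℕ
  largest P? zero = 0
  largest P? (suc m) with P? (suc m)
  ... | yes _ = suc m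
  ... | no  _ = largest P? m

  largest-holds : {P : ℕ → Set} (P? : ∀ m → Dec (P m)) → ∀ m → largest P? m ≡ 0 ⊎ P (largest P? m)
  largest-holds P? zero = inj₁ refl
  largest-holds P? (suc m) with P? (suc m)
  ... | yes p = inj₂ p
  ... | no  _ = largest-holds P? m

  largest-≤ : {P : ℕ → Set} (P? : ∀ m → Dec (P m)) → ∀ m → largest P? m ℕ.≤ m
  largest-≤ P? zero = ℕ.z≤n
  largest-≤ P? (suc m) with P? (suc m)
  ... | yes _ = ℕₚ.≤-refl
  ... | no  _ = ℕₚ.m≤n⇒m≤1+n (largest-≤ P? m)

  largest-maximal : {P : ℕ → Set} (P? : ∀ m → Dec (P m)) → ∀ m → largest P? m ≡ m ⊎ ¬ P (suc (largest P? m))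
  largest-maximal P? zero = inj₁ refl
  largest-maximal {P} P? (suc m) with P? (suc m)
  ... | yes _ = inj₁ refl
  ... | no ¬p with largest-maximal P? m
  ...   | inj₁ eq  = inj₂ (subst (λ j → ¬ P (suc j)) (sym eq) ¬p)
  ...   | inj₂ ¬p′ = inj₂ ¬p′

-- Numerical verification of the failure bound

_/1000 : ℕ → ℚ
m /1000 = ℤ.+ m ℚ./ 1000

0≤_/1000 : ∀ m → 0ℚ ℚ.≤ m /1000
0≤ m /1000 = ℚₚ.nonNegative⁻¹ _ {{ℚₚ.normalize-nonNeg m 1000}}

0<_/1000 : ∀ m .{{_ : NonZero m}} → 0ℚ ℚ.< m /1000
0< m /1000 = ℚₚ.positive⁻¹ _ {{ℚₚ.normalize-pos m 1000}}

-- The heart of the analysis, for approximations c, x, l of the parameter c, of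
-- (c n) ^ (1 / λ) and of ln (c n) within s of the truth, and with ĉ close to c.
-- The probability q of a bad trial is slightly more than 1 / x.
module Tuning (lam-1 m k : ℕ) (c ĉ n q β x l s : ℚ)
  (3≤c : 3000 /1000 ℚ.≤ c) (c≤ĉ : c ℚ.≤ ĉ) (ĉ≤c+ : ĉ ℚ.≤ c ℚ.+ 2 /1000)
  (n-large : (2600 /1000) ^ suc lam-1 ℚ.≤ n)
  (0≤l : 0ℚ ℚ.≤ l) (0≤s : 0ℚ ℚ.≤ s) (cn≤exp : c ℚ.* n ℚ.≤ expSum (l ℚ.+ s) (suc m))
  (lam≤l : ℕ→ℚ (suc lam-1) ℚ.≤ (l ℚ.+ s) ℚ.+ 1 /1000)
  (1≤x : 1ℚ ℚ.≤ x) (x≤cn : x ℚ.≤ c ℚ.* n) (cn≤x^ : c ℚ.* n ℚ.≤ (x ℚ.+ s) ^ suc lam-1)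
  (0≤q : 0ℚ ℚ.≤ q) (q≤1 : q ℚ.≤ 1ℚ) (0≤β : 0ℚ ℚ.≤ β)
  (q-small : q ^ suc lam-1 ℚ.* (ĉ ℚ.* n) ℚ.≤ 1370 /1000)
  (q-large : 1370 /1000 ℚ.< (q ℚ.+ β) ^ suc lam-1 ℚ.* (ĉ ℚ.* n))
  (β-small : β ℚ.* (ĉ ℚ.* n ℚ.+ 1ℚ) ℚ.≤ 5 /1000 ℚ.* 1/suc lam-1)
  (s-small : s ℚ.≤ 1 /1000 ℚ.* 1/suc lam-1)
  (xl≤k : x ℚ.* l ℚ.≤ ℕ→ℚ k ℚ.+ 1002 /1000)
  where

  open ℚₚ.≤-Reasoning

  lam : ℕ
  lam = suc lam-1

  i : ℚ
  i = 1/suc lam-1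

  0≤i : 0ℚ ℚ.≤ i
  0≤i = ℚₚ.<⇒≤ (0<1/suc lam-1)

  i≤1 : i ℚ.≤ 1ℚ
  i≤1 = begin
    i                        ≡⟨ ℚₚ.*-identityʳ i ⟨
    i ℚ.* 1ℚ                 ≤⟨ *-monoʳ i 0≤i (ℕ→ℚ-mono {1} {lam} (ℕ.s≤s ℕ.z≤n)) ⟩
    i ℚ.* ℕ→ℚ lam            ≡⟨ 1/suc-inverse lam-1 ⟩
    1ℚ                       ∎

  s≤ : s ℚ.≤ 1 /1000
  s≤ = ℚₚ.≤-trans s-small (subst (1 /1000 ℚ.* i ℚ.≤_) (ℚₚ.*-identityʳ (1 /1000)) (*-monoʳ (1 /1000) (0≤ 1 /1000) i≤1))

  0≤c : 0ℚ ℚ.≤ c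
  0≤c = ℚₚ.≤-trans (0≤ 3000 /1000) 3≤c

  0≤E^ : 0ℚ ℚ.≤ (2600 /1000) ^ lam
  0≤E^ = 0≤^ lam (0≤ 2600 /1000)

  0≤n : 0ℚ ℚ.≤ n
  0≤n = ℚₚ.≤-trans 0≤E^ n-large

  3E^≤cn : 3000 /1000 ℚ.* (2600 /1000) ^ lam ℚ.≤ c ℚ.* n
  3E^≤cn = *-mono-≤ 0≤c 0≤E^ 3≤c n-large

  cn≥ : 7800 /1000 ℚ.≤ c ℚ.* n
  cn≥ = ℚₚ.≤-trans (from-yes (7800 /1000 ℚₚ.≤? 3000 /1000 ℚ.* 2600 /1000)) (ℚₚ.≤-trans (*-monoʳ (3000 /1000) (0≤ 3000 /1000)
    (a≤a^suc lam-1 (from-yes (1ℚ ℚₚ.≤? 2600 /1000)))) 3E^≤cn)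

  cn≤ĉn : c ℚ.* n ℚ.≤ ĉ ℚ.* n
  cn≤ĉn = *-monoˡ n 0≤n c≤ĉ

  0≤ĉn : 0ℚ ℚ.≤ ĉ ℚ.* n
  0≤ĉn = ℚₚ.≤-trans (0≤* 0≤c 0≤n) cn≤ĉn

  -- As `c ≥ 3`, the error 2 / 1000 of `ĉ` is at most the fraction 1 / 1500 of `c`.
  ρ : ℚ
  ρ = ℤ.+ 1501 ℚ./ 1500

  0≤ρ : 0ℚ ℚ.≤ ρ
  0≤ρ = from-yes (0ℚ ℚₚ.≤? ρ)

  ĉn≤ρcn : ĉ ℚ.* n ℚ.≤ ρ ℚ.* (c ℚ.* n)
  ĉn≤ρcn = subst (ĉ ℚ.* n ℚ.≤_) (ℚₚ.*-assoc ρ c n) (*-monoˡ n 0≤n (ℚₚ.≤-trans {j = c ℚ.+ 2 /1000} {k = ρ ℚ.* c} ĉ≤c+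
    (certify ((c ℚ.- 3000 /1000) ℚ.* (ℤ.+ 1 ℚ./ 1500)) (0≤* (0≤diff 3≤c) (from-yes (0ℚ ℚₚ.≤? ℤ.+ 1 ℚ./ 1500))) (ring c))))
    where
    ring : ∀ c → ρ ℚ.* c ℚ.- (c ℚ.+ 2 /1000) ≡ (c ℚ.- 3000 /1000) ℚ.* (ℤ.+ 1 ℚ./ 1500)
    ring = solve 1 (λ c → con ρ :* c :- (c :+ con (2 /1000)) := (c :- con (3000 /1000)) :* con (ℤ.+ 1 ℚ./ 1500)) refl

  -- Nineteen steps of length 1 / 10 suffice because 7.8 · 0.9 ^ 19 > 1.
  l+s≥ : 1900 /1000 ℚ.≤ l ℚ.+ s
  l+s≥ = ℚₚ.≤-trans (from-yes (1900 /1000 ℚₚ.≤? ℕ→ℚ 19 ℚ.* 100 /1000))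
    (exp-exceeds m 19 {δ = 100 /1000} {b′ = 7800 /1000} (0≤+ 0≤l 0≤s) (0≤ 100 /1000) (from-yes (100 /1000 ℚₚ.≤? 1ℚ))
      (from-yes (1ℚ ℚₚ.<? 7800 /1000 ℚ.* (1ℚ ℚ.- 100 /1000) ^ 19)) cn≥ cn≤exp)

  5/13 : ℚ
  5/13 = ℤ.+ 5 ℚ./ 13

  -- The constant satisfies 2.6 · 5 / 13 = 1. As c n ≥ 3 · 2.6 ^ λ, a larger `q` would make q ^ λ c
  -- n at least 3, against the 1.37 of `q-small`.
  q≤ : q ℚ.≤ 5/13
  q≤ = ℚₚ.≮⇒≥ λ q> → ℚₚ.<-irrefl refl (ℚₚ.≤-<-trans (begin
      3000 /1000
        ≡⟨ ℚₚ.*-identityʳ (3000 /1000) ⟨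
      3000 /1000 ℚ.* 1ℚ
        ≤⟨ *-monoʳ (3000 /1000) (0≤ 3000 /1000) (1≤^ lam (ℚₚ.≤-trans (from-yes (1ℚ ℚₚ.≤? 5/13 ℚ.* 2600 /1000)) (*-monoˡ (2600 /1000) (0≤ 2600 /1000) (ℚₚ.<⇒≤ q>)))) ⟩
      3000 /1000 ℚ.* (q ℚ.* 2600 /1000) ^ lam
        ≡⟨ trans (cong (3000 /1000 ℚ.*_) (^-distrib-* lam q (2600 /1000))) (ring (3000 /1000) (q ^ lam) ((2600 /1000) ^ lam)) ⟩
      q ^ lam ℚ.* (3000 /1000 ℚ.* (2600 /1000) ^ lam)
        ≤⟨ *-monoʳ (q ^ lam) (0≤^ lam 0≤q) (ℚₚ.≤-trans 3E^≤cn cn≤ĉn) ⟩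
      q ^ lam ℚ.* (ĉ ℚ.* n)
        ≤⟨ q-small ⟩
      1370 /1000 ∎) (from-yes (1370 /1000 ℚₚ.<? 3000 /1000)))
    where
    ring : ∀ a b c → a ℚ.* (b ℚ.* c) ≡ b ℚ.* (a ℚ.* c)
    ring = solve 3 (λ a b c → a :* (b :* c) := b :* (a :* c)) refl

  0≤x : 0ℚ ℚ.≤ x
  0≤x = ℚₚ.≤-trans 0≤1 1≤x

  -- The budget 1.37 is worth a factor 1 + 0.26 / λ in `q`: by `bernoulli`, (1 + 0.26 / λ) ^ λ ·
  -- 0.74 ≤ 1, while 1.37 · 0.74 still exceeds `ρ`.
  [q+β][x+s]≥ : 1ℚ ℚ.+ 260 /1000 ℚ.* i ℚ.≤ (q ℚ.+ β) ℚ.* (x ℚ.+ s)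
  [q+β][x+s]≥ = ℚₚ.≮⇒≥ λ lt → ℚₚ.<-asym (from-yes (ρ ℚ.* 1ℚ ℚₚ.<? 1370 /1000 ℚ.* 740 /1000)) (begin-strict
      1370 /1000 ℚ.* 740 /1000
        <⟨ ℚₚ.*-monoˡ-<-pos (740 /1000) q-large ⟩
      (q ℚ.+ β) ^ lam ℚ.* (ĉ ℚ.* n) ℚ.* 740 /1000
        ≤⟨ *-monoˡ (740 /1000) (0≤ 740 /1000) (*-monoʳ ((q ℚ.+ β) ^ lam) (0≤^ lam (0≤+ 0≤q 0≤β))
             (ℚₚ.≤-trans ĉn≤ρcn (*-monoʳ ρ 0≤ρ cn≤x^))) ⟩
      (q ℚ.+ β) ^ lam ℚ.* (ρ ℚ.* (x ℚ.+ s) ^ lam) ℚ.* 740 /1000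
        ≡⟨ ring ((q ℚ.+ β) ^ lam) ρ ((x ℚ.+ s) ^ lam) (740 /1000) ⟩
      ρ ℚ.* ((q ℚ.+ β) ^ lam ℚ.* (x ℚ.+ s) ^ lam ℚ.* 740 /1000)
        ≡⟨ cong (λ w → ρ ℚ.* (w ℚ.* 740 /1000)) (^-distrib-* lam (q ℚ.+ β) (x ℚ.+ s)) ⟨
      ρ ℚ.* (((q ℚ.+ β) ℚ.* (x ℚ.+ s)) ^ lam ℚ.* 740 /1000)
        ≤⟨ *-monoʳ ρ 0≤ρ (*-monoˡ (740 /1000) (0≤ 740 /1000) (^-mono lam (0≤* (0≤+ 0≤q 0≤β) (0≤+ 0≤x 0≤s)) (ℚₚ.<⇒≤ lt))) ⟩
      ρ ℚ.* ((1ℚ ℚ.+ 260 /1000 ℚ.* i) ^ lam ℚ.* 740 /1000)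
        ≡⟨ cong (λ w → ρ ℚ.* ((1ℚ ℚ.+ 260 /1000 ℚ.* i) ^ lam ℚ.* w)) 740≡ ⟩
      ρ ℚ.* ((1ℚ ℚ.+ 260 /1000 ℚ.* i) ^ lam ℚ.* (1ℚ ℚ.- ℕ→ℚ lam ℚ.* (260 /1000 ℚ.* i)))
        ≤⟨ *-monoʳ ρ 0≤ρ (bernoulli lam (0≤* (0≤ 260 /1000) 0≤i)) ⟩
      ρ ℚ.* 1ℚ ∎)
    where
    ring : ∀ a r b c → a ℚ.* (r ℚ.* b) ℚ.* c ≡ r ℚ.* (a ℚ.* b ℚ.* c)
    ring = solve 4 (λ a r b c → a :* (r :* b) :* c := r :* (a :* b :* c)) refl
    ring′ : ∀ a b i → a ℚ.* (b ℚ.* i) ≡ b ℚ.* (i ℚ.* a)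
    ring′ = solve 3 (λ a b i → a :* (b :* i) := b :* (i :* a)) refl
    740≡ : 740 /1000 ≡ 1ℚ ℚ.- ℕ→ℚ lam ℚ.* (260 /1000 ℚ.* i)
    740≡ = sym (trans (cong (λ a → 1ℚ ℚ.- a) (trans (ring′ (ℕ→ℚ lam) (260 /1000) i) (cong (260 /1000 ℚ.*_) (1/suc-inverse lam-1)))) (from-yes (1ℚ ℚ.- 260 /1000 ℚ.* 1ℚ ℚₚ.≟ 740 /1000)))

  -- The dyadic grid and the approximation of the root cost at most 0.01 / λ, by `β-small` and
  -- `s-small`.
  qx≥ : 1ℚ ℚ.+ 250 /1000 ℚ.* i ℚ.≤ q ℚ.* x
  qx≥ = certify
    (((q ℚ.+ β) ℚ.* (x ℚ.+ s) ℚ.- (1ℚ ℚ.+ 260 /1000 ℚ.* i)) ℚ.+ (5 /1000 ℚ.* i ℚ.- β ℚ.* (ĉ ℚ.* n ℚ.+ 1ℚ))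
      ℚ.+ β ℚ.* (ĉ ℚ.* n ℚ.- x) ℚ.+ β ℚ.* (1ℚ ℚ.- s) ℚ.+ (1ℚ ℚ.- q) ℚ.* s ℚ.+ (1 /1000 ℚ.* i ℚ.- s) ℚ.+ 4 /1000 ℚ.* i)
    (0≤+ (0≤+ (0≤+ (0≤+ (0≤+ (0≤+ (0≤diff [q+β][x+s]≥) (0≤diff β-small)) (0≤* 0≤β (0≤diff (ℚₚ.≤-trans x≤cn cn≤ĉn))))
      (0≤* 0≤β (0≤diff (ℚₚ.≤-trans s≤ (from-yes (1 /1000 ℚₚ.≤? 1ℚ)))))) (0≤* (0≤diff q≤1) 0≤s)) (0≤diff s-small)) (0≤* (0≤ 4 /1000) 0≤i))
    (ring q β x s i (ĉ ℚ.* n))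
    where
    ring : ∀ q β x s i h → q ℚ.* x ℚ.- (1ℚ ℚ.+ 250 /1000 ℚ.* i) ≡
      ((q ℚ.+ β) ℚ.* (x ℚ.+ s) ℚ.- (1ℚ ℚ.+ 260 /1000 ℚ.* i)) ℚ.+ (5 /1000 ℚ.* i ℚ.- β ℚ.* (h ℚ.+ 1ℚ))
      ℚ.+ β ℚ.* (h ℚ.- x) ℚ.+ β ℚ.* (1ℚ ℚ.- s) ℚ.+ (1ℚ ℚ.- q) ℚ.* s ℚ.+ (1 /1000 ℚ.* i ℚ.- s) ℚ.+ 4 /1000 ℚ.* i
    ring = solve 6 (λ q β x s i h → q :* x :- (con 1ℚ :+ con (250 /1000) :* i) :=
      ((q :+ β) :* (x :+ s) :- (con 1ℚ :+ con (260 /1000) :* i)) :+ (con (5 /1000) :* i :- β :* (h :+ con 1ℚ))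
      :+ β :* (h :- x) :+ β :* (con 1ℚ :- s) :+ (con 1ℚ :- q) :* s :+ (con (1 /1000) :* i :- s) :+ con (4 /1000) :* i) refl

  il≥ : 998 /1000 ℚ.≤ i ℚ.* l
  il≥ = certify (i ℚ.* (((l ℚ.+ s) ℚ.+ 1 /1000) ℚ.- ℕ→ℚ lam) ℚ.+ i ℚ.* (1 /1000 ℚ.- s) ℚ.+ 2 /1000 ℚ.* (1ℚ ℚ.- i))
    (0≤+ (0≤+ (0≤* 0≤i (0≤diff lam≤l)) (0≤* 0≤i (0≤diff s≤))) (0≤* (0≤ 2 /1000) (0≤diff i≤1)))
    (trans (ring i l s (ℕ→ℚ lam)) (trans (cong (λ w → d ℚ.+ (w ℚ.- 1ℚ)) (1/suc-inverse lam-1)) (ring′ d)))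
    where
    d = i ℚ.* (((l ℚ.+ s) ℚ.+ 1 /1000) ℚ.- ℕ→ℚ lam) ℚ.+ i ℚ.* (1 /1000 ℚ.- s) ℚ.+ 2 /1000 ℚ.* (1ℚ ℚ.- i)
    ring′ : ∀ d → d ℚ.+ (1ℚ ℚ.- 1ℚ) ≡ d
    ring′ = solve 1 (λ d → d :+ (con 1ℚ :- con 1ℚ) := d) refl
    ring : ∀ i l s Λ → i ℚ.* l ℚ.- 998 /1000 ≡
      (i ℚ.* (((l ℚ.+ s) ℚ.+ 1 /1000) ℚ.- Λ) ℚ.+ i ℚ.* (1 /1000 ℚ.- s) ℚ.+ 2 /1000 ℚ.* (1ℚ ℚ.- i)) ℚ.+ (i ℚ.* Λ ℚ.- 1ℚ)
    ring = solve 4 (λ i l s Λ → i :* l :- con (998 /1000) :=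
      (i :* (((l :+ s) :+ con (1 /1000)) :- Λ) :+ i :* (con (1 /1000) :- s) :+ con (2 /1000) :* (con 1ℚ :- i)) :+ (i :* Λ :- con 1ℚ)) refl

  -- (1 - δ) ^ 2 is at least 1 - q, and 2 δ exceeds q by q ^ 2 / 4.
  δ : ℚ
  δ = q ℚ.* 500 /1000 ℚ.+ q ℚ.* q ℚ.* 125 /1000

  0≤δ : 0ℚ ℚ.≤ δ
  0≤δ = 0≤+ (0≤* 0≤q (0≤ 500 /1000)) (0≤* (0≤* 0≤q 0≤q) (0≤ 125 /1000))

  δ≤1 : δ ℚ.≤ 1ℚ
  δ≤1 = certify ((1ℚ ℚ.- q) ℚ.* 500 /1000 ℚ.+ (1ℚ ℚ.- q) ℚ.* (1ℚ ℚ.+ q) ℚ.* 125 /1000 ℚ.+ 375 /1000)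
    (0≤+ (0≤+ (0≤* (0≤diff q≤1) (0≤ 500 /1000)) (0≤* (0≤* (0≤diff q≤1) (0≤1+ 0≤q)) (0≤ 125 /1000))) (0≤ 375 /1000))
    (ring q)
    where
    ring : ∀ q → 1ℚ ℚ.- (q ℚ.* 500 /1000 ℚ.+ q ℚ.* q ℚ.* 125 /1000) ≡
      (1ℚ ℚ.- q) ℚ.* 500 /1000 ℚ.+ (1ℚ ℚ.- q) ℚ.* (1ℚ ℚ.+ q) ℚ.* 125 /1000 ℚ.+ 375 /1000
    ring = solve 1 (λ q → con 1ℚ :- (q :* con (500 /1000) :+ q :* q :* con (125 /1000)) :=
      (con 1ℚ :- q) :* con (500 /1000) :+ (con 1ℚ :- q) :* (con 1ℚ :+ q) :* con (125 /1000) :+ con (375 /1000)) refl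

  1-q≤ : 1ℚ ℚ.- q ℚ.≤ (1ℚ ℚ.- δ) ℚ.* (1ℚ ℚ.- δ)
  1-q≤ = certify (q ℚ.* q ℚ.* q ℚ.* 125 /1000 ℚ.+ (q ℚ.* q ℚ.* 125 /1000) ℚ.* (q ℚ.* q ℚ.* 125 /1000))
    (0≤+ (0≤* (0≤* (0≤* 0≤q 0≤q) 0≤q) (0≤ 125 /1000)) (0≤* (0≤* (0≤* 0≤q 0≤q) (0≤ 125 /1000)) (0≤* (0≤* 0≤q 0≤q) (0≤ 125 /1000))))
    (ring q)
    where
    ring : ∀ q → (1ℚ ℚ.- (q ℚ.* 500 /1000 ℚ.+ q ℚ.* q ℚ.* 125 /1000)) ℚ.* (1ℚ ℚ.- (q ℚ.* 500 /1000 ℚ.+ q ℚ.* q ℚ.* 125 /1000)) ℚ.- (1ℚ ℚ.- q) ≡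
      q ℚ.* q ℚ.* q ℚ.* 125 /1000 ℚ.+ (q ℚ.* q ℚ.* 125 /1000) ℚ.* (q ℚ.* q ℚ.* 125 /1000)
    ring = solve 1 (λ q → (con 1ℚ :- (q :* con (500 /1000) :+ q :* q :* con (125 /1000))) :* (con 1ℚ :- (q :* con (500 /1000) :+ q :* q :* con (125 /1000))) :- (con 1ℚ :- q) :=
      q :* q :* q :* con (125 /1000) :+ (q :* q :* con (125 /1000)) :* (q :* q :* con (125 /1000))) refl

  -- The value at `q = 5/13` of the decreasing polynomial 0.2485 - 0.52725 q - 0.2505 q ^ 2, which
  -- is what the gains leave after the rounding loss. It is positive by a narrow margin.
  rest : ℚ
  rest = ℤ.+ 24850 ℚ./ 100000 ℚ.- ℤ.+ 52725 ℚ./ 100000 ℚ.* 5/13 ℚ.- ℤ.+ 25050 ℚ./ 100000 ℚ.* (5/13 ℚ.* 5/13)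

  -- Here 2 δ = q (1 + q / 4) and k ≥ x l - 1.002. The surplus i / 4 of `q * x` gains about 1 / 4,
  -- since i l is nearly 1 or more, and the factor 1 + q / 4 gains nearly 0.475 q, since l + s ≥
  -- 1.9. These pay for the loss 1.002 q (1 + q / 4), with `rest` to spare.
  l+s≤2kδ : l ℚ.+ s ℚ.≤ ℕ→ℚ (k ℕ.+ k) ℚ.* δ
  l+s≤2kδ = certify d
    (0≤+ (0≤+ (0≤+ (0≤+ (0≤+ (0≤+ (0≤+
      (0≤* (0≤+ 0≤δ 0≤δ) (0≤diff xl≤k))
      (0≤* (0≤* (0≤diff qx≥) (0≤1+ (0≤* 0≤q (0≤ 250 /1000)))) 0≤l))
      (0≤* (0≤ 250 /1000) (0≤diff il≥)))
      (0≤* (0≤* 0≤q (0≤ 250 /1000)) (0≤diff l+s≥)))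
      (0≤* (0≤* 0≤i 0≤q) (0≤* 0≤l (from-yes (0ℚ ℚₚ.≤? 1/16)))))
      (0≤* (0≤diff s≤) (0≤1+ (0≤* 0≤q (0≤ 250 /1000)))))
      (0≤* (0≤diff q≤) (0≤+ (from-yes (0ℚ ℚₚ.≤? a)) (0≤* (from-yes (0ℚ ℚₚ.≤? b)) (0≤+ 0≤q (from-yes (0ℚ ℚₚ.≤? 5/13)))))))
      (from-yes (0ℚ ℚₚ.≤? rest)))
    (trans (cong (λ K → K ℚ.* δ ℚ.- (l ℚ.+ s)) (ℕ→ℚ-+ k k)) (ring (ℕ→ℚ k) q x l s i))
    where
    1/16 = ℤ.+ 1 ℚ./ 16
    a = ℤ.+ 52725 ℚ./ 100000
    b = ℤ.+ 25050 ℚ./ 100000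
    d = (δ ℚ.+ δ) ℚ.* ((ℕ→ℚ k ℚ.+ 1002 /1000) ℚ.- x ℚ.* l)
      ℚ.+ (q ℚ.* x ℚ.- (1ℚ ℚ.+ 250 /1000 ℚ.* i)) ℚ.* (1ℚ ℚ.+ q ℚ.* 250 /1000) ℚ.* l
      ℚ.+ 250 /1000 ℚ.* (i ℚ.* l ℚ.- 998 /1000)
      ℚ.+ q ℚ.* 250 /1000 ℚ.* (l ℚ.+ s ℚ.- 1900 /1000)
      ℚ.+ i ℚ.* q ℚ.* (l ℚ.* 1/16)
      ℚ.+ (1 /1000 ℚ.- s) ℚ.* (1ℚ ℚ.+ q ℚ.* 250 /1000)
      ℚ.+ (5/13 ℚ.- q) ℚ.* (a ℚ.+ b ℚ.* (q ℚ.+ 5/13))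
      ℚ.+ rest
    ring : ∀ k q x l s i → let δ = q ℚ.* 500 /1000 ℚ.+ q ℚ.* q ℚ.* 125 /1000 in
      (k ℚ.+ k) ℚ.* δ ℚ.- (l ℚ.+ s) ≡
      (δ ℚ.+ δ) ℚ.* ((k ℚ.+ 1002 /1000) ℚ.- x ℚ.* l)
      ℚ.+ (q ℚ.* x ℚ.- (1ℚ ℚ.+ 250 /1000 ℚ.* i)) ℚ.* (1ℚ ℚ.+ q ℚ.* 250 /1000) ℚ.* l
      ℚ.+ 250 /1000 ℚ.* (i ℚ.* l ℚ.- 998 /1000)
      ℚ.+ q ℚ.* 250 /1000 ℚ.* (l ℚ.+ s ℚ.- 1900 /1000)
      ℚ.+ i ℚ.* q ℚ.* (l ℚ.* 1/16)
      ℚ.+ (1 /1000 ℚ.- s) ℚ.* (1ℚ ℚ.+ q ℚ.* 250 /1000)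
      ℚ.+ (5/13 ℚ.- q) ℚ.* (a ℚ.+ b ℚ.* (q ℚ.+ 5/13))
      ℚ.+ rest
    ring = solve 6 (λ k q x l s i → let δ = q :* con (500 /1000) :+ q :* q :* con (125 /1000) in
      (k :+ k) :* δ :- (l :+ s) :=
      (δ :+ δ) :* ((k :+ con (1002 /1000)) :- x :* l)
      :+ (q :* x :- (con 1ℚ :+ con (250 /1000) :* i)) :* (con 1ℚ :+ q :* con (250 /1000)) :* l
      :+ con (250 /1000) :* (i :* l :- con (998 /1000))
      :+ q :* con (250 /1000) :* (l :+ s :- con (1900 /1000))
      :+ i :* q :* (l :* con 1/16)
      :+ (con (1 /1000) :- s) :* (con 1ℚ :+ q :* con (250 /1000))
      :+ (con 5/13 :- q) :* (con a :+ con b :* (q :+ con 5/13))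
      :+ con rest) refl

  cn[1-q]^k≤1 : c ℚ.* n ℚ.* (1ℚ ℚ.- q) ^ k ℚ.≤ 1ℚ
  cn[1-q]^k≤1 = begin
    c ℚ.* n ℚ.* (1ℚ ℚ.- q) ^ k
      ≤⟨ *-monoʳ (c ℚ.* n) (0≤* 0≤c 0≤n) (^-mono k (0≤diff q≤1) 1-q≤) ⟩
    c ℚ.* n ℚ.* ((1ℚ ℚ.- δ) ℚ.* (1ℚ ℚ.- δ)) ^ k
      ≡⟨ cong (c ℚ.* n ℚ.*_) (trans (^-distrib-* k (1ℚ ℚ.- δ) (1ℚ ℚ.- δ)) (sym (^-+ k k (1ℚ ℚ.- δ)))) ⟩
    c ℚ.* n ℚ.* (1ℚ ℚ.- δ) ^ (k ℕ.+ k)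
      ≤⟨ exp-below m (k ℕ.+ k) (0≤+ 0≤l 0≤s) 0≤δ δ≤1 l+s≤2kδ cn≤exp ⟩
    1ℚ ∎

  -- 1.625 is 1 / (1 - 5 / 13), the full geometric series at the largest possible `q`.
  geometricSum≤ : geometricSum q lam ℚ.≤ 1625 /1000
  geometricSum≤ = begin
    geometricSum q lam
      ≡⟨ trans (ℚₚ.*-assoc (geometricSum q lam) 8/13 (1625 /1000)) (trans
           (cong (geometricSum q lam ℚ.*_) (from-yes (8/13 ℚ.* 1625 /1000 ℚₚ.≟ 1ℚ))) (ℚₚ.*-identityʳ (geometricSum q lam))) ⟨
    geometricSum q lam ℚ.* 8/13 ℚ.* 1625 /1000
      ≤⟨ *-monoˡ (1625 /1000) (0≤ 1625 /1000) (ℚₚ.≤-trans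
           (*-monoʳ (geometricSum q lam) (0≤geometricSum lam 0≤q) (ℚₚ.+-monoʳ-≤ 1ℚ (ℚₚ.neg-antimono-≤ q≤))) (geometricSum-bound lam 0≤q)) ⟩
    1ℚ ℚ.* 1625 /1000
      ≡⟨ ℚₚ.*-identityˡ (1625 /1000) ⟩
    1625 /1000 ∎
    where
    8/13 = 1ℚ ℚ.- 5/13

  failure≤3 : (n ℚ.* q ^ lam ℚ.+ geometricSum q lam ℚ.* (n ℚ.* (1ℚ ℚ.- q) ^ k)) ℚ.* ĉ ℚ.≤ 3000 /1000
  failure≤3 = begin
    (n ℚ.* q ^ lam ℚ.+ geometricSum q lam ℚ.* (n ℚ.* (1ℚ ℚ.- q) ^ k)) ℚ.* ĉ
      ≡⟨ ring n (q ^ lam) (geometricSum q lam) ((1ℚ ℚ.- q) ^ k) ĉ ⟩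
    q ^ lam ℚ.* (ĉ ℚ.* n) ℚ.+ geometricSum q lam ℚ.* (ĉ ℚ.* n ℚ.* (1ℚ ℚ.- q) ^ k)
      ≤⟨ ℚₚ.+-mono-≤ q-small (*-mono-≤ (0≤ 1625 /1000) (0≤* 0≤ĉn 0≤[1-q]^k) geometricSum≤
           (ℚₚ.≤-trans (*-monoˡ ((1ℚ ℚ.- q) ^ k) 0≤[1-q]^k ĉn≤ρcn)
             (subst (ℚ._≤ ρ ℚ.* 1ℚ) (sym (ℚₚ.*-assoc ρ (c ℚ.* n) ((1ℚ ℚ.- q) ^ k))) (*-monoʳ ρ 0≤ρ cn[1-q]^k≤1)))) ⟩
    1370 /1000 ℚ.+ 1625 /1000 ℚ.* (ρ ℚ.* 1ℚ)
      ≤⟨ from-yes (1370 /1000 ℚ.+ 1625 /1000 ℚ.* (ρ ℚ.* 1ℚ) ℚₚ.≤? 3000 /1000) ⟩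
    3000 /1000 ∎
    where
    0≤[1-q]^k : 0ℚ ℚ.≤ (1ℚ ℚ.- q) ^ k
    0≤[1-q]^k = 0≤^ k (0≤diff q≤1)
    ring : ∀ n a g p c → (n ℚ.* a ℚ.+ g ℚ.* (n ℚ.* p)) ℚ.* c ≡ a ℚ.* (c ℚ.* n) ℚ.+ g ℚ.* (c ℚ.* n ℚ.* p)
    ring = solve 5 (λ n a g p c → (n :* a :+ g :* (n :* p)) :* c := a :* (c :* n) :+ g :* (c :* n :* p)) refl

  -- Otherwise x l ≤ 1.002, and x ≥ 1 contradicts l + s ≥ 1.9. Positivity is needed because `floor`
  -- is a lower bound only if it is positive.
  0<k : 0 ℕ.< k
  0<k = ℕₚ.n≢0⇒n>0 λ k≡0 → ℚₚ.<-irrefl refl (begin-strict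
    l ℚ.+ s                          ≤⟨ ℚₚ.+-mono-≤ (subst (ℚ._≤ x ℚ.* l) (ℚₚ.*-identityˡ l) (*-monoˡ l 0≤l 1≤x)) s≤ ⟩
    x ℚ.* l ℚ.+ 1 /1000              ≤⟨ ℚₚ.+-monoˡ-≤ (1 /1000) (subst (λ k → x ℚ.* l ℚ.≤ ℕ→ℚ k ℚ.+ 1002 /1000) k≡0 xl≤k) ⟩
    ℕ→ℚ 0 ℚ.+ 1002 /1000 ℚ.+ 1 /1000 <⟨ from-yes (ℕ→ℚ 0 ℚ.+ 1002 /1000 ℚ.+ 1 /1000 ℚₚ.<? 1900 /1000) ⟩
    1900 /1000                       ≤⟨ l+s≥ ⟩
    l ℚ.+ s                          ∎)

-- Choice of the parameters

ℕ→ℚ-* : ∀ m k → ℕ→ℚ (m ℕ.* k) ≡ ℕ→ℚ m ℚ.* ℕ→ℚ k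
ℕ→ℚ-* zero    k = sym (ℚₚ.*-zeroˡ (ℕ→ℚ k))
ℕ→ℚ-* (suc m) k = trans (ℕ→ℚ-+ k (m ℕ.* k)) (trans (cong (ℕ→ℚ k ℚ.+_) (ℕ→ℚ-* m k))
  (trans (ring (ℕ→ℚ m) (ℕ→ℚ k)) (cong (ℚ._* ℕ→ℚ k) (sym (ℕ→ℚ-suc m)))))
  where
  ring : ∀ a b → b ℚ.+ a ℚ.* b ≡ (a ℚ.+ 1ℚ) ℚ.* b
  ring = solve 2 (λ a b → b :+ a :* b := (a :+ con 1ℚ) :* b) refl

½^-inverse : ∀ b → ℕ→ℚ (2 ℕ.^ b) ℚ.* ½ ^ b ≡ 1ℚ
½^-inverse zero    = refl
½^-inverse (suc b) = trans (cong (ℚ._* ½ ^ suc b) (ℕ→ℚ-* 2 (2 ℕ.^ b)))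
  (trans (ring (ℕ→ℚ 2) (ℕ→ℚ (2 ℕ.^ b)) ½ (½ ^ b)) (cong ((ℕ→ℚ 2 ℚ.* ½) ℚ.*_) (½^-inverse b)))
  where
  ring : ∀ t a h p → (t ℚ.* a) ℚ.* (h ℚ.* p) ≡ (t ℚ.* h) ℚ.* (a ℚ.* p)
  ring = solve 4 (λ t a h p → (t :* a) :* (h :* p) := (t :* h) :* (a :* p)) refl

0≤½^ : ∀ b → 0ℚ ℚ.≤ ½ ^ b
0≤½^ b = 0≤^ b (ℚₚ.nonNegative⁻¹ ½)

-- A negative number has floor 0 here.
floor : ℚ → ℕ
floor z = largest (λ j → ℕ→ℚ j ℚₚ.≤? z) (proj₁ (archimedean z))

floor-upper : ∀ z → z ℚ.≤ ℕ→ℚ (floor z) ℚ.+ 1ℚ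
floor-upper z = [ (λ eq → ℚₚ.≤-trans (proj₂ (archimedean z)) (subst (λ j → ℕ→ℚ j ℚ.≤ ℕ→ℚ (floor z) ℚ.+ 1ℚ) eq (p≤p+q (ℕ→ℚ (floor z)) 0≤1)))
                , (λ ¬≤ → subst (z ℚ.≤_) (ℕ→ℚ-suc (floor z)) (ℚₚ.<⇒≤ (ℚₚ.≰⇒> ¬≤)))
                ]′ (largest-maximal (λ j → ℕ→ℚ j ℚₚ.≤? z) (proj₁ (archimedean z)))

floor-lower : ∀ z → 0 ℕ.< floor z → ℕ→ℚ (floor z) ℚ.≤ z
floor-lower z 0<k = [ (λ k≡0 → contradiction (sym k≡0) (ℕₚ.<⇒≢ 0<k)) , (λ k≤z → k≤z) ]′
  (largest-holds (λ j → ℕ→ℚ j ℚₚ.≤? z) (proj₁ (archimedean z)))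

module _ (x : ℝ) where

  abstract

    index : ℕ
    index = proj₁ (cauchy x (1 /1000) (0< 1 /1000))

    -- Subtracting the accuracy 1 / 1000 before rounding keeps a positive result below `x` itself;
    -- in total at most 1.002 is lost.
    roundDown : ℕ
    roundDown = floor (approx x index ℚ.- 1 /1000)

    roundDown-upper : ∀ N → index ℕ.≤ N → approx x N ℚ.≤ ℕ→ℚ roundDown ℚ.+ 1002 /1000
    roundDown-upper N index≤N = ℚₚ.≤-trans (proj₂ (cauchy x (1 /1000) (0< 1 /1000)) N index index≤N ℕₚ.≤-refl)
      (certify ((ℕ→ℚ roundDown ℚ.+ 1ℚ) ℚ.- (approx x index ℚ.- 1 /1000)) (0≤diff (floor-upper (approx x index ℚ.- 1 /1000))) (ring (approx x index) (ℕ→ℚ roundDown)))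
      where
      ring : ∀ a k → (k ℚ.+ 1002 /1000) ℚ.- (a ℚ.+ 1 /1000) ≡ (k ℚ.+ 1ℚ) ℚ.- (a ℚ.- 1 /1000)
      ring = solve 2 (λ a k → (k :+ con (1002 /1000)) :- (a :+ con (1 /1000)) := (k :+ con 1ℚ) :- (a :- con (1 /1000))) refl

    roundDown-lower : 0 ℕ.< roundDown → ∀ N → index ℕ.≤ N → ℕ→ℚ roundDown ℚ.≤ approx x N
    roundDown-lower 0<k N index≤N = ℚₚ.≤-trans (floor-lower (approx x index ℚ.- 1 /1000) 0<k)
      (certify _ (0≤diff (proj₂ (cauchy x (1 /1000) (0< 1 /1000)) index N ℕₚ.≤-refl index≤N)) (ring (approx x index) (approx x N) (1 /1000)))
      where
      ring : ∀ a b e → b ℚ.- (a ℚ.- e) ≡ (b ℚ.+ e) ℚ.- a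
      ring = solve 3 (λ a b e → b :- (a :- e) := (b :+ e) :- a) refl

    upper : ℚ
    upper = approx x index ℚ.+ 1 /1000

    ≤upper : ∀ N → index ℕ.≤ N → approx x N ℚ.≤ upper
    ≤upper N index≤N = proj₂ (cauchy x (1 /1000) (0< 1 /1000)) N index index≤N ℕₚ.≤-refl

    upper≤ : ∀ N → index ℕ.≤ N → upper ℚ.≤ approx x N ℚ.+ 2 /1000
    upper≤ N index≤N = certify _ (0≤diff (proj₂ (cauchy x (1 /1000) (0< 1 /1000)) index N ℕₚ.≤-refl index≤N)) (ring (approx x index) (approx x N))
      where
      ring : ∀ a b → (b ℚ.+ 2 /1000) ℚ.- (a ℚ.+ 1 /1000) ≡ (b ℚ.+ 1 /1000) ℚ.- a
      ring = solve 2 (λ a b → (b :+ con (2 /1000)) :- (a :+ con (1 /1000)) := (b :+ con (1 /1000)) :- a) refl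

module Parameters (n lam-1 : ℕ) (c : ℝ) where

  lam : ℕ
  lam = suc lam-1

  cn : ℝ
  cn = c * fromℕ n

  ĉ : ℚ
  ĉ = upper c

  abstract

    -- As `b < 2 ^ b`, this many bits make the grid fine enough for `β-small`.
    precision : ∃ λ b → (ĉ ℚ.* ℕ→ℚ n ℚ.+ 1ℚ) ℚ.* (ℕ→ℚ 200 ℚ.* ℕ→ℚ lam) ℚ.≤ ℕ→ℚ b
    precision = archimedean _

  b : ℕ
  b = proj₁ precision

  bad? : ∀ j → Dec ((ℕ→ℚ j ℚ.* ½ ^ b) ^ lam ℚ.* (ĉ ℚ.* ℕ→ℚ n) ℚ.≤ 1370 /1000)
  bad? j = _ ℚₚ.≤? _

  -- The largest `q` on the grid that keeps survival within the budget 1.37, because a large `q` is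
  -- what makes truncation unlikely.
  j : ℕ
  j = largest bad? (2 ℕ.^ b)

  q : ℚ
  q = ℕ→ℚ j ℚ.* ½ ^ b

  K : ℝ
  K = root lam cn * ln cn

  k : ℕ
  k = roundDown K

  β : ℚ
  β = ½ ^ b

  i : ℚ
  i = 1/suc lam-1

  β-small : β ℚ.* (ĉ ℚ.* ℕ→ℚ n ℚ.+ 1ℚ) ℚ.≤ 5 /1000 ℚ.* i
  β-small = begin
    β ℚ.* h
      ≡⟨ trans (cong (β ℚ.* h ℚ.*_) one) (ℚₚ.*-identityʳ (β ℚ.* h)) ⟨
    β ℚ.* h ℚ.* ((ℕ→ℚ 200 ℚ.* 5 /1000) ℚ.* (i ℚ.* ℕ→ℚ lam))
      ≡⟨ ring β h (ℕ→ℚ 200) (5 /1000) i (ℕ→ℚ lam) ⟩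
    (h ℚ.* (ℕ→ℚ 200 ℚ.* ℕ→ℚ lam)) ℚ.* (β ℚ.* (5 /1000 ℚ.* i))
      ≤⟨ *-monoˡ (β ℚ.* (5 /1000 ℚ.* i)) (0≤* (0≤½^ b) (0≤* (0≤ 5 /1000) (ℚₚ.<⇒≤ (0<1/suc lam-1))))
           (ℚₚ.≤-trans (proj₂ precision) (ℕ→ℚ-mono (ℕₚ.<⇒≤ (n<2^n b)))) ⟩
    ℕ→ℚ (2 ℕ.^ b) ℚ.* (β ℚ.* (5 /1000 ℚ.* i))
      ≡⟨ trans (sym (ℚₚ.*-assoc (ℕ→ℚ (2 ℕ.^ b)) β (5 /1000 ℚ.* i)))
           (trans (cong (ℚ._* (5 /1000 ℚ.* i)) (½^-inverse b)) (ℚₚ.*-identityˡ (5 /1000 ℚ.* i))) ⟩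
    5 /1000 ℚ.* i ∎
    where
    open ℚₚ.≤-Reasoning
    h = ĉ ℚ.* ℕ→ℚ n ℚ.+ 1ℚ
    one : (ℕ→ℚ 200 ℚ.* 5 /1000) ℚ.* (i ℚ.* ℕ→ℚ lam) ≡ 1ℚ
    one = trans (cong₂ ℚ._*_ (from-yes (ℕ→ℚ 200 ℚ.* 5 /1000 ℚₚ.≟ 1ℚ)) (1/suc-inverse lam-1)) (ℚₚ.*-identityˡ 1ℚ)
    ring : ∀ β h t f i l → β ℚ.* h ℚ.* ((t ℚ.* f) ℚ.* (i ℚ.* l)) ≡ (h ℚ.* (t ℚ.* l)) ℚ.* (β ℚ.* (f ℚ.* i))
    ring = solve 6 (λ β h t f i l → β :* h :* ((t :* f) :* (i :* l)) := (h :* (t :* l)) :* (β :* (f :* i))) refl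
    n<2^n : ∀ m → m ℕ.< 2 ℕ.^ m
    n<2^n zero    = ℕₚ.≤-refl
    n<2^n (suc m) = ℕₚ.+-mono-≤ (ℕₚ.m^n>0 2 m) (subst (m ℕ.<_) (sym (ℕₚ.+-identityʳ (2 ℕ.^ m))) (n<2^n m))

  0≤q : 0ℚ ℚ.≤ q
  0≤q = 0≤* (0≤ℕ→ℚ j) (0≤½^ b)

  q≤1 : q ℚ.≤ 1ℚ
  q≤1 = subst (q ℚ.≤_) (½^-inverse b) (*-monoˡ (½ ^ b) (0≤½^ b) (ℕ→ℚ-mono (largest-≤ bad? (2 ℕ.^ b))))

  q-small : q ^ lam ℚ.* (ĉ ℚ.* ℕ→ℚ n) ℚ.≤ 1370 /1000
  q-small = [ zero-case , (λ holds → holds) ]′ (largest-holds bad? (2 ℕ.^ b))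
    where
    zero-case : j ≡ 0 → q ^ lam ℚ.* (ĉ ℚ.* ℕ→ℚ n) ℚ.≤ 1370 /1000
    zero-case j≡0 = subst (ℚ._≤ 1370 /1000) (sym (trans
      (cong (λ j → (ℕ→ℚ j ℚ.* ½ ^ b) ^ lam ℚ.* (ĉ ℚ.* ℕ→ℚ n)) j≡0) (ring (½ ^ b) ((ℕ→ℚ 0 ℚ.* ½ ^ b) ^ lam-1) (ĉ ℚ.* ℕ→ℚ n))))
      (0≤ 1370 /1000)
      where
      ring : ∀ h p a → 0ℚ ℚ.* h ℚ.* p ℚ.* a ≡ 0ℚ
      ring = solve 3 (λ h p a → con 0ℚ :* h :* p :* a := con 0ℚ) refl

  -- One grid step beyond the maximal `j` breaks the budget. If the search ends at `2 ^ b`, then `q`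
  -- is 1, and 7.8 exceeds the budget anyway.
  q-large : 7800 /1000 ℚ.≤ ĉ ℚ.* ℕ→ℚ n → 1370 /1000 ℚ.< (q ℚ.+ β) ^ lam ℚ.* (ĉ ℚ.* ℕ→ℚ n)
  q-large ĉn≥ = [ all-bad , some-good ]′ (largest-maximal bad? (2 ℕ.^ b))
    where
    open ℚₚ.≤-Reasoning
    all-bad : j ≡ 2 ℕ.^ b → 1370 /1000 ℚ.< (q ℚ.+ β) ^ lam ℚ.* (ĉ ℚ.* ℕ→ℚ n)
    all-bad j≡ = begin-strict
      1370 /1000                                 <⟨ from-yes (1370 /1000 ℚₚ.<? 7800 /1000) ⟩
      7800 /1000                                 ≤⟨ ĉn≥ ⟩
      ĉ ℚ.* ℕ→ℚ n                                ≡⟨ ℚₚ.*-identityˡ (ĉ ℚ.* ℕ→ℚ n) ⟨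
      1ℚ ℚ.* (ĉ ℚ.* ℕ→ℚ n)                       ≤⟨ *-monoˡ (ĉ ℚ.* ℕ→ℚ n) (ℚₚ.≤-trans (0≤ 7800 /1000) ĉn≥)
                                                     (1≤^ lam (subst (ℚ._≤ q ℚ.+ β) q≡1 (p≤p+q q (0≤½^ b)))) ⟩
      (q ℚ.+ β) ^ lam ℚ.* (ĉ ℚ.* ℕ→ℚ n)          ∎
      where
      q≡1 : q ≡ 1ℚ
      q≡1 = trans (cong (λ j → ℕ→ℚ j ℚ.* ½ ^ b) j≡) (½^-inverse b)
    some-good : ¬ ((ℕ→ℚ (suc j) ℚ.* ½ ^ b) ^ lam ℚ.* (ĉ ℚ.* ℕ→ℚ n) ℚ.≤ 1370 /1000) →
                1370 /1000 ℚ.< (q ℚ.+ β) ^ lam ℚ.* (ĉ ℚ.* ℕ→ℚ n)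
    some-good ¬bad = subst (λ w → 1370 /1000 ℚ.< w ^ lam ℚ.* (ĉ ℚ.* ℕ→ℚ n))
      (trans (cong (ℚ._* ½ ^ b) (ℕ→ℚ-suc j)) (ring (ℕ→ℚ j) (½ ^ b))) (ℚₚ.≰⇒> ¬bad)
      where
      ring : ∀ a h → (a ℚ.+ 1ℚ) ℚ.* h ≡ a ℚ.* h ℚ.+ h
      ring = solve 2 (λ a h → (a :+ con 1ℚ) :* h := a :* h :+ h) refl

  -- The parameters `k`, `q` and `ĉ` are fixed, and so is the failure bound; it suffices to prove it
  -- at one index where all approximations are good enough.
  module AtIndex (N : ℕ) (indexc≤N : index c ℕ.≤ N) (indexK≤N : index K ℕ.≤ N) (lam*16≤N : lam ℕ.* 16 ℕ.≤ N)
    (s-small : 1/suc N ℚ.≤ 1 /1000 ℚ.* i) (3≤c : 3000 /1000 ℚ.≤ approx c N)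
    (lam≤ln : ℕ→ℚ lam ℚ.≤ approx (ln (fromℕ n)) N ℚ.+ 1 /1000) where

    open ℚₚ.≤-Reasoning

    private
      module Ln   = Inversion exp-expanding
      module Root = Inversion (root-expanding lam-1) cn

    n′ = ℕ→ℚ n
    cN = approx c N
    zN = approx (ln (fromℕ n)) N
    lN = approx (ln cn) N
    xN = approx (root lam cn) N
    s = 1/suc N

    0≤s : 0ℚ ℚ.≤ s
    0≤s = ℚₚ.<⇒≤ (0<1/suc N)

    -- 16 h = 0.999 leaves room for the error 1 / 1000 in `lam≤ln`, and still (1 + h) ^ 16 ≥ 2.6.
    h : ℚ
    h = ℤ.+ 999 ℚ./ 16000

    0≤h : 0ℚ ℚ.≤ h
    0≤h = from-yes (0ℚ ℚₚ.≤? h)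

    1≤E^ : 1ℚ ℚ.≤ (2600 /1000) ^ lam
    1≤E^ = 1≤^ lam (from-yes (1ℚ ℚₚ.≤? 2600 /1000))

    lam*16h≤z : ℕ→ℚ (lam ℕ.* 16) ℚ.* h ℚ.≤ zN
    lam*16h≤z = begin
      ℕ→ℚ (lam ℕ.* 16) ℚ.* h
        ≡⟨ trans (cong (ℚ._* h) (ℕ→ℚ-* lam 16)) (ℚₚ.*-assoc (ℕ→ℚ lam) (ℕ→ℚ 16) h) ⟩
      ℕ→ℚ lam ℚ.* (ℕ→ℚ 16 ℚ.* h)
        ≡⟨ cong (ℕ→ℚ lam ℚ.*_) (from-yes (ℕ→ℚ 16 ℚ.* h ℚₚ.≟ 1ℚ ℚ.- 1 /1000)) ⟩
      ℕ→ℚ lam ℚ.* (1ℚ ℚ.- 1 /1000)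
        ≤⟨ certify ((ℕ→ℚ lam ℚ.- 1ℚ) ℚ.* 1 /1000 ℚ.+ ((zN ℚ.+ 1 /1000) ℚ.- ℕ→ℚ lam))
             (0≤+ (0≤* (0≤diff (ℕ→ℚ-mono {1} {lam} (ℕ.s≤s ℕ.z≤n))) (0≤ 1 /1000)) (0≤diff lam≤ln))
             (ring (ℕ→ℚ lam) zN (1 /1000)) ⟩
      zN ∎
      where
      ring : ∀ l z e → z ℚ.- l ℚ.* (1ℚ ℚ.- e) ≡ (l ℚ.- 1ℚ) ℚ.* e ℚ.+ ((z ℚ.+ e) ℚ.- l)
      ring = solve 3 (λ l z e → z :- l :* (con 1ℚ :- e) := (l :- con 1ℚ) :* e :+ ((z :+ e) :- l)) refl

    0≤l : 0ℚ ℚ.≤ lN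
    0≤l = Ln.0≤y cn N

    E^≤1⊔n : (2600 /1000) ^ lam ℚ.≤ 1ℚ ℚ.⊔ n′
    E^≤1⊔n = begin
      (2600 /1000) ^ lam
        ≤⟨ ^-mono lam (0≤ 2600 /1000) (from-yes (2600 /1000 ℚₚ.≤? (1ℚ ℚ.+ h) ^ 16)) ⟩
      ((1ℚ ℚ.+ h) ^ 16) ^ lam
        ≡⟨ ^-^ lam 16 (1ℚ ℚ.+ h) ⟩
      (1ℚ ℚ.+ h) ^ (lam ℕ.* 16)
        ≤⟨ expSum-lower (lam ℕ.* 16) 0 0≤h ⟩
      expSum (ℕ→ℚ (lam ℕ.* 16) ℚ.* h) (lam ℕ.* 16 ℕ.+ 0)
        ≤⟨ expSum-increasing (0≤* (0≤ℕ→ℚ (lam ℕ.* 16)) 0≤h)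
             (ℕₚ.≤-trans (ℕₚ.≤-reflexive (ℕₚ.+-identityʳ (lam ℕ.* 16))) (ℕₚ.≤-trans lam*16≤N (ℕₚ.n≤1+n N))) ⟩
      expSum (ℕ→ℚ (lam ℕ.* 16) ℚ.* h) (suc N)
        ≤⟨ expSum-mono (suc N) (0≤* (0≤ℕ→ℚ (lam ℕ.* 16)) 0≤h) lam*16h≤z ⟩
      expSum zN (suc N)
        ≤⟨ Ln.Fy≤t (fromℕ n) N ⟩
      1ℚ ℚ.⊔ n′ ∎

    -- The maximum with 1 stems from the clamping in `ln`; it cannot be 1, because 2.6 ^ λ > 1.
    n-large : (2600 /1000) ^ lam ℚ.≤ n′
    n-large = [ (λ eq → contradiction (ℚₚ.≤-<-trans (ℚₚ.≤-trans E^≤1⊔n (ℚₚ.≤-reflexive eq)) 1<E^) (ℚₚ.<-irrefl refl))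
              , (λ eq → ℚₚ.≤-trans E^≤1⊔n (ℚₚ.≤-reflexive eq)) ]′ (ℚₚ.⊔-sel 1ℚ n′)
      where
      1<E^ : 1ℚ ℚ.< (2600 /1000) ^ lam
      1<E^ = ℚₚ.<-≤-trans (from-yes (1ℚ ℚₚ.<? 2600 /1000)) (a≤a^suc lam-1 (from-yes (1ℚ ℚₚ.≤? 2600 /1000)))

    1≤n : 1ℚ ℚ.≤ n′
    1≤n = ℚₚ.≤-trans 1≤E^ n-large

    0≤c : 0ℚ ℚ.≤ cN
    0≤c = ℚₚ.≤-trans (0≤ 3000 /1000) 3≤c

    1≤c : 1ℚ ℚ.≤ cN
    1≤c = ℚₚ.≤-trans (from-yes (1ℚ ℚₚ.≤? 3000 /1000)) 3≤c

    n≤cn : n′ ℚ.≤ cN ℚ.* n′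
    n≤cn = subst (ℚ._≤ cN ℚ.* n′) (ℚₚ.*-identityˡ n′) (*-monoˡ n′ (ℚₚ.≤-trans 0≤1 1≤n) 1≤c)

    clamp-cn : 1ℚ ℚ.⊔ (cN ℚ.* n′) ≡ cN ℚ.* n′
    clamp-cn = ℚₚ.p≤q⇒p⊔q≡q (ℚₚ.≤-trans 1≤n n≤cn)

    cn≤exp : cN ℚ.* n′ ℚ.≤ expSum (lN ℚ.+ s) (suc N)
    cn≤exp = ℚₚ.≤-trans (ℚₚ.≤-reflexive (sym clamp-cn)) (Ln.t≤Fy′ cn N)

    lam≤l : ℕ→ℚ lam ℚ.≤ (lN ℚ.+ s) ℚ.+ 1 /1000
    lam≤l = ℚₚ.≤-trans lam≤ln (ℚₚ.+-monoˡ-≤ (1 /1000) (expSum-cancel-≤ N (0≤+ 0≤l 0≤s)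
      (ℚₚ.≤-trans (Ln.Fy≤t (fromℕ n) N) (ℚₚ.≤-trans (ℚₚ.≤-reflexive (ℚₚ.p≤q⇒p⊔q≡q 1≤n)) (ℚₚ.≤-trans n≤cn cn≤exp)))))

    1≤x : 1ℚ ℚ.≤ xN
    1≤x = p≤p+q 1ℚ (Root.0≤y N)

    x≤cn : xN ℚ.≤ cN ℚ.* n′
    x≤cn = ℚₚ.≤-trans (a≤a^suc lam-1 1≤x) (ℚₚ.≤-trans (Root.Fy≤t N) (ℚₚ.≤-reflexive clamp-cn))

    cn≤x^ : cN ℚ.* n′ ℚ.≤ (xN ℚ.+ s) ^ lam
    cn≤x^ = ℚₚ.≤-trans (ℚₚ.≤-reflexive (sym clamp-cn))
      (subst (λ w → 1ℚ ℚ.⊔ (cN ℚ.* n′) ℚ.≤ w ^ lam) (sym (ℚₚ.+-assoc 1ℚ (Root.y N) s)) (Root.t≤Fy′ N))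

    ĉn≥ : 7800 /1000 ℚ.≤ ĉ ℚ.* n′
    ĉn≥ = ℚₚ.≤-trans (from-yes (7800 /1000 ℚₚ.≤? 3000 /1000 ℚ.* 2600 /1000)) (ℚₚ.≤-trans
      (*-mono-≤ 0≤c (0≤ 2600 /1000) 3≤c (ℚₚ.≤-trans (a≤a^suc lam-1 (from-yes (1ℚ ℚₚ.≤? 2600 /1000))) n-large))
      (*-monoˡ n′ (ℚₚ.≤-trans 0≤1 1≤n) (≤upper c N indexc≤N)))

    open Tuning lam-1 N k cN ĉ n′ q β xN lN s 3≤c (≤upper c N indexc≤N) (upper≤ c N indexc≤N) n-large 0≤l 0≤s cn≤exp lam≤l
      1≤x x≤cn cn≤x^ 0≤q q≤1 (0≤½^ b) q-small (q-large ĉn≥) β-small s-small (roundDown-upper K N indexK≤N)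
      using (failure≤3; 0<k) public

-- The guarantees of the algorithm

recip-inverse : ∀ x N → approx (clamp x) N ℚ.* approx (recip x) N ≡ 1ℚ
recip-inverse x N = ℚₚ.*-inverseʳ (approx (clamp x) N) {{ℚ.>-nonZero (0<clamp x N)}}

0≤recip : ∀ x N → 0ℚ ℚ.≤ approx (recip x) N
0≤recip x N = ℚₚ.<⇒≤ (0<1/ (0<clamp x N))

≤3recip : ∀ x N {f B} → 0ℚ ℚ.≤ f → approx (clamp x) N ℚ.≤ B → f ℚ.* B ℚ.≤ 3000 /1000 → f ℚ.≤ ℕ→ℚ 3 ℚ.* approx (recip x) N
≤3recip x N {f} {B} 0≤f x≤B fB≤3 = begin
  f                                                       ≡⟨ trans (cong (f ℚ.*_) (recip-inverse x N)) (ℚₚ.*-identityʳ f) ⟨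
  f ℚ.* (approx (clamp x) N ℚ.* r)                        ≡⟨ ℚₚ.*-assoc f (approx (clamp x) N) r ⟨
  f ℚ.* approx (clamp x) N ℚ.* r                          ≤⟨ *-monoˡ r (0≤recip x N) (ℚₚ.≤-trans (*-monoʳ f 0≤f x≤B) fB≤3) ⟩
  3000 /1000 ℚ.* r                                        ≡⟨ cong (ℚ._* r) (from-yes (3000 /1000 ℚₚ.≟ ℕ→ℚ 3)) ⟩
  ℕ→ℚ 3 ℚ.* r                                             ∎
  where
  open ℚₚ.≤-Reasoning
  r = approx (recip x) N

fromℕ-*-≤ : ∀ m k (x y : ℝ) I → (∀ M → I ℕ.≤ M → ℕ→ℚ k ℚ.≤ approx x M ℚ.* approx y M) → fromℕ (m ℕ.* k) ≤ fromℕ m * x * y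
fromℕ-*-≤ m k x y I k≤ ε 0<ε = I , λ M I≤M → begin
  ℕ→ℚ (m ℕ.* k)                               ≡⟨ ℕ→ℚ-* m k ⟩
  ℕ→ℚ m ℚ.* ℕ→ℚ k                             ≤⟨ *-monoʳ (ℕ→ℚ m) (0≤ℕ→ℚ m) (k≤ M I≤M) ⟩
  ℕ→ℚ m ℚ.* (approx x M ℚ.* approx y M)       ≡⟨ ℚₚ.*-assoc (ℕ→ℚ m) (approx x M) (approx y M) ⟨
  ℕ→ℚ m ℚ.* approx x M ℚ.* approx y M         ≤⟨ p≤p+q _ (ℚₚ.<⇒≤ 0<ε) ⟩
  ℕ→ℚ m ℚ.* approx x M ℚ.* approx y M ℚ.+ ε   ∎
  where open ℚₚ.≤-Reasoning

-- The value at `lam = 0` is arbitrary. The predecessor of `k` is passed on, since `k` is known to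
-- be positive only under the hypotheses on `lam` and `c`.
decomposition : ∀ (n lam : ℕ) (c : ℝ) → Algorithm n
decomposition n zero        c = Decomposition.algorithm 0 0 0 0 n
decomposition n (suc lam-1) c = Decomposition.algorithm (suc lam-1) (ℕ.pred k) b j n
  where open Parameters n lam-1 c

-- A message has one bit besides its two identities. An edge forces n ≥ 2, so this bit fits into a
-- third word.
1≤log₂ : ∀ {n} (G : Graph n) {u v} → Adjacent G u v → 1 ℕ.≤ ⌈log₂ n ⌉
1≤log₂ {zero}        G {()}
1≤log₂ {suc zero}    G {zero} {zero} e = contradiction (subst T (adj-irrefl G zero) e) λ ()
1≤log₂ {suc (suc n)} G e = ⌈log₂⌉-mono-≤ {2} {suc (suc n)} (ℕ.s≤s (ℕ.s≤s ℕ.z≤n))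

module Conclusion (n : ℕ) (N : Network n) (lam-1 : ℕ) (c : ℝ)
  (lam≤ln : fromℕ (suc lam-1) ≤ ln (fromℕ n)) (3<c : fromℕ 3 < c) where

  open Parameters n lam-1 c
  open Decomposition lam (ℕ.pred k) b j using (algorithm; module Correctness)
  open Correctness N
  open Execution (algorithm n) N

  private
    small = 1/suc-small 1ℚ (1 /1000 ℚ.* i) 0≤1 (0<* (0< 1 /1000) (0<1/suc lam-1))
    I₀ I₁ I₂ I₃ : ℕ
    I₀ = proj₁ small
    I₁ = proj₁ (lam≤ln (1 /1000) (0< 1 /1000))
    I₂ = proj₁ (proj₂ (proj₂ 3<c))
    I₃ = index c ℕ.+ index K ℕ.+ lam ℕ.* 16

  large : ℕ
  large = (I₀ ℕ.+ I₁) ℕ.+ (I₂ ℕ.+ I₃)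

  I₀≤ : I₀ ℕ.≤ large
  I₀≤ = ℕₚ.m≤n⇒m≤n+o (I₂ ℕ.+ I₃) (ℕₚ.m≤m+n I₀ I₁)

  I₁≤ : I₁ ℕ.≤ large
  I₁≤ = ℕₚ.m≤n⇒m≤n+o (I₂ ℕ.+ I₃) (ℕₚ.m≤n+m I₁ I₀)

  I₂≤ : I₂ ℕ.≤ large
  I₂≤ = ℕₚ.m≤n⇒m≤o+n (I₀ ℕ.+ I₁) (ℕₚ.m≤m+n I₂ I₃)

  I₃≤ : I₃ ℕ.≤ large
  I₃≤ = ℕₚ.m≤n⇒m≤o+n (I₀ ℕ.+ I₁) (ℕₚ.m≤n+m I₃ I₂)

  3≤c-from : ∀ M → large ℕ.≤ M → 3000 /1000 ℚ.≤ approx c M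
  3≤c-from M large≤M = ℚₚ.≤-trans (ℚₚ.≤-reflexive (from-yes (3000 /1000 ℚₚ.≟ ℕ→ℚ 3)))
    (ℚₚ.≤-trans (p≤p+q (ℕ→ℚ 3) (ℚₚ.<⇒≤ (proj₁ (proj₂ 3<c)))) (proj₂ (proj₂ (proj₂ 3<c)) M (ℕₚ.≤-trans I₂≤ large≤M)))

  indexc≤ : index c ℕ.≤ large
  indexc≤ = ℕₚ.≤-trans (ℕₚ.m≤n⇒m≤n+o (lam ℕ.* 16) (ℕₚ.m≤m+n (index c) (index K))) I₃≤

  indexK≤ : index K ℕ.≤ large
  indexK≤ = ℕₚ.≤-trans (ℕₚ.m≤n⇒m≤n+o (lam ℕ.* 16) (ℕₚ.m≤n+m (index K) (index c))) I₃≤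

  open AtIndex large indexc≤ indexK≤ (ℕₚ.≤-trans (ℕₚ.m≤n+m (lam ℕ.* 16) (index c ℕ.+ index K)) I₃≤)
    (subst (ℚ._≤ 1 /1000 ℚ.* i) (ℚₚ.*-identityˡ (1/suc large)) (proj₂ small large I₀≤))
    (3≤c-from large ℕₚ.≤-refl)
    (proj₂ (lam≤ln (1 /1000) (0< 1 /1000)) large I₁≤)
    using (failure≤3; 0<k)

  suc-pred-k : suc (ℕ.pred k) ≡ k
  suc-pred-k = ℕₚ.suc-pred k {{ℕ.>-nonZero 0<k}}

  k≤K : ∀ M → large ℕ.≤ M → ℕ→ℚ (suc (ℕ.pred k)) ℚ.≤ approx (root lam cn) M ℚ.* approx (ln cn) M
  k≤K M large≤M = subst (λ k → ℕ→ℚ k ℚ.≤ approx K M) (sym suc-pred-k)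
    (roundDown-lower K 0<k M (ℕₚ.≤-trans indexK≤ large≤M))

  failure : ℕ → ℚ → ℚ
  failure k q = ℕ→ℚ n ℚ.* q ^ lam ℚ.+ geometricSum q lam ℚ.* (ℕ→ℚ n ℚ.* (1ℚ ℚ.- q) ^ k)

  0≤failure : 0ℚ ℚ.≤ failure k q
  0≤failure = 0≤+ (0≤* (0≤ℕ→ℚ n) (0≤^ lam 0≤q))
    (0≤* (0≤geometricSum lam 0≤q) (0≤* (0≤ℕ→ℚ n) (0≤^ k (0≤diff q≤1))))

  bad-probability : independent b fairCoin (𝟙 ∘ dyadic b j) ≡ q
  bad-probability = trans (Coins.dyadic-probability (algorithm n) N b j)
    (cong (λ j → ℕ→ℚ j ℚ.* ½ ^ b) (ℕₚ.m≤n⇒m⊓n≡m (largest-≤ bad? (2 ℕ.^ b))))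

  -- The left side varies with the approximation of `c`. As `ĉ` lies above all late approximations,
  -- the single bound `failure≤3` covers every one of them.
  succeeds : fromℕ 1 - fromℕ 3 * recip c ≤ fromℚ (probability complete)
  succeeds ε 0<ε = large , λ M large≤M → begin
    ℕ→ℚ 1 ℚ.- ℕ→ℚ 3 ℚ.* approx (recip c) M
      ≤⟨ ℚₚ.+-monoʳ-≤ 1ℚ (ℚₚ.neg-antimono-≤ (≤3recip c M 0≤failure (clamp≤ĉ M large≤M) failure≤3)) ⟩
    1ℚ ℚ.- failure k q
      ≡⟨ cong₂ (λ k q → 1ℚ ℚ.- failure k q) suc-pred-k bad-probability ⟨
    1ℚ ℚ.- failure (suc (ℕ.pred k)) (independent b fairCoin (𝟙 ∘ dyadic b j))
      ≤⟨ success-bound ⟩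
    probability complete
      ≤⟨ p≤p+q (probability complete) (ℚₚ.<⇒≤ 0<ε) ⟩
    probability complete ℚ.+ ε ∎
    where
    open ℚₚ.≤-Reasoning
    clamp≤ĉ : ∀ M → large ℕ.≤ M → approx (clamp c) M ℚ.≤ ĉ
    clamp≤ĉ M large≤M = ℚₚ.⊔-lub
      (ℚₚ.≤-trans (from-yes (1ℚ ℚₚ.≤? 3000 /1000)) (ℚₚ.≤-trans (3≤c-from M large≤M) c≤ĉ)) c≤ĉ
      where
      c≤ĉ : approx c M ℚ.≤ ĉ
      c≤ĉ = ≤upper c M (ℕₚ.≤-trans indexc≤ large≤M)

  diameter≤ : fromℕ (2 ℕ.* suc (ℕ.pred k)) ≤ fromℕ 2 * root lam cn * ln cn
  diameter≤ = fromℕ-*-≤ 2 (suc (ℕ.pred k)) (root lam cn) (ln cn) large k≤K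

  decomposes-probably : HoldsWithProbabilityAtLeast (fromℕ 1 - fromℕ 3 * recip c)
    (λ ω → IsStrongNetworkDecomposition (graph N) (clustering ω) (fromℕ 2 * root lam cn * ln cn) lam)
  decomposes-probably = complete , decomposes {fromℕ 2 * root lam cn * ln cn} diameter≤ , succeeds

  rounds≤ : fromℕ (rounds (algorithm n)) ≤ fromℕ lam * root lam cn * ln cn
  rounds≤ = fromℕ-*-≤ lam (suc (ℕ.pred k)) (root lam cn) (ln cn) large k≤K

  messages≤ : ∀ ω t u v → Adjacent (graph N) u v → length (message ω t u v) ℕ.≤ 3 ℕ.* ⌈log₂ n ⌉
  messages≤ ω t u v e = ℕₚ.≤-trans (message-length ω t u v)
    (subst (λ w → suc (⌈log₂ n ⌉ ℕ.+ ⌈log₂ n ⌉) ℕ.≤ ⌈log₂ n ⌉ ℕ.+ (⌈log₂ n ⌉ ℕ.+ w)) (sym (ℕₚ.+-identityʳ ⌈log₂ n ⌉))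
      (ℕₚ.+-monoˡ-≤ (⌈log₂ n ⌉ ℕ.+ ⌈log₂ n ⌉) (1≤log₂ (graph N) e)))

theorem3 :
    Σ (∀ (n lam : ℕ) (c : ℝ) → Algorithm n) λ algorithm →
    ∃ λ (words : ℕ) →
    ∀ (n : ℕ) (N : Network n) (lam : ℕ) .{{_ : NonZero lam}} (c : ℝ) →
    fromℕ lam ≤ ln (fromℕ n) →
    fromℕ 3 < c →
    let A  = algorithm n lam c
        cn = c * fromℕ n
        open Execution A N
    in
    HoldsWithProbabilityAtLeast
      (fromℕ 1 - fromℕ 3 * recip c)
      (λ ω → IsStrongNetworkDecomposition (graph N) (clustering ω)
               (fromℕ 2 * root lam cn * ln cn) lam)
    × fromℕ (rounds A) ≤ fromℕ lam * root lam cn * ln cn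
    × (∀ (ω : Outcome) (t : ℕ) → t ℕ.< rounds A →
       ∀ (u v : Fin n) → Adjacent (graph N) u v →
       length (message ω t u v) ℕ.≤ words ℕ.* ⌈log₂ n ⌉)
theorem3 = decomposition , 3 , λ where
  n N zero {{nonZero}} c _ _ → contradiction-irr nonZero λ ()
  n N (suc lam-1) c lam≤ln 3<c → let open Conclusion n N lam-1 c lam≤ln 3<c in
    decomposes-probably , rounds≤ , λ ω t _ → messages≤ ω t
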